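{- Let $q\in\{4,5\}$. There exists $R$ (depending only on $q$) such that for every integer $r\ge R$ and every set $\mathcal{C}=\{\mathcal{A}_1,\dots,\mathcal{A}_r\}$ of $r$ $\mathbb{F}_q$-affine hyperplanes of $\mathbb{F}_{q^r}$ in general position, the set $\mathcal{S}_\mathcal{C}^\ast=\mathbb{F}_{q^r}\setminus\bigcup_{i=1}^r\mathcal{A}_i$ contains a primitive element of $\mathbb{F}_{q^r}$.
   Context: $\mathbb{F}_{q^r}$ is viewed as an $r$-dimensional $\mathbb{F}_q$-vector space. A set $\{\mathcal{A}_1,\dots,\mathcal{A}_r\}$ of $\mathbb{F}_q$-affine hyperplanes is in general position if for every $1\le k\le r$ the intersection of any $k$ distinct members is an $\mathbb{F}_q$-affine subspace of dimension $r-k$. A primitive element of $\mathbb{F}_{q^r}$ is a generator of the cyclic group $\mathbb{F}_{q^r}^\ast$. -}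

module Defs where

open import Level using (0ℓ)
open import Algebra.Bundles using (CommutativeRing)
open import Data.Nat using (ℕ; zero; suc; _∸_; _≤_) renaming (_^_ to _^ℕ_)
open import Data.Fin using (Fin)
open import Data.Fin.Subset using (Subset; _∈_; ∣_∣)
open import Data.Product using (Σ; ∃; _×_; _,_)
open import Relation.Nullary using (¬_)
open import Relation.Binary using (Decidable)
open import Relation.Binary.PropositionalEquality using (_≡_)

record FiniteField (n : ℕ) : Set₁ where
  field
    commRing : CommutativeRing 0ℓ 0ℓ
  open CommutativeRing commRing public hiding (ring)
  field
    _≟_      : Decidable _≈_
    1≉0      : ¬ (1# ≈ 0#)
    inverse  : ∀ x → ¬ (x ≈ 0#) → ∃ λ y → (x * y) ≈ 1#
    enum     : Fin n → Carrier
    enum-inj : ∀ i j → enum i ≈ enum j → i ≡ j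
    enum-sur : ∀ x → ∃ λ i → enum i ≈ x

module _ {n : ℕ} (K : FiniteField n) where
  open FiniteField K

  pow : Carrier → ℕ → Carrier
  pow x zero    = 1#
  pow x (suc k) = x * pow x k

  Primitive : Carrier → Set
  Primitive g = ¬ (g ≈ 0#) × (∀ y → ¬ (y ≈ 0#) → ∃ λ k → pow g k ≈ y)

  -- the subfield F_q of K, for a prime power q, is {a ∈ K | a^q = a}
  InFq : ℕ → Carrier → Set
  InFq q a = pow a q ≈ a

  record FqFunctional (q : ℕ) : Set where
    field
      L        : Carrier → Carrier
      L-cong   : ∀ {x y} → x ≈ y → L x ≈ L y
      L-Fq     : ∀ x → InFq q (L x)
      L-add    : ∀ x y → L (x + y) ≈ (L x + L y)
      L-scal   : ∀ a x → InFq q a → L (a * x) ≈ (a * L x)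
      L-nonzero : ∃ λ x → ¬ (L x ≈ 0#)

  record AffineHyperplane (q : ℕ) : Set where
    field
      functional : FqFunctional q
      const      : Carrier
      const-Fq   : InFq q const
    open FqFunctional functional
    _∋_ : Carrier → Set
    _∋_ x = L x ≈ const

  open AffineHyperplane using (_∋_)

  InAll : {q r : ℕ} → (Fin r → AffineHyperplane q) → Subset r → Carrier → Set
  InAll A S x = ∀ i → i ∈ S → (A i ∋ x)

  HasSize : (Carrier → Set) → ℕ → Set
  HasSize P m = Σ (Fin m → Carrier) λ f →
      (∀ i → P (f i))
    × (∀ i j → f i ≈ f j → i ≡ j)
    × (∀ x → P x → ∃ λ i → f i ≈ x)

  -- General position: for every 1 ≤ k ≤ r, the intersection of any k
  -- distinct members is an F_q-affine subspace of dimension r - k.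
  -- (An intersection of affine hyperplanes is empty or an affine
  -- subspace; an F_q-affine subspace has dimension d iff it has q^d
  -- elements.)
  GeneralPosition : {q r : ℕ} → (Fin r → AffineHyperplane q) → Set
  GeneralPosition {q} {r} A =
    ∀ (S : Subset r) → 1 ≤ ∣ S ∣ → HasSize (InAll A S) (q ^ℕ (r ∸ ∣ S ∣))

  Avoids : {q r : ℕ} → (Fin r → AffineHyperplane q) → Carrier → Set
  Avoids {r = r} A x = ∀ (i : Fin r) → ¬ (A i ∋ x)

{-# OPTIONS --safe #-}
module Submission where

-- Write K for the field with Q = q^r elements. In coordinates dual to the hyperplanes, the points that
-- avoid all of them contain a sumset U + V, where U varies only the first 2r/3 coordinates and V only the
-- last r/3. For D d = Q − 1, the number of pairs with (u + v)^D = 1 is compared with |U||V|/d: by Hölder's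
-- inequality the deviation is controlled by the fourth moment of #{v : (x + v)^D = 1} − |V|/d over all x in K,
-- hence by the number of x for which (x + v₁)(x + v₄)/((x + v₂)(x + v₃)) is a d-th power.
-- Unless the vᵢ coincide in pairs, this number is at most Q/d + O(√Q) by Stepanov's method, in
-- Bombieri's form: Q = M M′ with x ↦ x^M additive, and the auxiliary function is an M-th root, so that no
-- derivatives are needed. The saving (9/8)^(r/3) for q = 4 beats the 2^O(ω(Q − 1)) terms of the sieve over the
-- primes dividing Q − 1, which are subexponential.

-- The sumset has about (q - 1)^r elements, short of Q by a fixed power. A second moment would need
-- |U||V| to exceed Q, which is out of reach. The fourth moment needs |U||V|² to exceed Q and |U| to
-- exceed √Q, up to constants and the loss of the sieve. With |U| near (q - 1)^(2s), |V| near (q -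
-- 1)^s and r near 3s, this means (q - 1)⁴ > q³ and (q - 1)² > q^(3/2): 81 > 64 and 9 > 8 for q = 4,
-- 256 > 125 and 16 > √125 for q = 5. For q = 3 the second comparison would be 4 against √27 and
-- fails. The smallest ratio, 9/8, sets the numerical estimates for both q. No characters occur: the
-- values (x + v)^D are d-th roots of unity, and comparing the sizes of fibres with their average
-- does the work of summing over characters. The estimate is uniform in d: the factor d³ from
-- Hölder's inequality and one factor d from the count match the fourth power of d in the normalised
-- deviation. Hence a single Λ bounds the deviation by |U||V|/Λ for every divisor d, as the sieve
-- requires.

open import Algebra.Structures using (IsCommutativeMonoid)
open import Relation.Binary.PropositionalEquality using (_≡_)
open import Data.Empty using (⊥-elim)
open import Data.Fin using (zero; suc; Fin; toℕ; combine; remQuot)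
open import Data.List
  using (List; []; _∷_; _++_; length; map; filter; cartesianProduct; cartesianProductWith; allFin; upTo)
open import Data.List.Membership.Propositional using (_∈_; find; lose)
open import Data.List.Membership.Propositional.Properties
  using (∈-∃++; ∈-map⁻; ∈-filter⁺; ∈-filter⁻; ∈-cartesianProductWith⁺; ∈-cartesianProductWith⁻;
         ∈-allFin; ∈-++⁺ˡ; ∈-++⁺ʳ; ∈-map⁺; ∈-cartesianProduct⁻; ∈-upTo⁺; ∈-upTo⁻)
open import Data.List.Properties
  using (length-++; ++-identityʳ; filter-all; length-map; length-upTo; length-filter; length-tabulate)
open import Data.List.Relation.Binary.Permutation.Propositional.Properties using (shift; ↭-length; ∈-resp-↭)
open import Data.List.Relation.Unary.All using (All; []; _∷_; all?)
open import Data.List.Relation.Unary.AllPairs using ([]; _∷_)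
open import Data.List.Relation.Unary.Any using (here; there; any?)
open import Data.List.Relation.Unary.Unique.Propositional using (Unique)
open import Data.Product using (∃; _,_; proj₁; proj₂; _×_; ∃₂)
open import Data.Sum using (inj₁; inj₂)
open import Function using (_∘_; id)
open import Relation.Binary using (tri<; tri≈; tri>)
open import Relation.Binary.Definitions using (DecidableEquality)
open import Relation.Nullary using (yes; no; ¬?; ¬_; Dec; does; _×-dec_; contradiction)
import Data.List.Relation.Unary.All as All
import Data.List.Relation.Unary.Unique.Propositional.Properties as Unique
import Data.Fin.Properties as Fin
import Data.Nat.Coprimality as Coprime

-- Finite sets as duplicate-free lists

module Lists where

  open import Data.List.Relation.Binary.Permutation.Propositional
    using (_↭_; ↭-refl; ↭-trans; prep)
  open import Data.Nat using (suc; _≤_; z≤n; s≤s)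
  open import Data.Nat.Properties using (≤-trans; ≤-reflexive; m≤m+n; m≢1+m+n; +-suc)
  open import Relation.Binary.PropositionalEquality using (_≡_; _≢_; refl; sym; trans; cong; subst)

  module _ {A : Set} where

    -- Keeping the complement `zs` lets one statement yield cardinality bounds, monotonicity of sums
    -- over subsets, and surjectivity by counting.
    unique-⊆⇒↭ : {xs ys : List A} → Unique xs → (∀ {x} → x ∈ xs → x ∈ ys) →
                 ∃ λ zs → ys ↭ xs ++ zs
    unique-⊆⇒↭ {[]}     {ys} _          _   = ys , ↭-refl
    unique-⊆⇒↭ {x ∷ xs} {ys} (x∉ ∷ uxs) sub with ∈-∃++ (sub (here refl))
    ... | as , bs , refl = zs , ↭-trans (shift x as bs) (prep x p)
      where
      strip : ∀ {z} → z ∈ xs → z ∈ as ++ bs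
      strip {z} z∈ with ∈-resp-↭ (shift x as bs) (sub (there z∈))
      ... | here refl = ⊥-elim (All.lookup x∉ z∈ refl)
      ... | there q   = q
      ih = unique-⊆⇒↭ uxs strip
      zs = proj₁ ih
      p  = proj₂ ih

    unique-⊆⇒≤ : {xs ys : List A} → Unique xs → (∀ {x} → x ∈ xs → x ∈ ys) → length xs ≤ length ys
    unique-⊆⇒≤ {xs} u s with unique-⊆⇒↭ u s
    ... | zs , p = ≤-trans (m≤m+n _ _) (≤-reflexive (sym (trans (↭-length p) (length-++ xs {zs}))))

    -- The source of all surjectivity by counting: an injective image of full size exhausts the
    -- target. It serves for the translations and dilations of the field, for the coordinate map,
    -- and for the powers of a generator.
    unique-⊆-length⇒↭ : {xs ys : List A} → Unique xs → (∀ {x} → x ∈ xs → x ∈ ys) →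
                        length xs ≡ length ys → ys ↭ xs
    unique-⊆-length⇒↭ {xs} u s eq with unique-⊆⇒↭ u s
    ... | []     , p = subst (_ ↭_) (++-identityʳ xs) p
    ... | z ∷ zs , p = ⊥-elim (m≢1+m+n (length xs)
      (trans eq (trans (↭-length p) (trans (length-++ xs {z ∷ zs}) (+-suc (length xs) (length zs))))))

    unique-map-∈ : {B : Set} {f : A → B} {xs : List A} →
                   (∀ {x y} → x ∈ xs → y ∈ xs → f x ≡ f y → x ≡ y) →
                   Unique xs → Unique (map f xs)
    unique-map-∈ {xs = []}     _   _        = []
    unique-map-∈ {f = f} {x ∷ xs} inj (x∉ ∷ u) =
      All.tabulate fresh ∷ unique-map-∈ (λ p q → inj (there p) (there q)) u
      where
      fresh : ∀ {z} → z ∈ map f xs → f x ≢ z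
      fresh z∈ eq with ∈-map⁻ f z∈
      ... | y , y∈ , refl = All.lookup x∉ y∈ (inj (here refl) (there y∈) eq)

    module _ (_≟_ : DecidableEquality A) where

      length≤1+filter-≢ : ∀ c {xs} → Unique xs → length xs ≤ suc (length (filter (λ x → ¬? (x ≟ c)) xs))
      length≤1+filter-≢ c {[]} _ = z≤n
      length≤1+filter-≢ c {x ∷ xs} (x∉ ∷ u) with x ≟ c
      ... | no _     = s≤s (length≤1+filter-≢ c u)
      ... | yes refl = s≤s (≤-reflexive (cong length (sym (filter-all (λ x → ¬? (x ≟ c)) (All.map (_∘ sym) x∉)))))

-- Finite sums and products in a commutative monoid

module BigOp {C : Set} {_∙_ : C → C → C} {ε : C}
             (isCM : IsCommutativeMonoid _≡_ _∙_ ε) where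

  open import Data.List.Relation.Binary.Permutation.Propositional
    using (_↭_; refl; prep; swap; trans)
  open import Relation.Binary.PropositionalEquality as ≡ using (_≢_; cong; cong₂; module ≡-Reasoning)
  open IsCommutativeMonoid isCM using (assoc; comm; identityˡ; identityʳ)

  ⨁ : {A : Set} → List A → (A → C) → C
  ⨁ []       f = ε
  ⨁ (x ∷ xs) f = f x ∙ ⨁ xs f

  private
    interchange : ∀ a b c d → (a ∙ b) ∙ (c ∙ d) ≡ (a ∙ c) ∙ (b ∙ d)
    interchange a b c d = begin
      (a ∙ b) ∙ (c ∙ d) ≡⟨ assoc a b (c ∙ d) ⟩
      a ∙ (b ∙ (c ∙ d)) ≡⟨ cong (a ∙_) (assoc b c d) ⟨
      a ∙ ((b ∙ c) ∙ d) ≡⟨ cong (λ e → a ∙ (e ∙ d)) (comm b c) ⟩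
      a ∙ ((c ∙ b) ∙ d) ≡⟨ cong (a ∙_) (assoc c b d) ⟩
      a ∙ (c ∙ (b ∙ d)) ≡⟨ assoc a c (b ∙ d) ⟨
      (a ∙ c) ∙ (b ∙ d) ∎
      where open ≡-Reasoning

  module _ {A : Set} where

    ⨁-cong-∈ : ∀ {xs} {f g : A → C} → (∀ {x} → x ∈ xs → f x ≡ g x) → ⨁ xs f ≡ ⨁ xs g
    ⨁-cong-∈ {[]}     eq = ≡.refl
    ⨁-cong-∈ {x ∷ xs} eq = cong₂ _∙_ (eq (here ≡.refl)) (⨁-cong-∈ (eq ∘ there))

    ⨁-cong : ∀ xs {f g : A → C} → (∀ x → f x ≡ g x) → ⨁ xs f ≡ ⨁ xs g
    ⨁-cong xs eq = ⨁-cong-∈ {xs} (λ {x} _ → eq x)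

    ⨁-ε : ∀ (xs : List A) → ⨁ xs (λ _ → ε) ≡ ε
    ⨁-ε []       = ≡.refl
    ⨁-ε (x ∷ xs) = ≡.trans (identityˡ _) (⨁-ε xs)

    ⨁-∙ : ∀ xs (f g : A → C) → ⨁ xs (λ x → f x ∙ g x) ≡ ⨁ xs f ∙ ⨁ xs g
    ⨁-∙ []       f g = ≡.sym (identityˡ ε)
    ⨁-∙ (x ∷ xs) f g = ≡.trans (cong ((f x ∙ g x) ∙_) (⨁-∙ xs f g)) (interchange _ _ _ _)

    ⨁-++ : ∀ xs ys (f : A → C) → ⨁ (xs ++ ys) f ≡ ⨁ xs f ∙ ⨁ ys f
    ⨁-++ []       ys f = ≡.sym (identityˡ _)
    ⨁-++ (x ∷ xs) ys f = ≡.trans (cong (f x ∙_) (⨁-++ xs ys f)) (≡.sym (assoc _ _ _))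

    ⨁-↭ : ∀ {xs ys} (f : A → C) → xs ↭ ys → ⨁ xs f ≡ ⨁ ys f
    ⨁-↭ f refl          = ≡.refl
    ⨁-↭ f (prep x p)    = cong (f x ∙_) (⨁-↭ f p)
    ⨁-↭ f (swap x y p)  = ≡.trans (≡.sym (assoc _ _ _))
      (≡.trans (cong₂ _∙_ (comm _ _) (⨁-↭ f p)) (assoc _ _ _))
    ⨁-↭ f (trans p q)   = ≡.trans (⨁-↭ f p) (⨁-↭ f q)

    ⨁-single : ∀ {xs x} {f : A → C} → Unique xs → x ∈ xs → (∀ y → y ≢ x → f y ≡ ε) → ⨁ xs f ≡ f x
    ⨁-single {x ∷ xs} {f = f} (x∉ ∷ u) (here ≡.refl) z = ≡.trans
      (cong (f x ∙_) (≡.trans (⨁-cong-∈ (λ {y} y∈ → z y (λ eq → All.lookup x∉ y∈ (≡.sym eq)))) (⨁-ε xs)))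
      (identityʳ (f x))
    ⨁-single {y ∷ xs} {x} {f} (y∉ ∷ u) (there x∈) z = ≡.trans
      (cong₂ _∙_ (z y (All.lookup y∉ x∈)) (⨁-single u x∈ z)) (identityˡ (f x))

    ⨁-map : ∀ {B : Set} (h : B → A) xs (f : A → C) → ⨁ (map h xs) f ≡ ⨁ xs (f ∘ h)
    ⨁-map h []       f = ≡.refl
    ⨁-map h (x ∷ xs) f = cong (f (h x) ∙_) (⨁-map h xs f)

  ⨁-swap : ∀ {A B : Set} (xs : List A) (ys : List B) (f : A → B → C) →
           ⨁ xs (λ x → ⨁ ys (f x)) ≡ ⨁ ys (λ y → ⨁ xs (λ x → f x y))
  ⨁-swap []       ys f = ≡.sym (⨁-ε ys)
  ⨁-swap (x ∷ xs) ys f = ≡.trans (cong (⨁ ys (f x) ∙_) (⨁-swap xs ys f)) (≡.sym (⨁-∙ ys _ _))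

  ⨁-× : ∀ {A B : Set} (xs : List A) (ys : List B) (f : A × B → C) →
        ⨁ (cartesianProduct xs ys) f ≡ ⨁ xs (λ x → ⨁ ys (λ y → f (x , y)))
  ⨁-× []       ys f = ≡.refl
  ⨁-× (x ∷ xs) ys f = ≡.trans (⨁-++ (map (x ,_) ys) _ f)
    (cong₂ _∙_ (⨁-map (x ,_) ys f) (⨁-× xs ys f))

-- Integer sums, indicators and quadratic deviation

module IntSum where

  open import Data.Bool using (if_then_else_)
  open import Data.Integer hiding (suc)
  open import Data.Integer.Properties
  open import Data.Integer.Tactic.RingSolver using (solve-∀)
  open import Data.Nat as ℕ using (ℕ; suc)
  open import Relation.Binary.PropositionalEquality

  open Lists

  open BigOp +-0-isCommutativeMonoid public renaming
    ( ⨁ to ∑; ⨁-cong to ∑-cong; ⨁-cong-∈ to ∑-cong-∈; ⨁-ε to ∑-0; ⨁-∙ to ∑-+; ⨁-++ to ∑-++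
    ; ⨁-↭ to ∑-↭; ⨁-map to ∑-map; ⨁-swap to ∑-swap; ⨁-× to ∑-×)

  0≤i*i : ∀ i → 0ℤ ≤ i * i
  0≤i*i (+ n)      = ≤-trans (+≤+ ℕ.z≤n) (≤-reflexive (pos-* n n))
  0≤i*i (-[1+ n ]) = +≤+ ℕ.z≤n

  *-mono-≤-nonNeg : ∀ {i j k l} → 0ℤ ≤ k → 0ℤ ≤ j → i ≤ j → k ≤ l → i * k ≤ j * l
  *-mono-≤-nonNeg {i} {j} {k} {l} 0≤k 0≤j i≤j k≤l = ≤-trans
    (*-monoʳ-≤-nonNeg k {{nonNegative 0≤k}} i≤j) (*-monoˡ-≤-nonNeg j {{nonNegative 0≤j}} k≤l)

  module _ {A : Set} where

    ∑-*ˡ : ∀ xs c (f : A → ℤ) → ∑ xs (λ x → c * f x) ≡ c * ∑ xs f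
    ∑-*ˡ []       c f = sym (*-zeroʳ c)
    ∑-*ˡ (x ∷ xs) c f = trans (cong (_+_ (c * f x)) (∑-*ˡ xs c f)) (sym (*-distribˡ-+ c (f x) (∑ xs f)))

    ∑-*ʳ : ∀ xs c (f : A → ℤ) → ∑ xs (λ x → f x * c) ≡ ∑ xs f * c
    ∑-*ʳ xs c f = trans (∑-cong xs (λ x → *-comm (f x) c)) (trans (∑-*ˡ xs c f) (*-comm c _))

    ∑-const : ∀ (xs : List A) c → ∑ xs (λ _ → c) ≡ + length xs * c
    ∑-const []       c = sym (*-zeroˡ c)
    ∑-const (x ∷ xs) c = trans (cong (_+_ c) (∑-const xs c)) (sym (suc-* (+ length xs) c))

    ∑-mono : ∀ {xs} {f g : A → ℤ} → (∀ {x} → x ∈ xs → f x ≤ g x) → ∑ xs f ≤ ∑ xs g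
    ∑-mono {[]}     le = ≤-refl
    ∑-mono {x ∷ xs} le = +-mono-≤ (le (here refl)) (∑-mono (le ∘ there))

    0≤∑ : ∀ {xs} {f : A → ℤ} → (∀ {x} → x ∈ xs → 0ℤ ≤ f x) → 0ℤ ≤ ∑ xs f
    0≤∑ {xs} nn = ≤-trans (≤-reflexive (sym (∑-0 xs))) (∑-mono nn)

    ∑-⊆-mono : ∀ {xs ys} {f : A → ℤ} → Unique xs → (∀ {x} → x ∈ xs → x ∈ ys) →
               (∀ x → 0ℤ ≤ f x) → ∑ xs f ≤ ∑ ys f
    ∑-⊆-mono {xs} {ys} {f} u s nn with unique-⊆⇒↭ u s
    ... | zs , p = begin
      ∑ xs f ≡⟨ +-identityʳ _ ⟨
      ∑ xs f + 0ℤ ≤⟨ +-monoʳ-≤ (∑ xs f) (0≤∑ {zs} (λ {x} _ → nn x)) ⟩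
      ∑ xs f + ∑ zs f ≡⟨ ∑-++ xs zs f ⟨
      ∑ (xs ++ zs) f ≡⟨ ∑-↭ f p ⟨
      ∑ ys f ∎
      where open ≤-Reasoning

    term≤∑ : ∀ {xs x} {f : A → ℤ} → x ∈ xs → (∀ x → 0ℤ ≤ f x) → f x ≤ ∑ xs f
    term≤∑ {x = x} {f} x∈ nn = ≤-trans (≤-reflexive (sym (+-identityʳ (f x))))
      (∑-⊆-mono {x ∷ []} (All.[] ∷ []) (λ { (here refl) → x∈ }) nn)

    -- The common expansion behind two inequalities: `cauchy-schwarz` takes α = |xs| and β = ∑ f,
    -- `fibre-deviation` takes α = d and β the number of points fibred.
    ∑-quadratic : ∀ xs α β γ (f : A → ℤ) →
      ∑ xs (λ x → (α * f x - β) * (α * f x - β) * γ) ≡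
      (α * α * ∑ xs (λ x → f x * f x) - + 2 * α * β * ∑ xs f + + length xs * (β * β)) * γ
    ∑-quadratic [] α β γ f = lem α β γ
      where
      lem : ∀ α β γ → 0ℤ ≡ (α * α * 0ℤ - + 2 * α * β * 0ℤ + 0ℤ * (β * β)) * γ
      lem = solve-∀
    ∑-quadratic (x ∷ xs) α β γ f = trans (cong (_+_ ((α * f x - β) * (α * f x - β) * γ)) (∑-quadratic xs α β γ f))
      (lem α β γ (f x) (∑ xs (λ x → f x * f x)) (∑ xs f) (+ length xs))
      where
      lem : ∀ α β γ a s t l → (α * a - β) * (α * a - β) * γ +
              (α * α * s - + 2 * α * β * t + l * (β * β)) * γ ≡
            (α * α * (a * a + s) - + 2 * α * β * (a + t) + (1ℤ + l) * (β * β)) * γ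
      lem = solve-∀

    -- With L = |xs| and S = ∑ f, the sum of the squares (L f - S)² equals L (L ∑ f² - S²); the
    -- factor L is cancelled, which is why the empty list is separate.
    cauchy-schwarz : ∀ xs (f : A → ℤ) →
      ∑ xs f * ∑ xs f ≤ + length xs * ∑ xs (λ x → f x * f x)
    cauchy-schwarz [] f = ≤-refl
    cauchy-schwarz xs@(_ ∷ ys) f =
      *-cancelˡ-≤-pos _ _ L (0≤i-j⇒j≤i (≤-trans
        (0≤∑ {xs} (λ {x} _ → subst (0ℤ ≤_) (sym (*-identityʳ _)) (0≤i*i (L * f x - S))))
        (≤-reflexive (trans (∑-quadratic xs L S 1ℤ f) (lem L S (∑ xs (λ x → f x * f x)))))))
      where
      L S : ℤ
      L = + suc (length ys)
      S = ∑ xs f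
      lem : ∀ L S T → (L * L * T - + 2 * L * S * S + L * (S * S)) * 1ℤ ≡ L * (L * T) - L * (S * S)
      lem = solve-∀

  𝟙 : {P : Set} → Dec P → ℤ
  𝟙 p = if does p then 1ℤ else 0ℤ

  0≤𝟙 : {P : Set} (p : Dec P) → 0ℤ ≤ 𝟙 p
  0≤𝟙 (yes _) = +≤+ ℕ.z≤n
  0≤𝟙 (no _)  = +≤+ ℕ.z≤n

  𝟙-yes : {P : Set} (p : Dec P) → P → 𝟙 p ≡ 1ℤ
  𝟙-yes (yes _) _ = refl
  𝟙-yes (no ¬a) a = ⊥-elim (¬a a)

  𝟙-no : {P : Set} (p : Dec P) → ¬ P → 𝟙 p ≡ 0ℤ
  𝟙-no (yes a) ¬a = ⊥-elim (¬a a)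
  𝟙-no (no _)  _  = refl

  𝟙-mono : {P Q : Set} (p : Dec P) (q : Dec Q) → (P → Q) → 𝟙 p ≤ 𝟙 q
  𝟙-mono (yes a) q f = ≤-reflexive (sym (𝟙-yes q (f a)))
  𝟙-mono (no _)  q f = 0≤𝟙 q

  𝟙-cong : {P Q : Set} (p : Dec P) (q : Dec Q) → (P → Q) → (Q → P) → 𝟙 p ≡ 𝟙 q
  𝟙-cong p q f g = ≤-antisym (𝟙-mono p q f) (𝟙-mono q p g)

  ∑-𝟙 : {A : Set} {P : A → Set} (P? : ∀ x → Dec (P x)) → ∀ xs →
        ∑ xs (λ x → 𝟙 (P? x)) ≡ + length (filter P? xs)
  ∑-𝟙 P? [] = refl
  ∑-𝟙 P? (x ∷ xs) with P? x
  ... | yes _ = cong (_+_ 1ℤ) (∑-𝟙 P? xs)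
  ... | no  _ = trans (+-identityˡ _) (∑-𝟙 P? xs)

  module _ {A : Set} (_≟_ : DecidableEquality A) where

    ∑-sift : ∀ {xs a} (f : A → ℤ) → Unique xs → a ∈ xs → ∑ xs (λ c → 𝟙 (a ≟ c) * f c) ≡ f a
    ∑-sift {x ∷ xs} {a} f (x∉ ∷ u) (here refl) = trans
      (cong₂ _+_ (trans (cong (_* f a) (𝟙-yes (a ≟ a) refl)) (*-identityˡ (f a)))
        (trans (∑-cong-∈ (λ {c} c∈ → trans (cong (_* f c) (𝟙-no (a ≟ c) (All.lookup x∉ c∈))) (*-zeroˡ (f c)))) (∑-0 xs)))
      (+-identityʳ (f a))
    ∑-sift {x ∷ xs} {a} f (x∉ ∷ u) (there a∈) = trans
      (cong₂ _+_ (trans (cong (_* f x) (𝟙-no (a ≟ x) (All.lookup x∉ a∈ ∘ sym))) (*-zeroˡ (f x)))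
        (∑-sift f u a∈))
      (+-identityˡ (f a))

    -- Compares the fibre sizes w c of g with their average: one term of Σ_c (d w(c) − |B|)²
    -- is at most the whole sum.
    fibre-deviation : ∀ {B : Set} {G : List A} → Unique G → (bs : List B) (g : B → A) →
      (∀ {b} → b ∈ bs → g b ∈ G) → ∀ {e} → e ∈ G → ∀ {d} → length G ℕ.≤ d →
      let w = λ c → ∑ bs (λ b → 𝟙 (g b ≟ c)); L = + length bs; D = + d in
      (D * w e - L) * (D * w e - L) ≤ D * (D * ∑ bs (λ b → w (g b)) - L * L)
    fibre-deviation {B} {G} uG bs g g∈ {e} e∈ {d} G≤d = begin
      (D * w e - L) * (D * w e - L) ≡⟨ *-identityʳ _ ⟨
      (D * w e - L) * (D * w e - L) * 1ℤ ≤⟨ term≤∑ e∈ (λ c → subst (0ℤ ≤_) (sym (*-identityʳ _)) (0≤i*i (D * w c - L))) ⟩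
      ∑ G (λ c → (D * w c - L) * (D * w c - L) * 1ℤ)
        ≡⟨ ∑-quadratic G D L 1ℤ w ⟩
      (D * D * ∑ G (λ c → w c * w c) - + 2 * D * L * ∑ G w + + length G * (L * L)) * 1ℤ
        ≡⟨ cong₂ (λ s t → (D * D * s - + 2 * D * L * t + + length G * (L * L)) * 1ℤ) ∑w² ∑w ⟩
      (D * D * N - + 2 * D * L * L + + length G * (L * L)) * 1ℤ
        ≡⟨ *-identityʳ _ ⟩
      D * D * N - + 2 * D * L * L + + length G * (L * L)
        ≤⟨ +-monoʳ-≤ (D * D * N - + 2 * D * L * L) (*-monoʳ-≤-nonNeg (L * L) {{nonNegative (0≤i*i L)}} (+≤+ G≤d)) ⟩
      D * D * N - + 2 * D * L * L + D * (L * L) ≡⟨ lem D L N ⟩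
      D * (D * N - L * L) ∎
      where
      open ≤-Reasoning
      w : A → ℤ
      w c = ∑ bs (λ b → 𝟙 (g b ≟ c))
      L D N : ℤ
      L = + length bs
      D = + d
      N = ∑ bs (λ b → w (g b))
      lem : ∀ D L N → D * D * N - + 2 * D * L * L + D * (L * L) ≡ D * (D * N - L * L)
      lem = solve-∀
      sifted : ∀ f → ∑ G (λ c → w c * f c) ≡ ∑ bs (λ b → f (g b))
      sifted f = trans (∑-cong G (λ c → sym (∑-*ʳ bs (f c) _)))
        (trans (∑-swap G bs _) (∑-cong-∈ (λ b∈ → ∑-sift f uG (g∈ b∈))))
      ∑w² : ∑ G (λ c → w c * w c) ≡ N
      ∑w² = sifted w
      ∑w : ∑ G w ≡ L
      ∑w = trans (∑-cong G (λ c → sym (*-identityʳ (w c))))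
        (trans (sifted (λ _ → 1ℤ)) (trans (∑-const bs 1ℤ) (*-identityʳ L)))

-- Finite fields: Lagrange, Frobenius, roots of polynomials

module Field where

  import Algebra.Properties.CommutativeSemiring.Exp as Exp
  import Algebra.Properties.Ring as RingProperties
  import Algebra.Properties.Semiring.Mult as Mult
  import Algebra.Solver.Ring.NaturalCoefficients.Default as SemiringSolver
  open import Algebra.Bundles using (CommutativeRing)
  open import Algebra.Structures using (IsCommutativeRing)
  open import Data.Nat as ℕ using (ℕ; zero; suc; z≤n; s≤s)
  import Data.Nat.Properties as ℕ
  open import Data.Vec using (Vec; []; _∷_)
  open import Level using (0ℓ)
  open import Relation.Binary.PropositionalEquality hiding ([_])

  open Lists

  record FinField : Set₁ where
    infixl 6 _+_
    infixl 7 _*_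
    field
      F   : Set
      _+_ _*_ : F → F → F
      -_  : F → F
      0# 1# : F
      isCommutativeRing : IsCommutativeRing _≡_ _+_ _*_ -_ 0# 1#
      _≟_ : DecidableEquality F
      1≢0 : 1# ≢ 0#
      inv : F → F
      *-inv : ∀ x → x ≢ 0# → x * inv x ≡ 1#
      els : List F
      els-unique : Unique els
      els-complete : ∀ x → x ∈ els

  module FieldTheory (𝔽 : FinField) where
    open FinField 𝔽 public

    commutativeRing : CommutativeRing 0ℓ 0ℓ
    commutativeRing = record { isCommutativeRing = isCommutativeRing }

    open CommutativeRing commutativeRing public
      using ( +-assoc; +-comm; +-identityˡ; +-identityʳ; *-assoc; *-comm; *-identityˡ; *-identityʳ
            ; distribˡ; distribʳ; zeroˡ; zeroʳ; -‿inverseˡ; -‿inverseʳ; commutativeSemiring; semiring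
            ; +-isCommutativeMonoid; *-isCommutativeMonoid; ring)
    open Exp commutativeSemiring public using (_^_; ^-homo-*; ^-assocʳ; ^-distrib-*)
    open Mult semiring public using (×1-homo-*) renaming (_×_ to _×′_)
    open RingProperties ring public using (+-cancelˡ; +-cancelʳ)
    open SemiringSolver commutativeSemiring public using (solve; _:=_; _:+_; _:*_; con)
    open BigOp +-isCommutativeMonoid public
    private
      module Π = BigOp *-isCommutativeMonoid

    *-cancelˡ-0 : ∀ {x y} → x ≢ 0# → x * y ≡ 0# → y ≡ 0#
    *-cancelˡ-0 {x} {y} x≢0 xy≡0 = begin
      y ≡⟨ *-identityˡ y ⟨
      1# * y ≡⟨ cong (_* y) (trans (*-comm (inv x) x) (*-inv x x≢0)) ⟨
      inv x * x * y ≡⟨ *-assoc _ _ _ ⟩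
      inv x * (x * y) ≡⟨ cong (inv x *_) xy≡0 ⟩
      inv x * 0# ≡⟨ zeroʳ _ ⟩
      0# ∎
      where open ≡-Reasoning

    *-cancelˡ : ∀ {x y z} → x ≢ 0# → x * y ≡ x * z → y ≡ z
    *-cancelˡ {x} {y} {z} x≢0 eq = begin
      y ≡⟨ move y ⟩
      inv x * (x * y) ≡⟨ cong (inv x *_) eq ⟩
      inv x * (x * z) ≡⟨ move z ⟨
      z ∎
      where
      open ≡-Reasoning
      move : ∀ y → y ≡ inv x * (x * y)
      move y = sym (trans (sym (*-assoc _ _ _))
        (trans (cong (_* y) (trans (*-comm (inv x) x) (*-inv x x≢0))) (*-identityˡ y)))

    *-≢0 : ∀ {x y} → x ≢ 0# → y ≢ 0# → x * y ≢ 0#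
    *-≢0 x≢0 y≢0 = y≢0 ∘ *-cancelˡ-0 x≢0

    ^-≢0 : ∀ {x} n → x ≢ 0# → x ^ n ≢ 0#
    ^-≢0 zero    x≢0 = 1≢0
    ^-≢0 (suc n) x≢0 = *-≢0 x≢0 (^-≢0 n x≢0)

    ^≡0⇒≡0 : ∀ {x} n → x ^ n ≡ 0# → x ≡ 0#
    ^≡0⇒≡0 {x} n eq with x ≟ 0#
    ... | yes x≡0 = x≡0
    ... | no  x≢0 = ⊥-elim (^-≢0 n x≢0 eq)

    1^ : ∀ n → 1# ^ n ≡ 1#
    1^ zero    = refl
    1^ (suc n) = trans (*-identityˡ _) (1^ n)

    0^ : ∀ n .{{_ : ℕ.NonZero n}} → 0# ^ n ≡ 0#
    0^ (suc n) = zeroˡ _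

    ⨁-*ˡ : {A : Set} (xs : List A) (c : F) (f : A → F) → ⨁ xs (λ x → c * f x) ≡ c * ⨁ xs f
    ⨁-*ˡ []       c f = sym (zeroʳ c)
    ⨁-*ˡ (x ∷ xs) c f = trans (cong (c * f x +_) (⨁-*ˡ xs c f)) (sym (distribˡ c (f x) _))

    units : List F
    units = filter (λ x → ¬? (x ≟ 0#)) els

    ∈units : ∀ {x} → x ≢ 0# → x ∈ units
    ∈units {x} = ∈-filter⁺ (λ x → ¬? (x ≟ 0#)) (els-complete x)

    ∈units⇒≢0 : ∀ {x} → x ∈ units → x ≢ 0#
    ∈units⇒≢0 x∈ = proj₂ (∈-filter⁻ (λ x → ¬? (x ≟ 0#)) {xs = els} x∈)

    units-unique : Unique units
    units-unique = Unique.filter⁺ (λ x → ¬? (x ≟ 0#)) els-unique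

    length-units : suc (length units) ≡ length els
    length-units = ℕ.≤-antisym
      (unique-⊆⇒≤ {xs = 0# ∷ units} (All.tabulate (λ x∈ eq → ∈units⇒≢0 x∈ (sym eq)) ∷ units-unique)
        (λ {x} _ → els-complete x))
      (length≤1+filter-≢ _≟_ 0# els-unique)

    -- Multiplication by x permutes the units, so their product P satisfies P x^n = P, and P can be
    -- cancelled.
    lagrange : ∀ {x} → x ≢ 0# → x ^ length units ≡ 1#
    lagrange {x} x≢0 = *-cancelˡ (Π-≢0 units ∈units⇒≢0) (begin
      Π.⨁ units (λ y → y) * x ^ length units ≡⟨ *-comm _ _ ⟩
      x ^ length units * Π.⨁ units (λ y → y) ≡⟨ Π-scale units ⟨
      Π.⨁ units (λ y → x * y) ≡⟨ Π.⨁-map (x *_) units (λ y → y) ⟨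
      Π.⨁ (map (x *_) units) (λ y → y) ≡⟨ Π.⨁-↭ (λ y → y) (unique-⊆-length⇒↭ (Unique.map⁺ (*-cancelˡ x≢0) units-unique) closed (length-map _ units)) ⟨
      Π.⨁ units (λ y → y) ≡⟨ *-identityʳ _ ⟨
      Π.⨁ units (λ y → y) * 1# ∎)
      where
      open ≡-Reasoning
      Π-≢0 : ∀ xs → (∀ {x} → x ∈ xs → x ≢ 0#) → Π.⨁ xs (λ y → y) ≢ 0#
      Π-≢0 []       _  = 1≢0
      Π-≢0 (x ∷ xs) nz = *-≢0 (nz (here refl)) (Π-≢0 xs (nz ∘ there))
      Π-scale : ∀ xs → Π.⨁ xs (λ y → x * y) ≡ x ^ length xs * Π.⨁ xs (λ y → y)
      Π-scale []       = sym (*-identityˡ 1#)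
      Π-scale (y ∷ ys) = trans (cong (x * y *_) (Π-scale ys))
        (solve 4 (λ a b c d → a :* b :* (c :* d) := a :* c :* (b :* d)) refl x y _ _)
      closed : ∀ {z} → z ∈ map (x *_) units → z ∈ units
      closed z∈ with ∈-map⁻ (x *_) z∈
      ... | y , y∈ , refl = ∈units (*-≢0 x≢0 (∈units⇒≢0 y∈))

    x^|F|≡x : ∀ x → x ^ length els ≡ x
    x^|F|≡x x rewrite sym length-units with x ≟ 0#
    ... | yes refl = zeroˡ _
    ... | no x≢0   = trans (cong (x *_) (lagrange x≢0)) (*-identityʳ x)

    -- The additive counterpart of `lagrange`: y ↦ 1 + y permutes the field, so the sum of all
    -- elements absorbs |F| copies of 1.
    |F|×1≡0 : length els ×′ 1# ≡ 0#
    |F|×1≡0 = +-cancelʳ (⨁ els (λ y → y)) _ _ (begin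
      length els ×′ 1# + ⨁ els (λ y → y) ≡⟨ cong (_+ ⨁ els (λ y → y)) (⨁-1 els) ⟨
      ⨁ els (λ _ → 1#) + ⨁ els (λ y → y) ≡⟨ ⨁-∙ els _ _ ⟨
      ⨁ els (λ y → 1# + y) ≡⟨ ⨁-map (1# +_) els (λ y → y) ⟨
      ⨁ (map (1# +_) els) (λ y → y) ≡⟨ ⨁-↭ (λ y → y) (unique-⊆-length⇒↭ (Unique.map⁺ (+-cancelˡ 1# _ _) els-unique) (λ {x} _ → els-complete x) (length-map _ els)) ⟨
      ⨁ els (λ y → y) ≡⟨ +-identityˡ _ ⟨
      0# + ⨁ els (λ y → y) ∎)
      where
      open ≡-Reasoning
      ⨁-1 : ∀ {A : Set} (xs : List A) → ⨁ xs (λ _ → 1#) ≡ length xs ×′ 1#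
      ⨁-1 []       = refl
      ⨁-1 (x ∷ xs) = cong (1# +_) (⨁-1 xs)

    -- The multiple |F| · 1 = q^r · 1 is the r-th power of q · 1, and a field has no nilpotents.
    -- This extracts the characteristic from the cardinality alone.
    q×1≡0 : ∀ q r → length els ≡ q ℕ.^ r → q ×′ 1# ≡ 0#
    q×1≡0 q r eq = ^≡0⇒≡0 r (trans (sym (homo r)) (trans (cong (_×′ 1#) (sym eq)) |F|×1≡0))
      where
      homo : ∀ r → (q ℕ.^ r) ×′ 1# ≡ (q ×′ 1#) ^ r
      homo zero    = +-identityʳ 1#
      homo (suc r) = trans (×1-homo-* q (q ℕ.^ r)) (cong (q ×′ 1# *_) (homo r))

    Additive : ℕ → Set
    Additive M = ∀ x y → (x + y) ^ M ≡ x ^ M + y ^ M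

    frobenius₂ : 2 ×′ 1# ≡ 0# → Additive 2
    frobenius₂ eq x y = begin
      (x + y) ^ 2 ≡⟨ solve 2 (λ x y → (x :+ y) :* ((x :+ y) :* con 1)
        := (x :* (x :* con 1) :+ y :* (y :* con 1)) :+ (con 1 :+ (con 1 :+ con 0)) :* (x :* y)) refl x y ⟩
      x ^ 2 + y ^ 2 + 2 ×′ 1# * (x * y) ≡⟨ cong (λ c → x ^ 2 + y ^ 2 + c * (x * y)) eq ⟩
      x ^ 2 + y ^ 2 + 0# * (x * y) ≡⟨ cong (x ^ 2 + y ^ 2 +_) (zeroˡ _) ⟩
      x ^ 2 + y ^ 2 + 0# ≡⟨ +-identityʳ _ ⟩
      x ^ 2 + y ^ 2 ∎
      where open ≡-Reasoning

    -- The inner binomial coefficients 5, 10, 10, 5 share the factor 5; `mixed` is the quotient.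
    frobenius₅ : 5 ×′ 1# ≡ 0# → Additive 5
    frobenius₅ eq x y = begin
      (x + y) ^ 5 ≡⟨ solve 2 (λ x y →
           let p = λ z → z :* (z :* (z :* (z :* (z :* con 1))))
               a = x :* x :* x :* x :* y
               b = x :* x :* x :* y :* y
               c = x :* x :* y :* y :* y
               d = x :* y :* y :* y :* y in
           p (x :+ y) := (p x :+ p y) :+ (con 1 :+ (con 1 :+ (con 1 :+ (con 1 :+ (con 1 :+ con 0)))))
             :* (a :+ (b :+ b) :+ (c :+ c) :+ d)) refl x y ⟩
      x ^ 5 + y ^ 5 + 5 ×′ 1# * mixed ≡⟨ cong (λ c → x ^ 5 + y ^ 5 + c * mixed) eq ⟩
      x ^ 5 + y ^ 5 + 0# * mixed ≡⟨ cong (x ^ 5 + y ^ 5 +_) (zeroˡ _) ⟩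
      x ^ 5 + y ^ 5 + 0# ≡⟨ +-identityʳ _ ⟩
      x ^ 5 + y ^ 5 ∎
      where
      open ≡-Reasoning
      x⁴y x³y² x²y³ xy⁴ mixed : F
      x⁴y   = x * x * x * x * y
      x³y²  = x * x * x * y * y
      x²y³  = x * x * y * y * y
      xy⁴   = x * y * y * y * y
      mixed = x⁴y + (x³y² + x³y²) + (x²y³ + x²y³) + xy⁴

    Additive-^ : ∀ {p} → Additive p → ∀ k → Additive (p ℕ.^ k)
    Additive-^ {p} add zero    x y = trans (*-identityʳ _) (sym (cong₂ _+_ (*-identityʳ x) (*-identityʳ y)))
    Additive-^ {p} add (suc k) x y = begin
      (x + y) ^ (p ℕ.* p ℕ.^ k) ≡⟨ ^-assocʳ _ p _ ⟨
      ((x + y) ^ p) ^ (p ℕ.^ k) ≡⟨ cong (_^ (p ℕ.^ k)) (add x y) ⟩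
      (x ^ p + y ^ p) ^ (p ℕ.^ k) ≡⟨ Additive-^ add k _ _ ⟩
      (x ^ p) ^ (p ℕ.^ k) + (y ^ p) ^ (p ℕ.^ k) ≡⟨ cong₂ _+_ (^-assocʳ x p _) (^-assocʳ y p _) ⟩
      x ^ (p ℕ.* p ℕ.^ k) + y ^ (p ℕ.* p ℕ.^ k) ∎
      where open ≡-Reasoning

    Additive-⨁ : ∀ {M} .{{_ : ℕ.NonZero M}} → Additive M → {A : Set} (xs : List A) (f : A → F) →
                 ⨁ xs f ^ M ≡ ⨁ xs (λ x → f x ^ M)
    Additive-⨁ {M} add []       f = 0^ M
    Additive-⨁ {M} add (x ∷ xs) f = trans (add (f x) _) (cong (f x ^ M +_) (Additive-⨁ add xs f))

    eval : ∀ {n} → Vec F n → F → F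
    eval []       x = 0#
    eval (c ∷ cs) x = c + x * eval cs x

    -- n counts the coefficients, so the degree is less than n.
    Poly : ℕ → (F → F) → Set
    Poly n f = ∃ λ (cs : Vec F n) → ∀ x → f x ≡ eval cs x

    Poly-cong : ∀ {n f g} → (∀ x → f x ≡ g x) → Poly n g → Poly n f
    Poly-cong eq (cs , h) = cs , λ x → trans (eq x) (h x)

    Poly-0 : ∀ n → Poly n (λ _ → 0#)
    Poly-0 zero    = [] , λ _ → refl
    Poly-0 (suc n) with Poly-0 n
    ... | cs , h = 0# ∷ cs , λ x → sym (trans (+-identityˡ _) (trans (cong (x *_) (sym (h x))) (zeroʳ x)))

    Poly-const : ∀ c → Poly 1 (λ _ → c)
    Poly-const c = c ∷ [] , λ x → sym (trans (cong (c +_) (zeroʳ x)) (+-identityʳ c))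

    Poly-shift : ∀ {n f} → Poly n f → Poly (suc n) (λ x → x * f x)
    Poly-shift (cs , h) = 0# ∷ cs , λ x → trans (cong (x *_) (h x)) (sym (+-identityˡ _))

    Poly-weaken : ∀ {m n f} → m ℕ.≤ n → Poly m f → Poly n f
    Poly-weaken {n = n} z≤n ([] , h) = Poly-cong h (Poly-0 n)
    Poly-weaken (s≤s m≤n) (c ∷ cs , h) with Poly-weaken m≤n (cs , λ _ → refl)
    ... | ds , k = c ∷ ds , λ x → trans (h x) (cong (λ t → c + x * t) (k x))

    Poly-+ : ∀ {n f g} → Poly n f → Poly n g → Poly n (λ x → f x + g x)
    Poly-+ ([] , h) ([] , k) = [] , λ x → trans (cong₂ _+_ (h x) (k x)) (+-identityˡ 0#)
    Poly-+ (c ∷ cs , h) (d ∷ ds , k) with Poly-+ (cs , λ _ → refl) (ds , λ _ → refl)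
    ... | es , l = (c + d) ∷ es , λ x → trans (cong₂ _+_ (h x) (k x))
      (trans (solve 5 (λ c d x s t → (c :+ x :* s) :+ (d :+ x :* t) := (c :+ d) :+ x :* (s :+ t)) refl c d x _ _)
        (cong (λ t → c + d + x * t) (l x)))

    Poly-scale : ∀ {n f} c → Poly n f → Poly n (λ x → c * f x)
    Poly-scale c ([] , h) = [] , λ x → trans (cong (c *_) (h x)) (zeroʳ c)
    Poly-scale c (d ∷ ds , h) with Poly-scale c (ds , λ _ → refl)
    ... | es , l = c * d ∷ es , λ x → trans (cong (c *_) (h x))
      (trans (solve 4 (λ c d x s → c :* (d :+ x :* s) := c :* d :+ x :* (c :* s)) refl c d x _)
        (cong (λ t → c * d + x * t) (l x)))

    Poly-* : ∀ {m n f g} → Poly (suc m) f → Poly (suc n) g → Poly (suc (m ℕ.+ n)) (λ x → f x * g x)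
    Poly-* {zero} {n} {f} {g} (c ∷ [] , h) pg = Poly-cong
      (λ x → cong (_* g x) (trans (h x) (trans (cong (c +_) (zeroʳ x)) (+-identityʳ c)))) (Poly-scale c pg)
    Poly-* {suc m} {n} {f} {g} (c ∷ cs , h) pg = Poly-cong
      (λ x → trans (cong (_* g x) (h x))
        (solve 4 (λ c x s t → (c :+ x :* s) :* t := c :* t :+ x :* (s :* t)) refl c x _ _))
      (Poly-+ (Poly-weaken (s≤s (ℕ.m≤n+m n (suc m))) (Poly-scale c pg))
        (Poly-shift (Poly-* (cs , λ _ → refl) pg)))

    Poly-^ : ∀ {m f} k → Poly (suc m) f → Poly (suc (k ℕ.* m)) (λ x → f x ^ k)
    Poly-^ zero    pf = Poly-const 1#
    Poly-^ (suc k) pf = Poly-* pf (Poly-^ k pf)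

    Poly-X+ : ∀ a → Poly 2 (λ x → x + a)
    Poly-X+ a = a ∷ 1# ∷ [] , λ x →
      solve 2 (λ x a → x :+ a := a :+ x :* (con 1 :+ x :* con 0)) refl x a

    Poly-⨁ : ∀ {A : Set} {n} (xs : List A) {f : A → F → F} → (∀ {a} → a ∈ xs → Poly n (f a)) →
             Poly n (λ x → ⨁ xs (λ a → f a x))
    Poly-⨁ {n = n} []       p = Poly-0 n
    Poly-⨁         (a ∷ xs) p = Poly-+ (p (here refl)) (Poly-⨁ xs (p ∘ there))

    -- Division by X − a, with both sides moved so that no subtraction occurs.
    divide : ∀ {n} (cs : Vec F (suc n)) a → ∃ λ (qs : Vec F n) →
             ∀ x → eval cs x + a * eval qs x ≡ eval cs a + x * eval qs x
    divide {zero}  (c ∷ []) a = [] , λ x →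
      solve 3 (λ c x a → (c :+ x :* con 0) :+ a :* con 0 := (c :+ a :* con 0) :+ x :* con 0) refl c x a
    divide {suc n} (c ∷ cs) a with divide cs a
    ... | qs , h = eval cs a ∷ qs , λ x → begin
      c + x * eval cs x + a * (eval cs a + x * eval qs x)
        ≡⟨ solve 6 (λ c x a s t q → c :+ x :* s :+ a :* (t :+ x :* q) := c :+ a :* t :+ x :* (s :+ a :* q))
             refl c x a _ _ _ ⟩
      c + a * eval cs a + x * (eval cs x + a * eval qs x)
        ≡⟨ cong (λ t → c + a * eval cs a + x * t) (h x) ⟩
      c + a * eval cs a + x * (eval cs a + x * eval qs x) ∎
      where open ≡-Reasoning

    *-cancelʳ-≢ : ∀ {x y z} → x ≢ y → x * z ≡ y * z → z ≡ 0#
    *-cancelʳ-≢ {x} {y} {z} x≢y eq with z ≟ 0#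
    ... | yes z≡0 = z≡0
    ... | no  z≢0 = ⊥-elim (x≢y (*-cancelˡ z≢0 (trans (*-comm z x) (trans eq (*-comm y z)))))

    -- Nonvanishing is required at a point y and not of the coefficients, because a nonzero
    -- polynomial such as X^|F| - X can be the zero function. The point y survives the induction:
    -- dividing by X - a leaves a quotient that is still nonzero at y.
    roots≤degree : ∀ {n f} → Poly (suc n) f → ∀ {y} → f y ≢ 0# → ∀ {xs} → Unique xs →
                   (∀ {x} → x ∈ xs → f x ≡ 0#) → length xs ℕ.≤ n
    roots≤degree pf fy≢0 {[]} _ _ = z≤n
    roots≤degree {zero} {f} (c ∷ [] , h) {y} fy≢0 {a ∷ _} _ root =
      ⊥-elim (fy≢0 (trans (const y) (trans (sym (const a)) (root (here refl)))))
      where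
      const : ∀ x → f x ≡ c
      const x = trans (h x) (trans (cong (c +_) (zeroʳ x)) (+-identityʳ c))
    roots≤degree {suc n} {f} (cs , h) {y} fy≢0 {a ∷ xs} (a∉ ∷ u) root with divide cs a
    ... | qs , d = s≤s (roots≤degree {n} (qs , λ _ → refl) {y} qy≢0 u qroot)
      where
      open ≡-Reasoning
      step : ∀ x → f x + a * eval qs x ≡ x * eval qs x
      step x = begin
        f x + a * eval qs x ≡⟨ cong (_+ a * eval qs x) (h x) ⟩
        eval cs x + a * eval qs x ≡⟨ d x ⟩
        eval cs a + x * eval qs x ≡⟨ cong (_+ x * eval qs x) (trans (sym (h a)) (root (here refl))) ⟩
        0# + x * eval qs x ≡⟨ +-identityˡ _ ⟩
        x * eval qs x ∎
      qy≢0 : eval qs y ≢ 0#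
      qy≢0 eq = fy≢0 (begin
        f y ≡⟨ trans (cong (f y +_) (trans (cong (a *_) eq) (zeroʳ a))) (+-identityʳ _) ⟨
        f y + a * eval qs y ≡⟨ step y ⟩
        y * eval qs y ≡⟨ trans (cong (y *_) eq) (zeroʳ y) ⟩
        0# ∎)
      qroot : ∀ {x} → x ∈ xs → eval qs x ≡ 0#
      qroot {x} x∈ = *-cancelʳ-≢ (All.lookup a∉ x∈)
        (trans (sym (trans (cong (_+ a * eval qs x) (root (there x∈))) (+-identityˡ _))) (step x))

    private
      ⊖ : F
      ⊖ = - 1#

    -- Applies `roots≤degree` to X^d - 1, whose value at 0 is -1.
    roots-unity≤ : ∀ d .{{_ : ℕ.NonZero d}} {xs} → Unique xs → (∀ {x} → x ∈ xs → x ^ d ≡ 1#) → length xs ℕ.≤ d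
    roots-unity≤ d u root = roots≤degree
      (Poly-+ (Poly-weaken (s≤s (ℕ.≤-reflexive (ℕ.*-identityʳ d))) (Poly-^ d (Poly-cong (λ x → sym (+-identityʳ x)) (Poly-X+ 0#))))
              (Poly-weaken (s≤s z≤n) (Poly-const ⊖)))
      {0#} at0≢0 u
      (λ {x} x∈ → trans (cong (_+ ⊖) (root x∈)) (-‿inverseʳ 1#))
      where
      at0≢0 : 0# ^ d + ⊖ ≢ 0#
      at0≢0 eq = 1≢0 (begin
        1# ≡⟨ +-identityʳ 1# ⟨
        1# + 0# ≡⟨ cong (1# +_) (trans (sym eq) (trans (cong (_+ ⊖) (0^ d)) (+-identityˡ ⊖))) ⟩
        1# + ⊖ ≡⟨ -‿inverseʳ 1# ⟩
        0# ∎)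
        where open ≡-Reasoning

    -- The nonzero solutions of x^(q+1) = x are q-th roots of unity.
    fixed≤ : ∀ q .{{_ : ℕ.NonZero q}} {xs} → Unique xs → (∀ {x} → x ∈ xs → x ^ suc q ≡ x) → length xs ℕ.≤ suc q
    fixed≤ q {xs} u fix = ℕ.≤-trans (length≤1+filter-≢ _≟_ 0# u)
      (s≤s (roots-unity≤ q (Unique.filter⁺ ≢0? u) root))
      where
      ≢0? = λ x → ¬? (x ≟ 0#)
      root : ∀ {x} → x ∈ filter ≢0? xs → x ^ q ≡ 1#
      root {x} x∈ with ∈-filter⁻ ≢0? {xs = xs} x∈
      ... | x∈xs , x≢0 = *-cancelˡ x≢0 (trans (fix x∈xs) (sym (*-identityʳ x)))

-- Pigeonhole principle and products of finite sets

module Choices where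

  open import Data.List.Relation.Unary.Unique.Propositional.Properties using (cartesianProductWith⁺)
  open import Data.Nat using (zero; suc; _+_; _*_; _^_; _≤_; _<_)
  open import Data.Nat.Properties using (<⇒≱)
  open import Data.Vec using (Vec; []; _∷_; lookup; replicate)
  open import Data.Vec.Properties using (∷-injective)
  open import Relation.Binary.PropositionalEquality hiding ([_])

  open Lists

  pigeonhole : {A B : Set} → DecidableEquality A → DecidableEquality B → (f : A → B) →
               ∀ {xs ys} → Unique xs → (∀ {x} → x ∈ xs → f x ∈ ys) → length ys < length xs →
               ∃₂ λ x y → x ≢ y × f x ≡ f y
  pigeonhole _≟_ _≟′_ f {xs} {ys} u sub lt
    with any? (λ x → any? (λ y → ¬? (x ≟ y) ×-dec (f x ≟′ f y)) xs) xs
  ... | yes p with find p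
  ...   | x , _ , q with find q
  ...     | y , _ , r = x , y , r
  pigeonhole _≟_ _≟′_ f {xs} {ys} u sub lt | no ¬p =
    ⊥-elim (<⇒≱ lt (subst (λ n → n ≤ length ys) (length-map f xs)
      (unique-⊆⇒≤ (unique-map-∈ inj u) images)))
    where
    inj : ∀ {x y} → x ∈ xs → y ∈ xs → f x ≡ f y → x ≡ y
    inj {x} {y} x∈ y∈ eq with x ≟ y
    ... | yes x≡y = x≡y
    ... | no  x≢y = ⊥-elim (¬p (lose x∈ (lose y∈ (x≢y , eq))))
    images : ∀ {z} → z ∈ map f xs → z ∈ ys
    images z∈ with ∈-map⁻ f z∈
    ... | x , x∈ , refl = sub x∈

  length-cartesianProductWith : {A B C : Set} (f : A → B → C) → ∀ xs ys →
    length (cartesianProductWith f xs ys) ≡ length xs * length ys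
  length-cartesianProductWith f []       ys = refl
  length-cartesianProductWith f (x ∷ xs) ys = trans (length-++ (map (f x) ys))
    (cong₂ _+_ (length-map (f x) ys) (length-cartesianProductWith f xs ys))

  module _ {A : Set} where

    choices : ∀ {n} → Vec (List A) n → List (Vec A n)
    choices []       = [] ∷ []
    choices (l ∷ ls) = cartesianProductWith _∷_ l (choices ls)

    choices-unique : ∀ {n} (ls : Vec (List A) n) → (∀ i → Unique (lookup ls i)) → Unique (choices ls)
    choices-unique [] u = [] ∷ []
    choices-unique (l ∷ ls) u =
      cartesianProductWith⁺ _∷_ ∷-injective (u zero) (choices-unique ls (u ∘ suc))

    ∈-choices⁺ : ∀ {n} (ls : Vec (List A) n) {v} → (∀ i → lookup v i ∈ lookup ls i) → v ∈ choices ls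
    ∈-choices⁺ [] {[]}    h = here refl
    ∈-choices⁺ (l ∷ ls) {x ∷ v} h = ∈-cartesianProductWith⁺ _∷_ (h zero) (∈-choices⁺ ls (h ∘ suc))

    ∈-choices⁻ : ∀ {n} (ls : Vec (List A) n) {v} → v ∈ choices ls → ∀ i → lookup v i ∈ lookup ls i
    ∈-choices⁻ (l ∷ ls) v∈ i with ∈-cartesianProductWith⁻ _∷_ l (choices ls) v∈
    ∈-choices⁻ (l ∷ ls) v∈ zero    | x , v , x∈ , v∈′ , refl = x∈
    ∈-choices⁻ (l ∷ ls) v∈ (suc i) | x , v , x∈ , v∈′ , refl = ∈-choices⁻ ls v∈′ i

    length-choices-∷ : ∀ {n} l (ls : Vec (List A) n) → length (choices (l ∷ ls)) ≡ length l * length (choices ls)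
    length-choices-∷ l ls = length-cartesianProductWith _∷_ l (choices ls)

    length-choices-replicate : ∀ n l → length (choices (replicate n l)) ≡ length l ^ n
    length-choices-replicate zero    l = refl
    length-choices-replicate (suc n) l =
      trans (length-choices-∷ l (replicate n l)) (cong (length l *_) (length-choices-replicate n l))

-- Linear dependence of polynomials of small degree

module LinDep where

  open import Data.Nat as ℕ using (ℕ; zero; suc)
  import Data.Nat.Properties as ℕ
  open import Data.Vec using (Vec; []; _∷_; lookup; replicate)
  open import Data.Vec.Properties using (lookup-replicate; ≡-dec)
  open import Relation.Binary.PropositionalEquality hiding ([_])

  open Lists
  open Choices
  open Field

  module _ (𝔽 : FinField) where
    open FieldTheory 𝔽

    vectors : ∀ n → List (Vec F n)
    vectors n = choices (replicate n els)

    differ : ∀ {n} (v w : Vec F n) → v ≢ w → ∃ λ i → lookup v i ≢ lookup w i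
    differ []      []      v≢w = ⊥-elim (v≢w refl)
    differ (x ∷ v) (y ∷ w) v≢w with x ≟ y
    ... | no  x≢y  = zero , x≢y
    ... | yes refl with differ v w (v≢w ∘ cong (x ∷_))
    ...   | i , h = suc i , h

    private
      combination : ∀ {T N} (g : Fin T → F → F) → (∀ t → Poly N (g t)) → (cs : Vec F T) →
                    Poly N (λ x → ⨁ (allFin T) (λ t → lookup cs t * g t x))
      combination {T} g pg cs = Poly-⨁ (allFin T) (λ {t} _ → Poly-scale (lookup cs t) (pg t))

    1<|F| : 1 ℕ.< length els
    1<|F| = unique-⊆⇒≤ {xs = 0# ∷ 1# ∷ []} (((1≢0 ∘ sym) ∷ []) ∷ [] ∷ []) (λ {x} _ → els-complete x)

    -- Counting replaces elimination: the |F|^T linear combinations have only |F|^N possible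
    -- coefficient vectors, so two of them agree, and their difference is the relation.
    linear-dependence : ∀ {T N} (g : Fin T → F → F) → (∀ t → Poly N (g t)) → N ℕ.< T →
      ∃ λ (c : Fin T → F) → (∃ λ t → c t ≢ 0#) × (∀ x → ⨁ (allFin T) (λ t → c t * g t x) ≡ 0#)
    linear-dependence {T} {N} g pg N<T
      with pigeonhole (≡-dec _≟_) (≡-dec _≟_) (proj₁ ∘ combination g pg)
             {vectors T} {vectors N}
             (choices-unique (replicate T els) (λ i → subst Unique (sym (lookup-replicate i els)) els-unique))
             (λ {v} _ → ∈-choices⁺ (replicate N els) (λ i → subst (lookup (proj₁ (combination g pg v)) i ∈_) (sym (lookup-replicate i els)) (els-complete _)))
             (subst₂ ℕ._<_ (sym (length-choices-replicate N els)) (sym (length-choices-replicate T els))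
               (ℕ.^-monoʳ-< (length els) 1<|F| N<T))
    ... | cs , ds , cs≢ds , eq = (λ t → lookup cs t + - lookup ds t) , (t₀ , nz) , vanish
      where
      dif = differ cs ds cs≢ds
      t₀ = proj₁ dif
      nz : lookup cs t₀ + - lookup ds t₀ ≢ 0#
      nz e = proj₂ dif (+-cancelʳ (- lookup ds t₀) _ _ (trans e (sym (-‿inverseʳ _))))
      comb = combination g pg
      vanish : ∀ x → ⨁ (allFin T) (λ t → (lookup cs t + - lookup ds t) * g t x) ≡ 0#
      vanish x = +-cancelʳ (⨁ (allFin T) (λ t → lookup ds t * g t x)) _ _ (begin
        ⨁ ts (λ t → (lookup cs t + - lookup ds t) * g t x) + ⨁ ts (λ t → lookup ds t * g t x)
          ≡⟨ ⨁-∙ ts _ _ ⟨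
        ⨁ ts (λ t → (lookup cs t + - lookup ds t) * g t x + lookup ds t * g t x)
          ≡⟨ ⨁-cong ts (λ t → pointwise (lookup cs t) (lookup ds t) (g t x)) ⟩
        ⨁ ts (λ t → lookup cs t * g t x) ≡⟨ proj₂ (comb cs) x ⟩
        eval (proj₁ (comb cs)) x ≡⟨ cong (λ v → eval v x) eq ⟩
        eval (proj₁ (comb ds)) x ≡⟨ proj₂ (comb ds) x ⟨
        ⨁ ts (λ t → lookup ds t * g t x) ≡⟨ +-identityˡ _ ⟨
        0# + ⨁ ts (λ t → lookup ds t * g t x) ∎)
        where
        open ≡-Reasoning
        ts = allFin T
        pointwise : ∀ a b z → (a + - b) * z + b * z ≡ a * z
        pointwise a b z = trans (sym (distribʳ z _ _)) (cong (_* z)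
          (trans (+-assoc a _ b) (trans (cong (a +_) (-‿inverseˡ b)) (+-identityʳ a))))

-- Exponents of the auxiliary function

module Exponents where

  open import Data.Nat
  open import Data.Nat.Properties
  open import Data.Nat.DivMod using (_/_; _%_; m≡m%n+[m/n]*n; m%n<n)
  open import Data.Nat.Tactic.RingSolver using (solve-∀)
  open import Relation.Binary.PropositionalEquality
  open import Relation.Unary using (Decidable)

  argmin : ∀ {n} {P : Fin n → Set} (P? : Decidable P) (w : Fin n → ℕ) {t} → P t →
           ∃ λ t₀ → P t₀ × (∀ t → P t → w t₀ ≤ w t)
  argmin {n} {P} P? w {t} pt = search (suc (w t)) pt ≤-refl
    where
    search : ∀ fuel {t} → P t → w t < fuel → ∃ λ t₀ → P t₀ × (∀ t → P t → w t₀ ≤ w t)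
    search (suc fuel) {t} pt lt with Fin.any? (λ s → P? s ×-dec (w s <? w t))
    ... | yes (s , ps , ws<wt) = search fuel ps (<-≤-trans ws<wt (≤-pred lt))
    ... | no none = t , pt , λ s ps → ≮⇒≥ (λ ws<wt → none (s , ps , ws<wt))

  -- M κ(i) is the least multiple of M that is at least D i, so the M-th power of A^κ(i) differs from (A^D)^i
  -- only by the factor A^ρ(i), of bounded degree.
  module _ (D M : ℕ) .{{_ : NonZero M}} where

    κ : ℕ → ℕ
    κ i = (D * i + pred M) / M

    ρ : ℕ → ℕ
    ρ i = M * κ i ∸ D * i

    private
      bound : ∀ i → D * i + pred M < M + M * κ i
      bound i = begin-strict
        D * i + pred M ≡⟨ m≡m%n+[m/n]*n (D * i + pred M) M ⟩
        (D * i + pred M) % M + κ i * M <⟨ +-monoˡ-< (κ i * M) (m%n<n (D * i + pred M) M) ⟩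
        M + κ i * M ≡⟨ cong (M +_) (*-comm (κ i) M) ⟩
        M + M * κ i ∎
        where open ≤-Reasoning

    D*i≤M*κ : ∀ i → D * i ≤ M * κ i
    D*i≤M*κ i = +-cancelʳ-≤ M _ _ (begin
      D * i + M ≡⟨ cong (D * i +_) (suc-pred M) ⟨
      D * i + suc (pred M) ≡⟨ +-suc (D * i) (pred M) ⟩
      suc (D * i + pred M) ≤⟨ bound i ⟩
      M + M * κ i ≡⟨ +-comm M _ ⟩
      M * κ i + M ∎)
      where open ≤-Reasoning

    M*κ<D*i+M : ∀ i → M * κ i < D * i + M
    M*κ<D*i+M i = begin-strict
      M * κ i ≡⟨ *-comm M (κ i) ⟩
      κ i * M ≤⟨ m≤n+m (κ i * M) _ ⟩
      (D * i + pred M) % M + κ i * M ≡⟨ m≡m%n+[m/n]*n (D * i + pred M) M ⟨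
      D * i + pred M <⟨ +-monoʳ-< (D * i) (≤-reflexive (suc-pred M)) ⟩
      D * i + M ∎
      where open ≤-Reasoning

    M*κ≡D*i+ρ : ∀ i → M * κ i ≡ D * i + ρ i
    M*κ≡D*i+ρ i = sym (m+[n∸m]≡n (D*i≤M*κ i))

    ρ≤M : ∀ i → ρ i ≤ M
    ρ≤M i = m≤n+o⇒m∸n≤o (M * κ i) (D * i) (<⇒≤ (M*κ<D*i+M i))

    -- D i grows by D ≥ M l at each step, so the quotient rounded up grows by at least l. The gap is
    -- the room in which the small exponent l of Stepanov's monomials varies.
    κ-step : ∀ {l} → M * l ≤ D → ∀ i → κ i + l ≤ κ (suc i)
    κ-step {l} Ml≤D i = ≤-pred (*-cancelˡ-< M _ _ (begin-strict
      M * (κ i + l) ≡⟨ *-distribˡ-+ M (κ i) l ⟩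
      M * κ i + M * l <⟨ +-mono-<-≤ (M*κ<D*i+M i) Ml≤D ⟩
      D * i + M + D ≡⟨ lem D i M ⟩
      D * suc i + M ≤⟨ +-monoˡ-≤ M (D*i≤M*κ (suc i)) ⟩
      M * κ (suc i) + M ≡⟨ +-comm _ M ⟩
      M + M * κ (suc i) ≡⟨ *-suc M _ ⟨
      M * suc (κ (suc i)) ∎))
      where
      open ≤-Reasoning
      lem : ∀ D i M → D * i + M + D ≡ D * suc i + M
      lem = solve-∀

    κ-< : ∀ {l} → M * l ≤ D → ∀ {i j} → i < j → κ i + l ≤ κ j
    κ-< {l} h {i} {suc j} (s≤s i≤j) with m≤n⇒m<n∨m≡n i≤j
    ... | inj₂ refl = κ-step h i
    ... | inj₁ i<j  = ≤-trans (κ-< h i<j) (≤-trans (m≤m+n (κ j) l) (κ-step h j))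

    -- Applied with D d = Q - 1 and M N = Q, it keeps all the exponents κ within M′.
    κ≤ : ∀ {d N} → D * d < M * N → κ d ≤ N
    κ≤ {d} {N} h = ≤-pred (*-cancelˡ-< M _ _ (begin-strict
      M * κ d <⟨ M*κ<D*i+M d ⟩
      D * d + M ≤⟨ +-monoˡ-≤ M (<⇒≤ h) ⟩
      M * N + M ≡⟨ +-comm _ M ⟩
      M + M * N ≡⟨ *-suc M N ⟨
      M * suc N ∎))
      where open ≤-Reasoning

    private
      κ-separated : ∀ {l} → M * l ≤ D → ∀ {i i′ k k′} → k < l → i < i′ → k + κ i ≢ k′ + κ i′
      κ-separated {l} h {i} {i′} {k} {k′} k<l i<i′ eq = <-irrefl eq (begin-strict
        k + κ i <⟨ +-monoˡ-< (κ i) k<l ⟩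
        l + κ i ≡⟨ +-comm l (κ i) ⟩
        κ i + l ≤⟨ κ-< h i<i′ ⟩
        κ i′ ≤⟨ m≤n+m (κ i′) k′ ⟩
        k′ + κ i′ ∎)
        where open ≤-Reasoning

    -- The intervals from κ(i) to κ(i) + l - 1 are disjoint by `κ-<`, so the position determines
    -- both the interval and the offset.
    κ-injective : ∀ {l} → M * l ≤ D → ∀ {i i′ k k′} → k < l → k′ < l →
                  k + κ i ≡ k′ + κ i′ → i ≡ i′ × k ≡ k′
    κ-injective h {i} {i′} {k} {k′} k<l k′<l eq with <-cmp i i′
    ... | tri≈ _ refl _ = refl , +-cancelʳ-≡ (κ i) k k′ eq
    ... | tri< i<i′ _ _ = ⊥-elim (κ-separated h k<l i<i′ eq)
    ... | tri> _ _ i′<i = ⊥-elim (κ-separated h k′<l i′<i (sym eq))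

  private
    digits-separated : ∀ {N r r′ j j′} → r < N → j < j′ → r + N * j ≢ r′ + N * j′
    digits-separated {N} {r} {r′} {j} {j′} r<N j<j′ eq = <-irrefl eq (begin-strict
      r + N * j <⟨ +-monoˡ-< (N * j) r<N ⟩
      N + N * j ≡⟨ *-suc N j ⟨
      N * suc j ≤⟨ *-monoʳ-≤ N j<j′ ⟩
      N * j′ ≤⟨ m≤n+m (N * j′) r′ ⟩
      r′ + N * j′ ∎)
      where open ≤-Reasoning

  digits-injective : ∀ {N r r′ j j′} → r < N → r′ < N → r + N * j ≡ r′ + N * j′ → r ≡ r′ × j ≡ j′
  digits-injective {N} {r} {r′} {j} {j′} r<N r′<N eq with <-cmp j j′
  ... | tri≈ _ refl _ = +-cancelʳ-≡ (N * j) r r′ eq , refl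
  ... | tri< j<j′ _ _ = ⊥-elim (digits-separated r<N j<j′ eq)
  ... | tri> _ _ j′<j = ⊥-elim (digits-separated r′<N j′<j (sym eq))

-- Stepanov's method

module Stepanov where

  open import Data.Fin.Properties using (toℕ<n; toℕ-injective; combine-remQuot)
  open import Data.List.Relation.Unary.Unique.Propositional.Properties using (allFin⁺)
  open import Data.Nat as ℕ using (ℕ; zero; suc; s≤s; _∸_)
  import Data.Nat.Properties as ℕ
  import Data.Nat.Tactic.RingSolver as ℕ-Solver
  open import Relation.Binary.PropositionalEquality hiding ([_]; J)

  open Exponents
  open LinDep
  open Field

  module AuxiliaryFunction (𝔽 : FinField) where
    open FieldTheory 𝔽

    module _ {D M M′ : ℕ} (MM′≡Q : M ℕ.* M′ ≡ length els) {y v β : F} (sol : (y * v) ^ D ≡ β ^ D)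
                     (i j l : ℕ) {k r : ℕ} (Mk≡Di+r : M ℕ.* k ≡ D ℕ.* i ℕ.+ r) (k≤M′ : k ℕ.≤ M′) (r≤M : r ℕ.≤ M) where
      open ≡-Reasoning

      -- Here y, v and β stand for x + a, x + b and B x, so that y v is A x. The power y^k is taken
      -- from the monomial in y to complete v^k to (y v)^k, the only form to which the equation
      -- applies.
      ^-split : y ^ (l ℕ.+ k ℕ.+ M′ ℕ.* j) * (v ^ k * β ^ (M′ ∸ k)) ≡ y ^ (l ℕ.+ M′ ℕ.* j) * ((y * v) ^ k * β ^ (M′ ∸ k))
      ^-split = begin
        y ^ (l ℕ.+ k ℕ.+ M′ ℕ.* j) * (v ^ k * β ^ (M′ ∸ k))
          ≡⟨ cong (λ e → y ^ e * (v ^ k * β ^ (M′ ∸ k))) (lem l k (M′ ℕ.* j)) ⟩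
        y ^ (l ℕ.+ M′ ℕ.* j ℕ.+ k) * (v ^ k * β ^ (M′ ∸ k))
          ≡⟨ cong (_* (v ^ k * β ^ (M′ ∸ k))) (^-homo-* y (l ℕ.+ M′ ℕ.* j) k) ⟩
        y ^ (l ℕ.+ M′ ℕ.* j) * y ^ k * (v ^ k * β ^ (M′ ∸ k))
          ≡⟨ solve 4 (λ p q s u → p :* q :* (s :* u) := p :* (q :* s :* u)) refl
               (y ^ (l ℕ.+ M′ ℕ.* j)) (y ^ k) (v ^ k) (β ^ (M′ ∸ k)) ⟩
        y ^ (l ℕ.+ M′ ℕ.* j) * (y ^ k * v ^ k * β ^ (M′ ∸ k))
          ≡⟨ cong (λ t → y ^ (l ℕ.+ M′ ℕ.* j) * (t * β ^ (M′ ∸ k))) (^-distrib-* y v k) ⟨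
        y ^ (l ℕ.+ M′ ℕ.* j) * ((y * v) ^ k * β ^ (M′ ∸ k)) ∎
        where
        lem : ∀ u v z → u ℕ.+ v ℕ.+ z ≡ u ℕ.+ z ℕ.+ v
        lem = ℕ-Solver.solve-∀

      -- The reduction y^Q = y turns the large exponent M′ j into the small exponent j after the
      -- M-th power. This drop of degree is what leaves few linear conditions on the coefficients.
      y-part : (y ^ (l ℕ.+ M′ ℕ.* j)) ^ M ≡ y ^ (M ℕ.* l ℕ.+ j)
      y-part = begin
        (y ^ (l ℕ.+ M′ ℕ.* j)) ^ M ≡⟨ ^-assocʳ y (l ℕ.+ M′ ℕ.* j) M ⟩
        y ^ ((l ℕ.+ M′ ℕ.* j) ℕ.* M) ≡⟨ cong (y ^_) (lem l M′ j M) ⟩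
        y ^ (M ℕ.* l ℕ.+ (M ℕ.* M′) ℕ.* j) ≡⟨ ^-homo-* y (M ℕ.* l) ((M ℕ.* M′) ℕ.* j) ⟩
        y ^ (M ℕ.* l) * y ^ ((M ℕ.* M′) ℕ.* j) ≡⟨ cong (y ^ (M ℕ.* l) *_) (^-assocʳ y (M ℕ.* M′) j) ⟨
        y ^ (M ℕ.* l) * (y ^ (M ℕ.* M′)) ^ j ≡⟨ cong (λ t → y ^ (M ℕ.* l) * t ^ j) (trans (cong (y ^_) MM′≡Q) (x^|F|≡x y)) ⟩
        y ^ (M ℕ.* l) * y ^ j ≡⟨ ^-homo-* y (M ℕ.* l) j ⟨
        y ^ (M ℕ.* l ℕ.+ j) ∎
        where
        lem : ∀ l M′ j M → (l ℕ.+ M′ ℕ.* j) ℕ.* M ≡ M ℕ.* l ℕ.+ (M ℕ.* M′) ℕ.* j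
        lem = ℕ-Solver.solve-∀

      -- The equation trades (y v)^(D i) for β^(D i), so only the remainder r ≤ M still contributes
      -- to the degree in y v.
      α-power : ((y * v) ^ k) ^ M ≡ β ^ (D ℕ.* i) * (y * v) ^ r
      α-power = begin
        ((y * v) ^ k) ^ M ≡⟨ ^-assocʳ (y * v) k M ⟩
        (y * v) ^ (k ℕ.* M) ≡⟨ cong ((y * v) ^_) (trans (ℕ.*-comm k M) Mk≡Di+r) ⟩
        (y * v) ^ (D ℕ.* i ℕ.+ r) ≡⟨ ^-homo-* (y * v) (D ℕ.* i) r ⟩
        (y * v) ^ (D ℕ.* i) * (y * v) ^ r ≡⟨ cong (_* (y * v) ^ r) (^-assocʳ (y * v) D i) ⟨
        ((y * v) ^ D) ^ i * (y * v) ^ r ≡⟨ cong (λ t → t ^ i * (y * v) ^ r) sol ⟩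
        (β ^ D) ^ i * (y * v) ^ r ≡⟨ cong (_* (y * v) ^ r) (^-assocʳ β D i) ⟩
        β ^ (D ℕ.* i) * (y * v) ^ r ∎

      -- Without the extra M the exponent of β would be M M′ - r, different for each term. The extra
      -- factor β^M allows the common factor β^(M M′) to split off with a nonnegative exponent M - r
      -- left over.
      exponents : M ℕ.+ D ℕ.* i ℕ.+ (M′ ∸ k) ℕ.* M ≡ M ℕ.* M′ ℕ.+ (M ∸ r)
      exponents = ℕ.+-cancelʳ-≡ r _ _ (begin
        M ℕ.+ D ℕ.* i ℕ.+ (M′ ∸ k) ℕ.* M ℕ.+ r ≡⟨ lem₁ M (D ℕ.* i) (M′ ∸ k) r ⟩
        M ℕ.+ (D ℕ.* i ℕ.+ r) ℕ.+ M ℕ.* (M′ ∸ k) ≡⟨ cong (λ v → M ℕ.+ v ℕ.+ M ℕ.* (M′ ∸ k)) Mk≡Di+r ⟨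
        M ℕ.+ M ℕ.* k ℕ.+ M ℕ.* (M′ ∸ k) ≡⟨ lem₂ M k (M′ ∸ k) ⟩
        M ℕ.* (k ℕ.+ (M′ ∸ k)) ℕ.+ M ≡⟨ cong (λ v → M ℕ.* v ℕ.+ M) (ℕ.m+[n∸m]≡n k≤M′) ⟩
        M ℕ.* M′ ℕ.+ M ≡⟨ cong (M ℕ.* M′ ℕ.+_) (ℕ.m∸n+n≡m r≤M) ⟨
        M ℕ.* M′ ℕ.+ ((M ∸ r) ℕ.+ r) ≡⟨ ℕ.+-assoc (M ℕ.* M′) (M ∸ r) r ⟨
        M ℕ.* M′ ℕ.+ (M ∸ r) ℕ.+ r ∎)
        where
        lem₁ : ∀ M u v r → M ℕ.+ u ℕ.+ v ℕ.* M ℕ.+ r ≡ M ℕ.+ (u ℕ.+ r) ℕ.+ M ℕ.* v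
        lem₁ = ℕ-Solver.solve-∀
        lem₂ : ∀ M k v → M ℕ.+ M ℕ.* k ℕ.+ M ℕ.* v ≡ M ℕ.* (k ℕ.+ v) ℕ.+ M
        lem₂ = ℕ-Solver.solve-∀

      β-power : β ^ M * β ^ (D ℕ.* i) * β ^ ((M′ ∸ k) ℕ.* M) ≡ β ^ (M ℕ.* M′) * β ^ (M ∸ r)
      β-power = begin
        β ^ M * β ^ (D ℕ.* i) * β ^ ((M′ ∸ k) ℕ.* M)
          ≡⟨ cong (_* β ^ ((M′ ∸ k) ℕ.* M)) (^-homo-* β M (D ℕ.* i)) ⟨
        β ^ (M ℕ.+ D ℕ.* i) * β ^ ((M′ ∸ k) ℕ.* M)
          ≡⟨ ^-homo-* β (M ℕ.+ D ℕ.* i) ((M′ ∸ k) ℕ.* M) ⟨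
        β ^ (M ℕ.+ D ℕ.* i ℕ.+ (M′ ∸ k) ℕ.* M) ≡⟨ cong (β ^_) exponents ⟩
        β ^ (M ℕ.* M′ ℕ.+ (M ∸ r)) ≡⟨ ^-homo-* β (M ℕ.* M′) (M ∸ r) ⟩
        β ^ (M ℕ.* M′) * β ^ (M ∸ r) ∎

      αβ-part : β ^ M * ((y * v) ^ k * β ^ (M′ ∸ k)) ^ M ≡ β ^ (M ℕ.* M′) * ((y * v) ^ r * β ^ (M ∸ r))
      αβ-part = begin
        β ^ M * ((y * v) ^ k * β ^ (M′ ∸ k)) ^ M
          ≡⟨ cong (β ^ M *_) (^-distrib-* ((y * v) ^ k) (β ^ (M′ ∸ k)) M) ⟩
        β ^ M * (((y * v) ^ k) ^ M * (β ^ (M′ ∸ k)) ^ M)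
          ≡⟨ cong₂ (λ u t → β ^ M * (u * t)) α-power (^-assocʳ β (M′ ∸ k) M) ⟩
        β ^ M * (β ^ (D ℕ.* i) * (y * v) ^ r * β ^ ((M′ ∸ k) ℕ.* M))
          ≡⟨ solve 4 (λ p q s u → p :* (q :* s :* u) := p :* q :* u :* s) refl
               (β ^ M) (β ^ (D ℕ.* i)) ((y * v) ^ r) (β ^ ((M′ ∸ k) ℕ.* M)) ⟩
        β ^ M * β ^ (D ℕ.* i) * β ^ ((M′ ∸ k) ℕ.* M) * (y * v) ^ r
          ≡⟨ cong (_* (y * v) ^ r) β-power ⟩
        β ^ (M ℕ.* M′) * β ^ (M ∸ r) * (y * v) ^ r
          ≡⟨ solve 3 (λ p q s → p :* q :* s := p :* (s :* q)) refl
               (β ^ (M ℕ.* M′)) (β ^ (M ∸ r)) ((y * v) ^ r) ⟩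
        β ^ (M ℕ.* M′) * ((y * v) ^ r * β ^ (M ∸ r)) ∎

      term-power : ∀ {c C} → c ^ M ≡ C →
        β ^ M * (c * (y ^ (l ℕ.+ k ℕ.+ M′ ℕ.* j) * (v ^ k * β ^ (M′ ∸ k)))) ^ M ≡
        β ^ (M ℕ.* M′) * (C * (y ^ (M ℕ.* l ℕ.+ j) * ((y * v) ^ r * β ^ (M ∸ r))))
      term-power {c} {C} c^M≡C = begin
        β ^ M * (c * (y ^ (l ℕ.+ k ℕ.+ M′ ℕ.* j) * (v ^ k * β ^ (M′ ∸ k)))) ^ M
          ≡⟨ cong (λ t → β ^ M * (c * t) ^ M) ^-split ⟩
        β ^ M * (c * (yy * αβ)) ^ M
          ≡⟨ cong (β ^ M *_) (trans (^-distrib-* c (yy * αβ) M) (cong₂ _*_ c^M≡C (^-distrib-* yy αβ M))) ⟩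
        β ^ M * (C * (yy ^ M * αβ ^ M))
          ≡⟨ cong (λ t → β ^ M * (C * (t * αβ ^ M))) y-part ⟩
        β ^ M * (C * (yyy * αβ ^ M))
          ≡⟨ solve 4 (λ p q s u → p :* (q :* (s :* u)) := q :* s :* (p :* u)) refl (β ^ M) C yyy (αβ ^ M) ⟩
        C * yyy * (β ^ M * αβ ^ M)
          ≡⟨ cong (C * yyy *_) αβ-part ⟩
        C * yyy * (β ^ (M ℕ.* M′) * ((y * v) ^ r * β ^ (M ∸ r)))
          ≡⟨ solve 4 (λ p q s u → q :* s :* (p :* u) := p :* (q :* (s :* u))) refl
               (β ^ (M ℕ.* M′)) C yyy ((y * v) ^ r * β ^ (M ∸ r)) ⟩
        β ^ (M ℕ.* M′) * (C * (yyy * ((y * v) ^ r * β ^ (M ∸ r)))) ∎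
        where
        yy yyy αβ : F
        yy  = y ^ (l ℕ.+ M′ ℕ.* j)
        yyy = y ^ (M ℕ.* l ℕ.+ j)
        αβ  = (y * v) ^ k * β ^ (M′ ∸ k)

    module _ {a b c e : F} (a≢b : a ≢ b) (a≢c : a ≢ c) (a≢e : a ≢ e) where

      private
        z₀ : F
        z₀ = - a

        Y A B : F → F
        Y x = x + a
        A x = (x + a) * (x + b)
        B x = (x + c) * (x + e)

        Y-z₀ : Y z₀ ≡ 0#
        Y-z₀ = -‿inverseˡ a

        z₀+≢0 : ∀ {t} → a ≢ t → z₀ + t ≢ 0#
        z₀+≢0 {t} a≢t eq = a≢t (sym (begin
          t ≡⟨ +-identityˡ t ⟨
          0# + t ≡⟨ cong (_+ t) (-‿inverseʳ a) ⟨
          (a + z₀) + t ≡⟨ +-assoc a z₀ t ⟩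
          a + (z₀ + t) ≡⟨ cong (a +_) eq ⟩
          a + 0# ≡⟨ +-identityʳ a ⟩
          a ∎))
          where open ≡-Reasoning

        B-z₀ : B z₀ ≢ 0#
        B-z₀ = *-≢0 (z₀+≢0 a≢c) (z₀+≢0 a≢e)

        Poly-A : Poly 3 A
        Poly-A = Poly-* (Poly-X+ a) (Poly-X+ b)

        Poly-B : Poly 3 B
        Poly-B = Poly-* (Poly-X+ c) (Poly-X+ e)

      -- The plain degree bound, for A^D - B^D, which is nonzero at -a. It covers the range D < M,
      -- where ⌊D/M⌋ = 0 leaves Stepanov's construction no monomials.
      few-solutions : ∀ D .{{_ : ℕ.NonZero D}} {xs} → Unique xs →
                      (∀ {x} → x ∈ xs → A x ^ D ≡ B x ^ D) → length xs ℕ.≤ D ℕ.* 2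
      few-solutions D u sol = roots≤degree
        (Poly-+ (Poly-^ D Poly-A) (Poly-scale (- 1#) (Poly-^ D Poly-B))) {z₀} nonzero u
        (λ {x} x∈ → trans (cong (_+ - 1# * B x ^ D) (sol x∈)) (x-x≡0 (B x ^ D)))
        where
        open ≡-Reasoning
        x-x≡0 : ∀ x → x + - 1# * x ≡ 0#
        x-x≡0 x = trans (cong (_+ - 1# * x) (sym (*-identityˡ x)))
          (trans (sym (distribʳ x 1# (- 1#))) (trans (cong (_* x) (-‿inverseʳ 1#)) (zeroˡ x)))
        nonzero : A z₀ ^ D + - 1# * B z₀ ^ D ≢ 0#
        nonzero eq = ^-≢0 D B-z₀ (begin
          B z₀ ^ D ≡⟨ +-identityʳ _ ⟨
          B z₀ ^ D + 0# ≡⟨ cong (B z₀ ^ D +_) eq ⟨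
          B z₀ ^ D + (A z₀ ^ D + - 1# * B z₀ ^ D)
            ≡⟨ cong (λ t → B z₀ ^ D + (t + - 1# * B z₀ ^ D)) (trans (cong (_^ D) (trans (cong (_* (z₀ + b)) Y-z₀) (zeroˡ _))) (0^ D)) ⟩
          B z₀ ^ D + (0# + - 1# * B z₀ ^ D) ≡⟨ cong (B z₀ ^ D +_) (+-identityˡ _) ⟩
          B z₀ ^ D + - 1# * B z₀ ^ D ≡⟨ x-x≡0 _ ⟩
          0# ∎)

      -- An auxiliary function Φ(x) = Σ c Y^(l + M′j) A^k B^(M′ − k) vanishes at every solution,
      -- because on solutions B^M Φ^M is B^(M M′) Σ c^M Y^(Ml + j) A^r B^(M − r), and the last sum
      -- is identically zero for suitable coefficients.
      module _ {D M M′ T ℓ m : ℕ} .{{_ : ℕ.NonZero M}} (MM′≡Q : M ℕ.* M′ ≡ length els)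
                     (additive : Additive M) (i j l k r : Fin T → ℕ)
                     (Mk≡Di+r : ∀ t → M ℕ.* k t ≡ D ℕ.* i t ℕ.+ r t) (r≤M : ∀ t → r t ℕ.≤ M)
                     (j<m : ∀ t → j t ℕ.< m) (l<ℓ : ∀ t → l t ℕ.< ℓ) (l+k<M′ : ∀ t → l t ℕ.+ k t ℕ.< M′)
                     (injective : ∀ t s → l t ℕ.+ k t ℕ.+ M′ ℕ.* j t ≡ l s ℕ.+ k s ℕ.+ M′ ℕ.* j s → t ≡ s)
                     (many : M ℕ.* suc ℓ ℕ.+ m ℕ.< T) where

        w : Fin T → ℕ
        w t = l t ℕ.+ k t ℕ.+ M′ ℕ.* j t

        k≤M′ : ∀ t → k t ℕ.≤ M′
        k≤M′ t = ℕ.≤-trans (ℕ.m≤n+m (k t) (l t)) (ℕ.<⇒≤ (l+k<M′ t))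

        w≤ : ∀ t → w t ℕ.≤ M′ ℕ.* m
        w≤ t = begin
          l t ℕ.+ k t ℕ.+ M′ ℕ.* j t ≤⟨ ℕ.+-monoˡ-≤ (M′ ℕ.* j t) (ℕ.<⇒≤ (l+k<M′ t)) ⟩
          M′ ℕ.+ M′ ℕ.* j t ≡⟨ ℕ.*-suc M′ (j t) ⟨
          M′ ℕ.* suc (j t) ≤⟨ ℕ.*-monoʳ-≤ M′ (j<m t) ⟩
          M′ ℕ.* m ∎
          where open ℕ.≤-Reasoning

        -- `g` is the low-degree summand that remains after the M-th power. `G` is what is left of
        -- A^k B^(M′ - k) once the factor Y^k is counted in `w`, and it does not vanish at -a.
        g G : Fin T → F → F
        g t x = Y x ^ (M ℕ.* l t ℕ.+ j t) * (A x ^ r t * B x ^ (M ∸ r t))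
        G t x = (x + b) ^ k t * B x ^ (M′ ∸ k t)

        -- A^r B^(M - r) has degree 2M whatever r is, and l ≤ ℓ - 1, so M l + 2M ≤ M (ℓ + 1).
        Poly-g : ∀ t → Poly (M ℕ.* suc ℓ ℕ.+ m) (g t)
        Poly-g t = Poly-weaken bound
          (Poly-* (Poly-^ (M ℕ.* l t ℕ.+ j t) (Poly-X+ a)) (Poly-* (Poly-^ (r t) Poly-A) (Poly-^ (M ∸ r t) Poly-B)))
          where
          open ℕ.≤-Reasoning
          lem₁ : ∀ u j r s → suc ((u ℕ.+ j) ℕ.* 1 ℕ.+ (r ℕ.* 2 ℕ.+ s ℕ.* 2)) ≡ u ℕ.+ suc j ℕ.+ (r ℕ.+ s) ℕ.* 2
          lem₁ = ℕ-Solver.solve-∀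
          lem₂ : ∀ M l j → M ℕ.* l ℕ.+ j ℕ.+ M ℕ.* 2 ≡ M ℕ.* suc (suc l) ℕ.+ j
          lem₂ = ℕ-Solver.solve-∀
          bound : suc ((M ℕ.* l t ℕ.+ j t) ℕ.* 1 ℕ.+ (r t ℕ.* 2 ℕ.+ (M ∸ r t) ℕ.* 2)) ℕ.≤ M ℕ.* suc ℓ ℕ.+ m
          bound = begin
            _ ≡⟨ lem₁ (M ℕ.* l t) (j t) (r t) (M ∸ r t) ⟩
            M ℕ.* l t ℕ.+ suc (j t) ℕ.+ (r t ℕ.+ (M ∸ r t)) ℕ.* 2
              ≡⟨ cong (λ z → M ℕ.* l t ℕ.+ suc (j t) ℕ.+ z ℕ.* 2) (ℕ.m+[n∸m]≡n (r≤M t)) ⟩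
            M ℕ.* l t ℕ.+ suc (j t) ℕ.+ M ℕ.* 2 ≡⟨ lem₂ M (l t) (suc (j t)) ⟩
            M ℕ.* suc (suc (l t)) ℕ.+ suc (j t) ≤⟨ ℕ.+-mono-≤ (ℕ.*-monoʳ-≤ M (s≤s (l<ℓ t))) (j<m t) ⟩
            M ℕ.* suc ℓ ℕ.+ m ∎

        abstract
          dep : ∃ λ (C : Fin T → F) → (∃ λ t → C t ≢ 0#) × (∀ x → ⨁ (allFin T) (λ t → C t * g t x) ≡ 0#)
          dep = linear-dependence 𝔽 g Poly-g many

        -- The relation has coefficients `C`, and `c′` are their M-th roots: (C^M′)^M = C^Q = C.
        C c′ : Fin T → F
        C = proj₁ dep
        c′ t = C t ^ M′

        c′^M : ∀ t → c′ t ^ M ≡ C t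
        c′^M t = trans (^-assocʳ (C t) M′ M)
          (trans (cong (C t ^_) (trans (ℕ.*-comm M′ M) MM′≡Q)) (x^|F|≡x (C t)))

        abstract
          least : ∃ λ t₀ → c′ t₀ ≢ 0# × (∀ t → c′ t ≢ 0# → w t₀ ℕ.≤ w t)
          least = argmin (λ t → ¬? (c′ t ≟ 0#)) w (^-≢0 M′ (proj₂ (proj₁ (proj₂ dep))))

        t₀ : Fin T
        t₀ = proj₁ least

        Φ Φ′ : F → F
        Φ x  = ⨁ (allFin T) (λ t → c′ t * (Y x ^ w t * G t x))
        Φ′ x = ⨁ (allFin T) (λ t → c′ t * (Y x ^ (w t ∸ w t₀) * G t x))

        Φ-factor : ∀ x → Φ x ≡ Y x ^ w t₀ * Φ′ x
        Φ-factor x = trans (⨁-cong (allFin T) term) (⨁-*ˡ (allFin T) (Y x ^ w t₀) _)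
          where
          open ≡-Reasoning
          term : ∀ t → c′ t * (Y x ^ w t * G t x) ≡ Y x ^ w t₀ * (c′ t * (Y x ^ (w t ∸ w t₀) * G t x))
          term t with c′ t ≟ 0#
          -- When the coefficient vanishes, w t may lie below w t₀ and the truncated difference
          -- carries no information; both sides are zero.
          ... | yes z = begin
            c′ t * (Y x ^ w t * G t x) ≡⟨ trans (cong (_* (Y x ^ w t * G t x)) z) (zeroˡ (Y x ^ w t * G t x)) ⟩
            0# ≡⟨ zeroʳ (Y x ^ w t₀) ⟨
            Y x ^ w t₀ * 0# ≡⟨ cong (Y x ^ w t₀ *_) (trans (cong (_* u) z) (zeroˡ u)) ⟨
            Y x ^ w t₀ * (c′ t * u) ∎
            where
            u : F
            u = Y x ^ (w t ∸ w t₀) * G t x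
          ... | no nz = begin
            c′ t * (Y x ^ w t * G t x)
              ≡⟨ cong (λ v → c′ t * (Y x ^ v * G t x)) (ℕ.m+[n∸m]≡n (proj₂ (proj₂ least) t nz)) ⟨
            c′ t * (Y x ^ (w t₀ ℕ.+ (w t ∸ w t₀)) * G t x)
              ≡⟨ cong (λ v → c′ t * (v * G t x)) (^-homo-* (Y x) (w t₀) (w t ∸ w t₀)) ⟩
            c′ t * (Y x ^ w t₀ * Y x ^ (w t ∸ w t₀) * G t x)
              ≡⟨ rearrange (c′ t) (Y x ^ w t₀) (Y x ^ (w t ∸ w t₀)) (G t x) ⟩
            Y x ^ w t₀ * (c′ t * (Y x ^ (w t ∸ w t₀) * G t x)) ∎
            where
            rearrange : ∀ p q s u → p * (q * s * u) ≡ q * (p * (s * u))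
            rearrange = solve 4 (λ p q s u → p :* (q :* s :* u) := q :* (p :* (s :* u))) refl

        -- The terms of Φ vanish at -a to the distinct orders `w t`. Dividing by the lowest one
        -- makes every other term zero at -a, and the surviving term is nonzero because a differs
        -- from b, c and e.
        Φ′-z₀ : Φ′ z₀ ≢ 0#
        Φ′-z₀ eq = *-≢0 (proj₁ (proj₂ least)) (*-≢0 (subst (_≢ 0#) (sym Y^0) 1≢0) (*-≢0 (^-≢0 (k t₀) (z₀+≢0 a≢b)) (^-≢0 (M′ ∸ k t₀) B-z₀)))
          (trans (sym (⨁-single (allFin⁺ T) (∈-allFin t₀) others)) eq)
          where
          Y^0 : Y z₀ ^ (w t₀ ∸ w t₀) ≡ 1#
          Y^0 = cong (Y z₀ ^_) (ℕ.n∸n≡0 (w t₀))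
          others : ∀ t → t ≢ t₀ → c′ t * (Y z₀ ^ (w t ∸ w t₀) * G t z₀) ≡ 0#
          others t t≢t₀ with c′ t ≟ 0#
          ... | yes z = trans (cong (_* (Y z₀ ^ (w t ∸ w t₀) * G t z₀)) z) (zeroˡ (Y z₀ ^ (w t ∸ w t₀) * G t z₀))
          ... | no nz = trans (cong (c′ t *_) (trans (cong (_* G t z₀)
                  (trans (cong (_^ (w t ∸ w t₀)) Y-z₀) (0^ (w t ∸ w t₀) {{ℕ.>-nonZero (ℕ.m<n⇒0<n∸m w<)}}))) (zeroˡ (G t z₀)))) (zeroʳ (c′ t))
            where
            w< : w t₀ ℕ.< w t
            w< = ℕ.≤∧≢⇒< (proj₂ (proj₂ least) t nz) (λ eq → t≢t₀ (sym (injective t₀ t eq)))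

        -- The power of Y contributes M′ m and the factor `G` at most 2M′.
        Poly-Φ′ : Poly (suc (M′ ℕ.* (m ℕ.+ 2))) Φ′
        Poly-Φ′ = Poly-⨁ (allFin T) (λ {t} _ → Poly-scale (c′ t) (Poly-weaken (s≤s (bound t))
          (Poly-* (Poly-^ (w t ∸ w t₀) (Poly-X+ a)) (Poly-* (Poly-^ (k t) (Poly-X+ b)) (Poly-^ (M′ ∸ k t) Poly-B)))))
          where
          open ℕ.≤-Reasoning
          lem : ∀ M m → M ℕ.* m ℕ.+ M ℕ.* 2 ≡ M ℕ.* (m ℕ.+ 2)
          lem = ℕ-Solver.solve-∀
          bound : ∀ t → (w t ∸ w t₀) ℕ.* 1 ℕ.+ (k t ℕ.* 1 ℕ.+ (M′ ∸ k t) ℕ.* 2) ℕ.≤ M′ ℕ.* (m ℕ.+ 2)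
          bound t = begin
            (w t ∸ w t₀) ℕ.* 1 ℕ.+ (k t ℕ.* 1 ℕ.+ (M′ ∸ k t) ℕ.* 2)
              ≤⟨ ℕ.+-mono-≤ (ℕ.≤-trans (ℕ.≤-reflexive (ℕ.*-identityʳ _)) (ℕ.≤-trans (ℕ.m∸n≤m (w t) (w t₀)) (w≤ t)))
                            (ℕ.+-monoˡ-≤ _ (ℕ.*-monoʳ-≤ (k t) (s≤s ℕ.z≤n))) ⟩
            M′ ℕ.* m ℕ.+ (k t ℕ.* 2 ℕ.+ (M′ ∸ k t) ℕ.* 2)
              ≡⟨ cong (M′ ℕ.* m ℕ.+_) (trans (sym (ℕ.*-distribʳ-+ 2 (k t) _)) (cong (ℕ._* 2) (ℕ.m+[n∸m]≡n (k≤M′ t)))) ⟩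
            M′ ℕ.* m ℕ.+ M′ ℕ.* 2 ≡⟨ lem M′ m ⟩
            M′ ℕ.* (m ℕ.+ 2) ∎

        Φ-vanishes : ∀ {x} → A x ^ D ≡ B x ^ D → B x ≢ 0# → Φ x ≡ 0#
        Φ-vanishes {x} sol Bx≢0 = ^≡0⇒≡0 M (*-cancelˡ-0 (^-≢0 M Bx≢0) (begin
            β ^ M * Φ x ^ M
              ≡⟨ cong (β ^ M *_) (Additive-⨁ additive (allFin T) _) ⟩
            β ^ M * ⨁ (allFin T) (λ t → (c′ t * (Y x ^ w t * G t x)) ^ M)
              ≡⟨ ⨁-*ˡ (allFin T) (β ^ M) _ ⟨
            ⨁ (allFin T) (λ t → β ^ M * (c′ t * (Y x ^ w t * G t x)) ^ M)
              ≡⟨ ⨁-cong (allFin T) (λ t → term-power {D} MM′≡Q sol (i t) (j t) (l t) (Mk≡Di+r t) (k≤M′ t) (r≤M t) (c′^M t)) ⟩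
            ⨁ (allFin T) (λ t → β ^ (M ℕ.* M′) * (C t * g t x))
              ≡⟨ ⨁-*ˡ (allFin T) (β ^ (M ℕ.* M′)) _ ⟩
            β ^ (M ℕ.* M′) * ⨁ (allFin T) (λ t → C t * g t x)
              ≡⟨ cong (β ^ (M ℕ.* M′) *_) (proj₂ (proj₂ dep) x) ⟩
            β ^ (M ℕ.* M′) * 0# ≡⟨ zeroʳ _ ⟩
            0# ∎))
          where
          open ≡-Reasoning
          β : F
          β = B x

        solutions≤ : ∀ {xs} → Unique xs → (∀ {x} → x ∈ xs → A x ^ D ≡ B x ^ D × Y x ≢ 0# × B x ≢ 0#) →
                     length xs ℕ.≤ M′ ℕ.* (m ℕ.+ 2)
        solutions≤ u sol = roots≤degree Poly-Φ′ Φ′-z₀ u λ {x} x∈ →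
          let (eq , Y≢0 , B≢0) = sol x∈ in
          *-cancelˡ-0 (^-≢0 (w t₀) Y≢0) (trans (sym (Φ-factor x)) (Φ-vanishes eq B≢0))

      module _ {D d M M′ ℓ m : ℕ} .{{_ : ℕ.NonZero M}}
               (Dd≡n : D ℕ.* d ≡ length units) (MM′≡Q : M ℕ.* M′ ≡ length els)
               (additive : Additive M) (Mℓ≤D : M ℕ.* ℓ ℕ.≤ D)
               (many : M ℕ.* suc ℓ ℕ.+ m ℕ.< d ℕ.* (m ℕ.* ℓ)) where

        private
          T : ℕ
          T = d ℕ.* (m ℕ.* ℓ)

          I J L : Fin T → ℕ
          I t = toℕ (proj₁ (remQuot {d} (m ℕ.* ℓ) t))
          J t = toℕ (proj₁ (remQuot {m} ℓ (proj₂ (remQuot {d} (m ℕ.* ℓ) t))))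
          L t = toℕ (proj₂ (remQuot {m} ℓ (proj₂ (remQuot {d} (m ℕ.* ℓ) t))))

          I<d : ∀ t → I t ℕ.< d
          I<d t = toℕ<n (proj₁ (remQuot {d} (m ℕ.* ℓ) t))
          J<m : ∀ t → J t ℕ.< m
          J<m t = toℕ<n (proj₁ (remQuot {m} ℓ (proj₂ (remQuot {d} (m ℕ.* ℓ) t))))
          L<ℓ : ∀ t → L t ℕ.< ℓ
          L<ℓ t = toℕ<n (proj₂ (remQuot {m} ℓ (proj₂ (remQuot {d} (m ℕ.* ℓ) t))))

          index-injective : ∀ t s → I t ≡ I s → J t ≡ J s → L t ≡ L s → t ≡ s
          index-injective t s i j l = begin
            t ≡⟨ combine-remQuot {d} (m ℕ.* ℓ) t ⟨
            combine (proj₁ (rq t)) (proj₂ (rq t))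
              ≡⟨ cong₂ (combine {d}) (toℕ-injective i) inner ⟩
            combine (proj₁ (rq s)) (proj₂ (rq s)) ≡⟨ combine-remQuot {d} (m ℕ.* ℓ) s ⟩
            s ∎
            where
            open ≡-Reasoning
            rq = remQuot {d} (m ℕ.* ℓ)
            inner : proj₂ (rq t) ≡ proj₂ (rq s)
            inner = begin
              proj₂ (rq t) ≡⟨ combine-remQuot {m} ℓ (proj₂ (rq t)) ⟨
              _ ≡⟨ cong₂ (combine {m}) (toℕ-injective j) (toℕ-injective l) ⟩
              _ ≡⟨ combine-remQuot {m} ℓ (proj₂ (rq s)) ⟩
              proj₂ (rq s) ∎

          -- Makes l + κ(i) a digit in base M′, so that j can be read off from the exponent `w`. The
          -- bound is κ(i) + ℓ ≤ κ(d) ≤ M′.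
          L+k<M′ : ∀ t → L t ℕ.+ κ D M (I t) ℕ.< M′
          L+k<M′ t = begin-strict
            L t ℕ.+ κ D M (I t) <⟨ ℕ.+-monoˡ-< (κ D M (I t)) (L<ℓ t) ⟩
            ℓ ℕ.+ κ D M (I t) ≡⟨ ℕ.+-comm ℓ (κ D M (I t)) ⟩
            κ D M (I t) ℕ.+ ℓ ≤⟨ κ-< D M Mℓ≤D (I<d t) ⟩
            κ D M d ≤⟨ κ≤ D M (ℕ.≤-reflexive (trans (cong suc Dd≡n) (trans length-units (sym MM′≡Q)))) ⟩
            M′ ∎
            where open ℕ.≤-Reasoning

          w-injective : ∀ t s → L t ℕ.+ κ D M (I t) ℕ.+ M′ ℕ.* J t ≡ L s ℕ.+ κ D M (I s) ℕ.+ M′ ℕ.* J s → t ≡ s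
          w-injective t s eq with digits-injective {M′} (L+k<M′ t) (L+k<M′ s) eq
          ... | eq′ , j with κ-injective D M Mℓ≤D (L<ℓ t) (L<ℓ s) eq′
          ...   | i , l = index-injective t s i j l

        stepanov : ∀ {xs} → Unique xs → (∀ {x} → x ∈ xs → A x ^ D ≡ B x ^ D × Y x ≢ 0# × B x ≢ 0#) →
                   length xs ℕ.≤ M′ ℕ.* (m ℕ.+ 2)
        stepanov = solutions≤ {D} MM′≡Q additive I J L (λ t → κ D M (I t)) (λ t → ρ D M (I t))
          (λ t → M*κ≡D*i+ρ D M (I t)) (λ t → ρ≤M D M (I t)) J<m L<ℓ L+k<M′ w-injective many

-- Choice of degrees and the resulting count

module CountBound where

  open import Data.Nat
  open import Data.Nat.Properties
  open import Data.Nat.DivMod using (_/_; m≡m%n+[m/n]*n; m%n<n; m/n*n≤m; m≥n⇒m/n>0)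
  open import Data.Nat.Tactic.RingSolver using (solve-∀)
  open import Relation.Binary.PropositionalEquality hiding ([_])

  open Field using (FinField; module FieldTheory)
  open LinDep using (1<|F|)
  open Lists using (unique-⊆⇒≤)
  open Stepanov using (module AuxiliaryFunction)

  n<m+[n/m]*m : ∀ n m .{{_ : NonZero m}} → n < m + n / m * m
  n<m+[n/m]*m n m = subst (_< m + n / m * m) (sym (m≡m%n+[m/n]*n n m)) (+-monoˡ-< (n / m * m) (m%n<n n m))

  module _ {D d M M′ : ℕ} .{{_ : NonZero M}} (2≤d : 2 ≤ d) (M≤D : M ≤ D) (Dd<MM′ : suc (D * d) ≡ M * M′) where

    private
      -- ℓ is the largest value with M ℓ ≤ D. The dimension count M (ℓ + 1) + m < d m ℓ amounts to M
      -- (ℓ + 1) < m u, whose least solution is m = q + 1.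
      ℓ u q : ℕ
      ℓ = D / M

      1≤ℓ : 1 ≤ ℓ
      1≤ℓ = m≥n⇒m/n>0 M≤D

      2ℓ≤dℓ : ℓ + ℓ ≤ d * ℓ
      2ℓ≤dℓ = ≤-trans (≤-reflexive (cong (ℓ +_) (sym (+-identityʳ ℓ)))) (*-monoˡ-≤ ℓ 2≤d)

      u = pred (d * ℓ)

      instance
        dℓ≢0 : NonZero (d * ℓ)
        dℓ≢0 = >-nonZero (≤-trans (≤-trans 1≤ℓ (m≤m+n ℓ ℓ)) 2ℓ≤dℓ)

      ℓ≤u : ℓ ≤ u
      ℓ≤u = ≤-pred (≤-trans (≤-trans (+-monoˡ-≤ ℓ 1≤ℓ) 2ℓ≤dℓ) (≤-reflexive (sym (suc-pred (d * ℓ)))))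

      instance
        u≢0 : NonZero u
        u≢0 = >-nonZero (≤-trans 1≤ℓ ℓ≤u)
        ℓ≢0 : NonZero ℓ
        ℓ≢0 = >-nonZero 1≤ℓ

      q = M * suc ℓ / u

      Mℓ+M≤2Mℓ : M * suc ℓ ≤ M * 2 * ℓ
      Mℓ+M≤2Mℓ = ≤-trans (*-monoʳ-≤ M (+-monoˡ-≤ ℓ 1≤ℓ)) (≤-reflexive (lem M ℓ))
        where
        lem : ∀ M l → M * (l + l) ≡ M * 2 * l
        lem = solve-∀

      qu≤ : q * u ≤ M * suc ℓ
      qu≤ = m/n*n≤m (M * suc ℓ) u

      q≤2M : q ≤ M * 2
      q≤2M = *-cancelʳ-≤ q (M * 2) ℓ (≤-trans (*-monoʳ-≤ q ℓ≤u) (≤-trans qu≤ Mℓ+M≤2Mℓ))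

      qdℓ≤ : q * (d * ℓ) ≤ M * suc ℓ + M * 2
      qdℓ≤ = begin
        q * (d * ℓ) ≡⟨ cong (q *_) (suc-pred (d * ℓ)) ⟨
        q * suc u ≡⟨ trans (*-suc q u) (+-comm q (q * u)) ⟩
        q * u + q ≤⟨ +-mono-≤ qu≤ q≤2M ⟩
        M * suc ℓ + M * 2 ∎
        where open ≤-Reasoning

      MM′≤ : M * M′ ≤ M * 2 * ℓ * d
      MM′≤ = begin
        M * M′ ≡⟨ Dd<MM′ ⟨
        suc (D * d) ≤⟨ +-monoˡ-≤ (D * d) (≤-trans (s≤s z≤n) 2≤d) ⟩
        suc D * d ≤⟨ *-monoˡ-≤ d (n<m+[n/m]*m D M) ⟩
        (M + ℓ * M) * d ≡⟨ cong (_* d) (lem M ℓ) ⟩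
        M * suc ℓ * d ≤⟨ *-monoˡ-≤ d Mℓ+M≤2Mℓ ⟩
        M * 2 * ℓ * d ∎
        where
        open ≤-Reasoning
        lem : ∀ M l → M + l * M ≡ M * suc l
        lem = solve-∀

      -- Up to rounding d q is M, so the main term is M M′. The rounding costs 3 M M′/ℓ, which M M′
      -- ≤ 2 M ℓ d turns into 6 M d.
      dM′q≤ : d * (M′ * q) ≤ M * M′ + d * (6 * M)
      dM′q≤ = *-cancelʳ-≤ _ _ ℓ (begin
        d * (M′ * q) * ℓ ≡⟨ lem₁ d M′ q ℓ ⟩
        M′ * (q * (d * ℓ)) ≤⟨ *-monoʳ-≤ M′ qdℓ≤ ⟩
        M′ * (M * suc ℓ + M * 2) ≡⟨ lem₂ M M′ ℓ ⟩
        M * M′ * ℓ + 3 * (M * M′) ≤⟨ +-monoʳ-≤ (M * M′ * ℓ) (*-monoʳ-≤ 3 MM′≤) ⟩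
        M * M′ * ℓ + 3 * (M * 2 * ℓ * d) ≡⟨ lem₃ M M′ ℓ d ⟩
        (M * M′ + d * (6 * M)) * ℓ ∎)
        where
        open ≤-Reasoning
        lem₁ : ∀ d M′ q l → d * (M′ * q) * l ≡ M′ * (q * (d * l))
        lem₁ = solve-∀
        lem₂ : ∀ M M′ l → M′ * (M * suc l + M * 2) ≡ M * M′ * l + 3 * (M * M′)
        lem₂ = solve-∀
        lem₃ : ∀ M M′ l d → M * M′ * l + 3 * (M * 2 * l * d) ≡ (M * M′ + d * (6 * M)) * l
        lem₃ = solve-∀

    -- The first error, 6M, comes from `dM′q≤`; the second, 3M′, comes from m + 2 = q + 3.
    degrees : ∃ λ m → M * suc (D / M) + m < d * (m * (D / M)) ×
                      d * (M′ * (m + 2)) ≤ M * M′ + d * (6 * M + 3 * M′)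
    degrees = suc q , enough , small
      where
      open ≤-Reasoning
      lem₁ : ∀ u q → (u + q * u) + suc q ≡ suc q * suc u
      lem₁ = solve-∀
      lem₂ : ∀ q d l → suc q * (d * l) ≡ d * (suc q * l)
      lem₂ = solve-∀
      enough : M * suc ℓ + suc q < d * (suc q * ℓ)
      enough = begin-strict
        M * suc ℓ + suc q <⟨ +-monoˡ-< (suc q) (n<m+[n/m]*m (M * suc ℓ) u) ⟩
        (u + q * u) + suc q ≡⟨ lem₁ u q ⟩
        suc q * suc u ≡⟨ cong (suc q *_) (suc-pred (d * ℓ)) ⟩
        suc q * (d * ℓ) ≡⟨ lem₂ q d ℓ ⟩
        d * (suc q * ℓ) ∎
      lem₃ : ∀ d M′ q → d * (M′ * (suc q + 2)) ≡ d * (M′ * q) + d * (3 * M′)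
      lem₃ = solve-∀
      lem₄ : ∀ d M M′ → M * M′ + d * (6 * M) + d * (3 * M′) ≡ M * M′ + d * (6 * M + 3 * M′)
      lem₄ = solve-∀
      small : d * (M′ * (suc q + 2)) ≤ M * M′ + d * (6 * M + 3 * M′)
      small = begin
        d * (M′ * (suc q + 2)) ≡⟨ lem₃ d M′ q ⟩
        d * (M′ * q) + d * (3 * M′) ≤⟨ +-monoˡ-≤ (d * (3 * M′)) dM′q≤ ⟩
        M * M′ + d * (6 * M) + d * (3 * M′) ≡⟨ lem₄ d M M′ ⟩
        M * M′ + d * (6 * M + 3 * M′) ∎

  module _ (𝔽 : FinField) where
    open FieldTheory 𝔽
      using (F; els; els-complete; units; length-units; Additive; 0#)
      renaming (_+_ to _⊕_; _*_ to _⊗_; _^_ to _^′_)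
    open AuxiliaryFunction 𝔽 using (few-solutions; stepanov)

    count-bound : ∀ {a b c e} → a ≢ b → a ≢ c → a ≢ e → ∀ {D d M M′} .{{_ : NonZero M}} →
      D * d ≡ length units → M * M′ ≡ length els → Additive M → ∀ {xs} → Unique xs →
      (∀ {x} → x ∈ xs → ((x ⊕ a) ⊗ (x ⊕ b)) ^′ D ≡ ((x ⊕ c) ⊗ (x ⊕ e)) ^′ D
                      × x ⊕ a ≢ 0# × (x ⊕ c) ⊗ (x ⊕ e) ≢ 0#) →
      d * length xs ≤ M * M′ + d * (6 * M + 3 * M′)
    count-bound a≢b a≢c a≢e {D} {d} {M} {M′} Dd≡n MM′≡Q add {xs} u sol with d
    ... | 0 = z≤n
    -- For d = 1 the full field size M M′ is already an admissible bound; the choice of degrees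
    -- starts at d = 2, where u ≥ ℓ.
    ... | 1 = ≤-trans (≤-reflexive (*-identityˡ _)) (≤-trans
      (≤-trans (unique-⊆⇒≤ u (λ {x} _ → els-complete x)) (≤-reflexive (sym MM′≡Q)))
      (m≤m+n (M * M′) _))
    ... | d@(suc (suc _)) with M ≤? D
    ...   | yes M≤D =
      let (m , many , le) = degrees {D} {d} (s≤s (s≤s z≤n)) M≤D (trans (cong suc Dd≡n) (trans length-units (sym MM′≡Q))) in
      ≤-trans (*-monoʳ-≤ d (stepanov a≢b a≢c a≢e {D} {d} {M} {M′} {D / M} {m} Dd≡n MM′≡Q add
        (≤-trans (≤-reflexive (*-comm M (D / M))) (m/n*n≤m D M)) many u sol)) le
    -- The degree bound gives at most 2D ≤ 2M solutions, which the error term 6M absorbs.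
    ...   | no M≰D = ≤-trans (*-monoʳ-≤ d (≤-trans (few-solutions a≢b a≢c a≢e D {{D≢0}} u (λ x∈ → proj₁ (sol x∈)))
        (≤-trans (*-monoˡ-≤ 2 (<⇒≤ (≰⇒> M≰D))) (≤-trans (≤-reflexive (*-comm M 2))
          (≤-trans (*-monoˡ-≤ M (s≤s (s≤s (z≤n {4})))) (m≤m+n (6 * M) (3 * M′)))))))
        (m≤n+m _ (M * M′))
      where
      0<D*d : 0 < D * d
      0<D*d = ≤-pred (≤-trans (1<|F| 𝔽) (≤-reflexive (trans (sym length-units) (cong suc (sym Dd≡n)))))
      D≢0 : NonZero D
      D≢0 = m*n≢0⇒m≢0 D {{>-nonZero 0<D*d}}

-- Fourth moment of the counts over translates of V

module Moments where

  open import Data.Integer using (ℤ; +_; 0ℤ; 1ℤ; _+_; _*_; _-_; -_; _≤_; +≤+; nonNegative)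
  open import Data.Integer.Properties hiding (_≟_)
  open import Data.Integer.Tactic.RingSolver using (solve-∀)
  open import Data.Nat as ℕ using (ℕ; NonZero)
  import Data.Nat.Properties as ℕ
  open import Relation.Binary.PropositionalEquality hiding ([_])

  open Lists
  open IntSum
  open Field
  open CountBound

  length-cartesianProduct : {A : Set} (xs : List A) → + length (cartesianProduct xs xs) ≡ + length xs * + length xs
  length-cartesianProduct xs = begin
    + length (cartesianProduct xs xs) ≡⟨ *-identityʳ _ ⟨
    + length (cartesianProduct xs xs) * 1ℤ ≡⟨ ∑-const (cartesianProduct xs xs) 1ℤ ⟨
    ∑ (cartesianProduct xs xs) (λ _ → 1ℤ) ≡⟨ ∑-× xs xs (λ _ → 1ℤ) ⟩
    ∑ xs (λ _ → ∑ xs (λ _ → 1ℤ)) ≡⟨ ∑-const xs (∑ xs (λ _ → 1ℤ)) ⟩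
    + length xs * ∑ xs (λ _ → 1ℤ) ≡⟨ cong (+ length xs *_) (trans (∑-const xs 1ℤ) (*-identityʳ _)) ⟩
    + length xs * + length xs ∎
    where open ≡-Reasoning

  square-mono : ∀ {i j} → 0ℤ ≤ i → i ≤ j → i * i ≤ j * j
  square-mono 0≤i i≤j = *-mono-≤-nonNeg 0≤i (≤-trans 0≤i i≤j) i≤j i≤j

  module FourthMoment (𝔽 : FinField) where
    private module R = FieldTheory 𝔽
    open FieldTheory 𝔽
      using ( F; 0#; 1#; inv; *-inv; _≟_; els; els-unique; els-complete; units; lagrange; Additive
            ; _^_; 1^; ^-≢0; *-≢0; ^-assocʳ; ^-distrib-*; roots-unity≤)
      renaming (_+_ to _⊕_; _*_ to _⊗_)

    module _ {V : List F} (uV : Unique V) {D d M M′ : ℕ} .{{_ : NonZero M}} .{{_ : NonZero d}}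
             (Dd≡n : D ℕ.* d ≡ length units) (MM′≡Q : M ℕ.* M′ ≡ length els)
             (additive : Additive M) where

      -- Only for such x are all the values (x + v)^D roots of unity. The moment runs over these x,
      -- and `Q≤K+L` shows that at most |V| elements are lost.
      Shiftable : F → Set
      Shiftable x = All (λ v → x ⊕ v ≢ 0#) V

      shiftable? : ∀ x → Dec (Shiftable x)
      shiftable? x = all? (λ v → ¬? ((x ⊕ v) ≟ 0#)) V

      K : List F
      K = filter shiftable? els

      L E d′ Q : ℤ
      L  = + length V
      E  = + (6 ℕ.* M ℕ.+ 3 ℕ.* M′)
      d′ = + d
      Q  = + length els

      K-unique : Unique K
      K-unique = Unique.filter⁺ shiftable? els-unique

      ∈K⇒≢0 : ∀ {x v} → x ∈ K → v ∈ V → x ⊕ v ≢ 0#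
      ∈K⇒≢0 x∈ = All.lookup (proj₂ (∈-filter⁻ shiftable? {xs = els} x∈))

      Q≤K+L : Q ≤ + length K + L
      Q≤K+L = +≤+ (ℕ.≤-trans (unique-⊆⇒≤ els-unique cover)
        (ℕ.≤-reflexive (trans (length-++ K) (cong (length K ℕ.+_) (length-map R.-_ V)))))
        where
        cover : ∀ {x} → x ∈ els → x ∈ K ++ map R.-_ V
        cover {x} x∈ with shiftable? x
        ... | yes s = ∈-++⁺ˡ (∈-filter⁺ shiftable? x∈ s)
        ... | no ¬s with any? (λ v → (x ⊕ v) ≟ 0#) V
        ...   | no ¬a = ⊥-elim (¬s (All.tabulate (λ v∈ eq → ¬a (lose v∈ eq))))
        ...   | yes a with find a
        ...     | v , v∈ , eq = ∈-++⁺ʳ K (subst (_∈ map R.-_ V) (sym x≡-v) (∈-map⁺ R.-_ v∈))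
          where
          x≡-v : x ≡ R.- v
          x≡-v = R.+-cancelʳ v x (R.- v) (trans eq (sym (R.-‿inverseˡ v)))

      G : List F
      G = filter (λ y → (y ^ d) ≟ 1#) els

      G-unique : Unique G
      G-unique = Unique.filter⁺ (λ y → (y ^ d) ≟ 1#) els-unique

      |G|≤d : length G ℕ.≤ d
      |G|≤d = roots-unity≤ d G-unique (λ x∈ → proj₂ (∈-filter⁻ (λ y → (y ^ d) ≟ 1#) {xs = els} x∈))

      ∈G : ∀ {y} → y ^ d ≡ 1# → y ∈ G
      ∈G {y} = ∈-filter⁺ (λ y → (y ^ d) ≟ 1#) (els-complete y)

      power^d : ∀ {z} → z ≢ 0# → (z ^ D) ^ d ≡ 1#
      power^d {z} z≢0 = trans (^-assocʳ z D d) (trans (cong (z ^_) Dd≡n) (lagrange z≢0))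

      inv^d : ∀ {z} → z ≢ 0# → z ^ d ≡ 1# → inv z ^ d ≡ 1#
      inv^d {z} z≢0 eq = trans (sym (R.*-identityˡ _)) (trans (cong (_⊗ inv z ^ d) (sym eq))
        (trans (sym (^-distrib-* z (inv z) d)) (trans (cong (_^ d) (*-inv z z≢0)) (1^ d))))

      φ : F → F → F
      φ x v = (x ⊕ v) ^ D

      ratio : F → F × F → F
      ratio x (v , v′) = φ x v ⊗ inv (φ x v′)

      N₁ N₂ N₄ : F → ℤ
      N₁ x = ∑ V (λ v → 𝟙 (φ x v ≟ 1#))
      N₂ x = ∑ V (λ v → ∑ V (λ v′ → 𝟙 (φ x v′ ≟ φ x v)))
      N₄ x = ∑ (cartesianProduct V V) (λ p → ∑ (cartesianProduct V V) (λ p′ → 𝟙 (ratio x p′ ≟ ratio x p)))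

      -- In terms of characters, d N₁ - L is the sum of the numbers S = Σ_v χ((x + v)^D) over the
      -- nontrivial characters χ of the d-th roots of unity, while d N₂ - L² and d N₄ - L⁴ are the
      -- sums of |S|² and |S|⁴. Two uses of `fibre-deviation`, for the values and then for their
      -- ratios, reproduce Hölder's inequality with its factor d³.
      fourth-power : ∀ {x} → x ∈ K → let a = d′ * N₁ x - L in
        (a * a) * (a * a) ≤ d′ * d′ * d′ * (d′ * N₄ x - L * L * (L * L))
      fourth-power {x} x∈ = begin
        (a * a) * (a * a) ≤⟨ square-mono (0≤i*i a) first ⟩
        d′ * b * (d′ * b) ≡⟨ lem₁ d′ b ⟩
        d′ * d′ * (b * b) ≤⟨ *-monoˡ-≤-nonNeg (d′ * d′) {{nonNegative (0≤i*i d′)}} second ⟩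
        d′ * d′ * (d′ * (d′ * N₄ x - L * L * (L * L))) ≡⟨ lem₂ d′ (d′ * N₄ x - L * L * (L * L)) ⟩
        d′ * d′ * d′ * (d′ * N₄ x - L * L * (L * L)) ∎
        where
        open ≤-Reasoning
        a b : ℤ
        a = d′ * N₁ x - L
        b = d′ * N₂ x - L * L
        lem₁ : ∀ d b → d * b * (d * b) ≡ d * d * (b * b)
        lem₁ = solve-∀
        lem₂ : ∀ d z → d * d * (d * z) ≡ d * d * d * z
        lem₂ = solve-∀
        ≢0 : ∀ {v} → v ∈ V → φ x v ≢ 0#
        ≢0 v∈ = ^-≢0 D (∈K⇒≢0 x∈ v∈)
        first : a * a ≤ d′ * b
        first = fibre-deviation _≟_ G-unique V (φ x) (λ v∈ → ∈G (power^d (∈K⇒≢0 x∈ v∈))) (∈G (1^ d)) |G|≤d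
        ratio∈ : ∀ {p} → p ∈ cartesianProduct V V → ratio x p ∈ G
        ratio∈ {v , v′} p∈ with ∈-cartesianProduct⁻ V V p∈
        ... | v∈ , v′∈ = ∈G (trans (^-distrib-* _ _ d) (trans (cong₂ _⊗_
                (power^d (∈K⇒≢0 x∈ v∈)) (inv^d (≢0 v′∈) (power^d (∈K⇒≢0 x∈ v′∈)))) (R.*-identityˡ 1#)))
        N₂-ratio : ∑ (cartesianProduct V V) (λ p → 𝟙 (ratio x p ≟ 1#)) ≡ N₂ x
        N₂-ratio = trans (∑-× V V _) (trans (∑-swap V V _) (∑-cong-∈ λ {v′} v′∈ → ∑-cong V λ v →
          𝟙-cong (ratio x (v , v′) ≟ 1#) (φ x v ≟ φ x v′)
            (λ eq → trans (sym (R.*-identityʳ _)) (trans (cong (φ x v ⊗_) (sym (*-inv _ (≢0 v′∈))))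
               (trans (cong (φ x v ⊗_) (R.*-comm _ _)) (trans (sym (R.*-assoc _ _ _)) (trans (cong (_⊗ φ x v′) eq) (R.*-identityˡ _))))))
            (λ eq → trans (cong (_⊗ inv (φ x v′)) eq) (*-inv _ (≢0 v′∈)))))
        second : b * b ≤ d′ * (d′ * N₄ x - L * L * (L * L))
        second = subst₂ (λ s l → (d′ * s - l) * (d′ * s - l) ≤ d′ * (d′ * N₄ x - l * l)) N₂-ratio (length-cartesianProduct V)
          (fibre-deviation _≟_ G-unique (cartesianProduct V V) (ratio x) ratio∈ (∈G (1^ d)) |G|≤d)

      -- A majorant of the indicator of coincidence in pairs. The third pairing leaves the square of
      -- (x + v₁)/(x + v₂), which for d = 2 is always a d-th power, so it must be counted among the
      -- degenerate quadruples; this costs only another L².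
      δ₄ : F × F → F × F → ℤ
      δ₄ (v₁ , v₂) (v₃ , v₄) =
        𝟙 (v₁ ≟ v₂) * 𝟙 (v₃ ≟ v₄) + 𝟙 (v₁ ≟ v₃) * 𝟙 (v₂ ≟ v₄) + 𝟙 (v₁ ≟ v₄) * 𝟙 (v₂ ≟ v₃)

      ∑-δ : ∀ {a} → a ∈ V → ∑ V (λ c → 𝟙 (a ≟ c)) ≡ 1ℤ
      ∑-δ a∈ = trans (∑-cong V (λ c → sym (*-identityʳ _))) (∑-sift _≟_ (λ _ → 1ℤ) uV a∈)

      ∑-δ₄ : ∑ (cartesianProduct V V) (λ p → ∑ (cartesianProduct V V) (δ₄ p)) ≡ + 3 * (L * L)
      ∑-δ₄ = begin
        ∑ (cartesianProduct V V) (λ p → ∑ (cartesianProduct V V) (δ₄ p))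
          ≡⟨ trans (∑-× V V _) (∑-cong V λ v₁ → ∑-cong V λ v₂ → ∑-× V V (δ₄ (v₁ , v₂))) ⟩
        ∑ V (λ v₁ → ∑ V λ v₂ → ∑ V λ v₃ → ∑ V λ v₄ → δ₄ (v₁ , v₂) (v₃ , v₄))
          ≡⟨ (∑-cong-∈ λ v₁∈ → ∑-cong-∈ λ v₂∈ → inner v₁∈ v₂∈) ⟩
        ∑ V (λ v₁ → ∑ V λ v₂ → 𝟙 (v₁ ≟ v₂) * L + + 2)
          ≡⟨ ∑-cong-∈ (λ {v₁} v₁∈ → trans (∑-+ V (λ v₂ → 𝟙 (v₁ ≟ v₂) * L) (λ _ → + 2))
               (cong₂ _+_ (trans (∑-*ʳ V L (λ v₂ → 𝟙 (v₁ ≟ v₂))) (cong (_* L) (∑-δ v₁∈))) (∑-const V (+ 2)))) ⟩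
        ∑ V (λ _ → 1ℤ * L + L * + 2)
          ≡⟨ ∑-const V (1ℤ * L + L * + 2) ⟩
        L * (1ℤ * L + L * + 2) ≡⟨ lem L ⟩
        + 3 * (L * L) ∎
        where
        open ≡-Reasoning
        lem : ∀ L → L * (1ℤ * L + L * + 2) ≡ + 3 * (L * L)
        lem = solve-∀
        row : ∀ {v₁ v₂ v₃} → v₁ ∈ V → v₂ ∈ V → v₃ ∈ V →
              ∑ V (λ v₄ → δ₄ (v₁ , v₂) (v₃ , v₄)) ≡ 𝟙 (v₁ ≟ v₂) + 𝟙 (v₁ ≟ v₃) + 𝟙 (v₂ ≟ v₃)
        row {v₁} {v₂} {v₃} v₁∈ v₂∈ v₃∈ = trans (∑-+ V _ _) (cong₂ _+_ (trans (∑-+ V _ _) (cong₂ _+_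
            (trans (∑-*ˡ V (𝟙 (v₁ ≟ v₂)) (λ v₄ → 𝟙 (v₃ ≟ v₄))) (trans (cong (𝟙 (v₁ ≟ v₂) *_) (∑-δ v₃∈)) (*-identityʳ (𝟙 (v₁ ≟ v₂)))))
            (trans (∑-*ˡ V (𝟙 (v₁ ≟ v₃)) (λ v₄ → 𝟙 (v₂ ≟ v₄))) (trans (cong (𝟙 (v₁ ≟ v₃) *_) (∑-δ v₂∈)) (*-identityʳ (𝟙 (v₁ ≟ v₃)))))))
          (trans (∑-*ʳ V (𝟙 (v₂ ≟ v₃)) (λ v₄ → 𝟙 (v₁ ≟ v₄))) (trans (cong (_* 𝟙 (v₂ ≟ v₃)) (∑-δ v₁∈)) (*-identityˡ (𝟙 (v₂ ≟ v₃))))))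
        inner : ∀ {v₁ v₂} → v₁ ∈ V → v₂ ∈ V →
                ∑ V (λ v₃ → ∑ V λ v₄ → δ₄ (v₁ , v₂) (v₃ , v₄)) ≡ 𝟙 (v₁ ≟ v₂) * L + + 2
        inner {v₁} {v₂} v₁∈ v₂∈ = begin
          ∑ V (λ v₃ → ∑ V λ v₄ → δ₄ (v₁ , v₂) (v₃ , v₄))
            ≡⟨ ∑-cong-∈ (λ v₃∈ → row v₁∈ v₂∈ v₃∈) ⟩
          ∑ V (λ v₃ → 𝟙 (v₁ ≟ v₂) + 𝟙 (v₁ ≟ v₃) + 𝟙 (v₂ ≟ v₃))
            ≡⟨ trans (∑-+ V (λ v₃ → 𝟙 (v₁ ≟ v₂) + 𝟙 (v₁ ≟ v₃)) (λ v₃ → 𝟙 (v₂ ≟ v₃)))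
                 (cong₂ _+_ (∑-+ V (λ _ → 𝟙 (v₁ ≟ v₂)) (λ v₃ → 𝟙 (v₁ ≟ v₃))) (∑-δ v₂∈)) ⟩
          ∑ V (λ _ → 𝟙 (v₁ ≟ v₂)) + ∑ V (λ v₃ → 𝟙 (v₁ ≟ v₃)) + 1ℤ
            ≡⟨ cong₂ (λ s t → s + t + 1ℤ) (trans (∑-const V (𝟙 (v₁ ≟ v₂))) (*-comm L _)) (∑-δ v₁∈) ⟩
          𝟙 (v₁ ≟ v₂) * L + 1ℤ + 1ℤ ≡⟨ +-assoc (𝟙 (v₁ ≟ v₂) * L) 1ℤ 1ℤ ⟩
          𝟙 (v₁ ≟ v₂) * L + + 2 ∎

      -- Stepanov's count needs one shift that differs from the three others, to be the point where
      -- orders of vanishing are compared. The constructors name that shift, or record that there is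
      -- none because the shifts pair up.
      data Pattern (v₁ v₂ v₃ v₄ : F) : Set where
        alone₁ : v₁ ≢ v₂ → v₁ ≢ v₃ → v₁ ≢ v₄ → Pattern v₁ v₂ v₃ v₄
        alone₂ : v₂ ≢ v₁ → v₂ ≢ v₃ → v₂ ≢ v₄ → Pattern v₁ v₂ v₃ v₄
        alone₃ : v₃ ≢ v₁ → v₃ ≢ v₂ → v₃ ≢ v₄ → Pattern v₁ v₂ v₃ v₄
        alone₄ : v₄ ≢ v₁ → v₄ ≢ v₂ → v₄ ≢ v₃ → Pattern v₁ v₂ v₃ v₄
        paired : 1ℤ ≤ δ₄ (v₁ , v₂) (v₃ , v₄) → Pattern v₁ v₂ v₃ v₄

      pattern? : ∀ v₁ v₂ v₃ v₄ → Pattern v₁ v₂ v₃ v₄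
      pattern? v₁ v₂ v₃ v₄ = classify (v₁ ≟ v₂) (v₁ ≟ v₃) (v₁ ≟ v₄) (v₃ ≟ v₄) (v₂ ≟ v₄) (v₂ ≟ v₃)
        where
        P : F → F → F → F → Set
        P a b c e = 𝟙 (a ≟ b) * 𝟙 (c ≟ e) ≡ 1ℤ
        both : ∀ {a b c e} → a ≡ b → c ≡ e → P a b c e
        both {a} {b} {c} {e} p q = cong₂ _*_ (𝟙-yes (a ≟ b) p) (𝟙-yes (c ≟ e) q)
        0≤P : ∀ a b c e → 0ℤ ≤ 𝟙 (a ≟ b) * 𝟙 (c ≟ e)
        0≤P a b c e = *-mono-≤-nonNeg ≤-refl (0≤𝟙 (a ≟ b)) (0≤𝟙 (a ≟ b)) (0≤𝟙 (c ≟ e))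
        classify : Dec (v₁ ≡ v₂) → Dec (v₁ ≡ v₃) → Dec (v₁ ≡ v₄) → Dec (v₃ ≡ v₄) → Dec (v₂ ≡ v₄) → Dec (v₂ ≡ v₃) →
                   Pattern v₁ v₂ v₃ v₄
        classify (yes p) _       _       (yes q) _       _       = paired
          (+-mono-≤ (+-mono-≤ (≤-reflexive (sym (both p q))) (0≤P v₁ v₃ v₂ v₄)) (0≤P v₁ v₄ v₂ v₃))
        classify (yes p) (yes q) _       (no r)  _       _       =
          alone₄ (λ e → r (trans (sym q) (sym e))) (λ e → r (trans (sym q) (trans p (sym e)))) (λ e → r (sym e))
        classify (yes p) (no q)  _       (no r)  _       _       =
          alone₃ (λ e → q (sym e)) (λ e → q (trans p (sym e))) r
        classify (no p)  (yes q) _       _       (yes r) _       = paired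
          (+-mono-≤ (+-mono-≤ (0≤P v₁ v₂ v₃ v₄) (≤-reflexive (sym (both q r)))) (0≤P v₁ v₄ v₂ v₃))
        classify (no p)  (yes q) _       _       (no r)  _       =
          alone₂ (λ e → p (sym e)) (λ e → p (trans q (sym e))) r
        classify (no p)  (no q)  (yes r) _       _       (yes s) = paired
          (+-mono-≤ (+-mono-≤ (0≤P v₁ v₂ v₃ v₄) (0≤P v₁ v₃ v₂ v₄)) (≤-reflexive (sym (both r s))))
        classify (no p)  (no q)  (yes r) _       _       (no s)  =
          alone₂ (λ e → p (sym e)) s (λ e → p (trans r (sym e)))
        classify (no p)  (no q)  (no r)  _       _       _       = alone₁ p q r

      0≤δ₄ : ∀ p q → 0ℤ ≤ δ₄ p q
      0≤δ₄ (v₁ , v₂) (v₃ , v₄) = +-mono-≤ (+-mono-≤ (nn v₁ v₂ v₃ v₄) (nn v₁ v₃ v₂ v₄)) (nn v₁ v₄ v₂ v₃)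
        where
        nn : ∀ a b c e → 0ℤ ≤ 𝟙 (a ≟ b) * 𝟙 (c ≟ e)
        nn a b c e = *-mono-≤-nonNeg ≤-refl (0≤𝟙 (a ≟ b)) (0≤𝟙 (a ≟ b)) (0≤𝟙 (c ≟ e))

      -- Clearing denominators brings the equality of ratios to the polynomial form A^D = B^D, with
      -- v₁ and v₄ on one side and v₂ and v₃ on the other.
      ratio-cross : ∀ {x v₁ v₂ v₃ v₄} → x ∈ K → v₂ ∈ V → v₄ ∈ V → ratio x (v₃ , v₄) ≡ ratio x (v₁ , v₂) →
                    ((x ⊕ v₁) ⊗ (x ⊕ v₄)) ^ D ≡ ((x ⊕ v₂) ⊗ (x ⊕ v₃)) ^ D
      ratio-cross {x} {v₁} {v₂} {v₃} {v₄} x∈ v₂∈ v₄∈ eq = begin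
        ((x ⊕ v₁) ⊗ (x ⊕ v₄)) ^ D ≡⟨ ^-distrib-* _ _ D ⟩
        φ x v₁ ⊗ φ x v₄ ≡⟨ cong (_⊗ φ x v₄) (undo v₁ v₂ v₂∈) ⟨
        ratio x (v₁ , v₂) ⊗ φ x v₂ ⊗ φ x v₄ ≡⟨ cong (λ r → r ⊗ φ x v₂ ⊗ φ x v₄) eq ⟨
        ratio x (v₃ , v₄) ⊗ φ x v₂ ⊗ φ x v₄
          ≡⟨ R.solve 3 (λ r s t → (r R.:* s) R.:* t R.:= s R.:* (r R.:* t)) refl (ratio x (v₃ , v₄)) (φ x v₂) (φ x v₄) ⟩
        φ x v₂ ⊗ (ratio x (v₃ , v₄) ⊗ φ x v₄) ≡⟨ cong (φ x v₂ ⊗_) (undo v₃ v₄ v₄∈) ⟩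
        φ x v₂ ⊗ φ x v₃ ≡⟨ ^-distrib-* _ _ D ⟨
        ((x ⊕ v₂) ⊗ (x ⊕ v₃)) ^ D ∎
        where
        open ≡-Reasoning
        undo : ∀ v v′ → v′ ∈ V → ratio x (v , v′) ⊗ φ x v′ ≡ φ x v
        undo v v′ v′∈ = trans (R.*-assoc _ _ _) (trans (cong (φ x v ⊗_)
          (trans (R.*-comm _ _) (*-inv _ (^-≢0 D (∈K⇒≢0 x∈ v′∈))))) (R.*-identityʳ _))

      pair-count : ∀ {v₁ v₂ v₃ v₄} → v₁ ∈ V → v₂ ∈ V → v₃ ∈ V → v₄ ∈ V →
        d′ * ∑ K (λ x → 𝟙 (ratio x (v₃ , v₄) ≟ ratio x (v₁ , v₂))) ≤
        (Q + d′ * E) + d′ * Q * δ₄ (v₁ , v₂) (v₃ , v₄)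
      pair-count {v₁} {v₂} {v₃} {v₄} v₁∈ v₂∈ v₃∈ v₄∈ =
        subst (λ s → d′ * s ≤ (Q + d′ * E) + d′ * Q * δ₄ (v₁ , v₂) (v₃ , v₄)) (sym (∑-𝟙 same? K)) (cases (pattern? v₁ v₂ v₃ v₄))
        where
        same? : ∀ x → Dec (ratio x (v₃ , v₄) ≡ ratio x (v₁ , v₂))
        same? x = ratio x (v₃ , v₄) ≟ ratio x (v₁ , v₂)
        xs : List F
        xs = filter same? K
        xs-unique : Unique xs
        xs-unique = Unique.filter⁺ same? K-unique
        eqn : ∀ {x} → x ∈ xs → x ∈ K × ((x ⊕ v₁) ⊗ (x ⊕ v₄)) ^ D ≡ ((x ⊕ v₂) ⊗ (x ⊕ v₃)) ^ D
        eqn x∈ with ∈-filter⁻ same? {xs = K} x∈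
        ... | x∈K , eq = x∈K , ratio-cross x∈K v₂∈ v₄∈ eq
        Δ : ℤ
        Δ = d′ * Q * δ₄ (v₁ , v₂) (v₃ , v₄)
        0≤d′Q : 0ℤ ≤ d′ * Q
        0≤d′Q = ≤-trans (+≤+ ℕ.z≤n) (≤-reflexive (pos-* d (length els)))
        0≤Δ : 0ℤ ≤ Δ
        0≤Δ = *-mono-≤-nonNeg ≤-refl 0≤d′Q 0≤d′Q (0≤δ₄ (v₁ , v₂) (v₃ , v₄))
        good : d ℕ.* length xs ℕ.≤ M ℕ.* M′ ℕ.+ d ℕ.* (6 ℕ.* M ℕ.+ 3 ℕ.* M′) →
               d′ * + length xs ≤ (Q + d′ * E) + Δ
        good le = ≤-trans (≤-reflexive (sym (pos-* d (length xs)))) (≤-trans (+≤+ le)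
          (≤-trans (≤-reflexive (cong₂ _+_ (cong +_ MM′≡Q) (pos-* d (6 ℕ.* M ℕ.+ 3 ℕ.* M′))))
            (≤-trans (≤-reflexive (sym (+-identityʳ (Q + d′ * E)))) (+-monoʳ-≤ (Q + d′ * E) 0≤Δ))))
        cases : Pattern v₁ v₂ v₃ v₄ → d′ * + length xs ≤ (Q + d′ * E) + Δ
        -- The isolated shift plays a, its companion on the same side of the cross-multiplied
        -- equation plays b, and the two sides are exchanged where necessary.
        cases (alone₁ n₂ n₃ n₄) = good (count-bound 𝔽 {b = v₄} n₄ n₂ n₃ {D} {d} Dd≡n MM′≡Q additive xs-unique (λ {x} x∈ →
          let (x∈K , eq) = eqn x∈ in eq , ∈K⇒≢0 x∈K v₁∈ , *-≢0 (∈K⇒≢0 x∈K v₂∈) (∈K⇒≢0 x∈K v₃∈)))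
        cases (alone₂ n₁ n₃ n₄) = good (count-bound 𝔽 {b = v₃} n₃ n₁ n₄ {D} {d} Dd≡n MM′≡Q additive xs-unique (λ {x} x∈ →
          let (x∈K , eq) = eqn x∈ in sym eq , ∈K⇒≢0 x∈K v₂∈ , *-≢0 (∈K⇒≢0 x∈K v₁∈) (∈K⇒≢0 x∈K v₄∈)))
        cases (alone₃ n₁ n₂ n₄) = good (count-bound 𝔽 {b = v₂} n₂ n₁ n₄ {D} {d} Dd≡n MM′≡Q additive xs-unique (λ {x} x∈ →
          let (x∈K , eq) = eqn x∈ in trans (cong (_^ D) (R.*-comm _ _)) (sym eq) , ∈K⇒≢0 x∈K v₃∈ , *-≢0 (∈K⇒≢0 x∈K v₁∈) (∈K⇒≢0 x∈K v₄∈)))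
        cases (alone₄ n₁ n₂ n₃) = good (count-bound 𝔽 {b = v₁} n₁ n₂ n₃ {D} {d} Dd≡n MM′≡Q additive xs-unique (λ {x} x∈ →
          let (x∈K , eq) = eqn x∈ in trans (cong (_^ D) (R.*-comm _ _)) eq , ∈K⇒≢0 x∈K v₄∈ , *-≢0 (∈K⇒≢0 x∈K v₂∈) (∈K⇒≢0 x∈K v₃∈)))
        -- For degenerate quadruples every x may be a solution; the trivial bound d Q is charged to
        -- δ₄.
        cases (paired 1≤δ) = begin
          d′ * + length xs ≤⟨ *-monoˡ-≤-nonNeg d′ (+≤+ (unique-⊆⇒≤ xs-unique (λ {x} _ → els-complete x))) ⟩
          d′ * Q ≡⟨ *-identityʳ _ ⟨
          d′ * Q * 1ℤ ≤⟨ *-monoˡ-≤-nonNeg (d′ * Q) {{nonNegative 0≤d′Q}} 1≤δ ⟩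
          Δ ≡⟨ +-identityˡ Δ ⟨
          0ℤ + Δ ≤⟨ +-monoˡ-≤ Δ (+-mono-≤ {0ℤ} {Q} (+≤+ ℕ.z≤n) (≤-trans (+≤+ ℕ.z≤n) (≤-reflexive (pos-* d (6 ℕ.* M ℕ.+ 3 ℕ.* M′))))) ⟩
          (Q + d′ * E) + Δ ∎
          where open ≤-Reasoning

      -- The main terms nearly cancel: the quadruples contribute at most Q L⁴ and the subtracted
      -- average at least (Q - L) L⁴. The remaining L⁵ joins the error, and the degenerate
      -- quadruples add 3 d Q L².
      moment : ∑ K (λ x → d′ * N₄ x - L * L * (L * L)) ≤ L * L * (L * L) * (d′ * E + L) + + 3 * d′ * Q * (L * L)
      moment = begin
        ∑ K (λ x → d′ * N₄ x - L⁴)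
          ≡⟨ ∑-+ K (λ x → d′ * N₄ x) (λ _ → - L⁴) ⟩
        ∑ K (λ x → d′ * N₄ x) + ∑ K (λ _ → - L⁴)
          ≡⟨ cong₂ _+_ exchange (∑-const K (- L⁴)) ⟩
        ∑ VV (λ p → ∑ VV (λ p′ → d′ * ∑ K (λ x → 𝟙 (ratio x p′ ≟ ratio x p)))) + + length K * - L⁴
          ≤⟨ +-mono-≤ (∑-mono λ p∈ → ∑-mono λ p′∈ → bound p∈ p′∈) (K-part) ⟩
        ∑ VV (λ p → ∑ VV (λ p′ → (Q + d′ * E) + d′ * Q * δ₄ p p′)) + (Q - L) * - L⁴
          ≡⟨ cong (_+ (Q - L) * - L⁴) total ⟩
        (L * L * (L * L * (Q + d′ * E)) + d′ * Q * (+ 3 * (L * L))) + (Q - L) * - L⁴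
          ≡⟨ lem L Q d′ E ⟩
        L⁴ * (d′ * E + L) + + 3 * d′ * Q * (L * L) ∎
        where
        open ≤-Reasoning
        VV : List (F × F)
        VV = cartesianProduct V V
        L⁴ : ℤ
        L⁴ = L * L * (L * L)
        exchange : ∑ K (λ x → d′ * N₄ x) ≡ ∑ VV (λ p → ∑ VV (λ p′ → d′ * ∑ K (λ x → 𝟙 (ratio x p′ ≟ ratio x p))))
        exchange = trans (∑-*ˡ K d′ N₄) (trans (cong (d′ *_) (trans (∑-swap K VV _) (∑-cong VV λ p → ∑-swap K VV _)))
          (trans (sym (∑-*ˡ VV d′ _)) (∑-cong VV λ p → sym (∑-*ˡ VV d′ _))))
        bound : ∀ {p p′} → p ∈ VV → p′ ∈ VV →
                d′ * ∑ K (λ x → 𝟙 (ratio x p′ ≟ ratio x p)) ≤ (Q + d′ * E) + d′ * Q * δ₄ p p′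
        bound {v₁ , v₂} {v₃ , v₄} p∈ p′∈ with ∈-cartesianProduct⁻ V V p∈ | ∈-cartesianProduct⁻ V V p′∈
        ... | v₁∈ , v₂∈ | v₃∈ , v₄∈ = pair-count v₁∈ v₂∈ v₃∈ v₄∈
        0≤L⁴ : 0ℤ ≤ L⁴
        0≤L⁴ = 0≤i*i (L * L)
        K-part : + length K * - L⁴ ≤ (Q - L) * - L⁴
        K-part = begin
          + length K * - L⁴ ≡⟨ neg-distribʳ-* (+ length K) L⁴ ⟨
          - (+ length K * L⁴) ≤⟨ neg-mono-≤ (*-monoʳ-≤-nonNeg L⁴ {{nonNegative 0≤L⁴}} Q-L≤K) ⟩
          - ((Q - L) * L⁴) ≡⟨ neg-distribʳ-* (Q - L) L⁴ ⟩
          (Q - L) * - L⁴ ∎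
          where
          cancel : ∀ k l → k + l - l ≡ k
          cancel = solve-∀
          Q-L≤K : Q - L ≤ + length K
          Q-L≤K = ≤-trans (+-monoˡ-≤ (- L) Q≤K+L) (≤-reflexive (cancel (+ length K) L))
        total : ∑ VV (λ p → ∑ VV (λ p′ → (Q + d′ * E) + d′ * Q * δ₄ p p′)) ≡
                L * L * (L * L * (Q + d′ * E)) + d′ * Q * (+ 3 * (L * L))
        total = trans (∑-cong VV (λ p → trans (∑-+ VV (λ _ → Q + d′ * E) (λ p′ → d′ * Q * δ₄ p p′))
                  (cong₂ _+_ (trans (∑-const VV (Q + d′ * E)) (cong (_* (Q + d′ * E)) (length-cartesianProduct V)))
                             (∑-*ˡ VV (d′ * Q) (δ₄ p)))))
          (trans (∑-+ VV (λ _ → L * L * (Q + d′ * E)) (λ p → d′ * Q * ∑ VV (δ₄ p)))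
            (cong₂ _+_ (trans (∑-const VV (L * L * (Q + d′ * E))) (cong (_* (L * L * (Q + d′ * E))) (length-cartesianProduct V)))
              (trans (∑-*ˡ VV (d′ * Q) (λ p → ∑ VV (δ₄ p))) (cong (d′ * Q *_) ∑-δ₄))))
        lem : ∀ L Q d E → (L * L * (L * L * (Q + d * E)) + d * Q * (+ 3 * (L * L))) + (Q - L) * - (L * L * (L * L)) ≡
              L * L * (L * L) * (d * E + L) + + 3 * d * Q * (L * L)
        lem = solve-∀

      module _ {U : List F} (uU : Unique U) (U+V≢0 : ∀ {u v} → u ∈ U → v ∈ V → u ⊕ v ≢ 0#) where

        private
          A : F → ℤ
          A x = d′ * N₁ x - L

          A² : F → ℤ
          A² x = A x * A x

        -- Hölder's inequality on U is Cauchy-Schwarz applied twice. The sum over U may then be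
        -- enlarged to all shiftable x because every term is a fourth power; that U is contained
        -- there is the condition u + v ≠ 0.
        discrepancy⁴ : let δ = d′ * ∑ U N₁ - + length U * L; u = + length U in
          (δ * δ) * (δ * δ) ≤ u * u * u * (d′ * d′ * d′ * (L * L * (L * L) * (d′ * E + L) + + 3 * d′ * Q * (L * L)))
        discrepancy⁴ = begin
          (δ * δ) * (δ * δ)
            ≡⟨ cong (λ s → (s * s) * (s * s)) ∑A ⟨
          (S * S) * (S * S)
            ≤⟨ square-mono (0≤i*i S) (cauchy-schwarz U A) ⟩
          u * ∑ U A² * (u * ∑ U A²)
            ≡⟨ lem u (∑ U A²) ⟩
          u * u * (∑ U A² * ∑ U A²)
            ≤⟨ *-monoˡ-≤-nonNeg (u * u) {{nonNegative (0≤i*i u)}} (cauchy-schwarz U A²) ⟩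
          u * u * (u * ∑ U (λ x → A² x * A² x))
            ≡⟨ *-assoc (u * u) u _ ⟨
          u * u * u * ∑ U (λ x → A² x * A² x)
            ≤⟨ *-monoˡ-≤-nonNeg (u * u * u) {{nonNegative 0≤u³}} fourth ⟩
          u * u * u * (d′ * d′ * d′ * (L * L * (L * L) * (d′ * E + L) + + 3 * d′ * Q * (L * L))) ∎
          where
          open ≤-Reasoning
          u δ S d³ : ℤ
          u  = + length U
          δ  = d′ * ∑ U N₁ - u * L
          S  = ∑ U A
          d³ = d′ * d′ * d′
          lem : ∀ u s → u * s * (u * s) ≡ u * u * (s * s)
          lem = solve-∀
          0≤cube : ∀ n → 0ℤ ≤ + n * + n * + n
          0≤cube n = *-mono-≤-nonNeg {0ℤ} {+ n * + n} {0ℤ} {+ n} ≤-refl (0≤i*i (+ n)) (0≤i*i (+ n)) (+≤+ ℕ.z≤n)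
          0≤u³ : 0ℤ ≤ u * u * u
          0≤u³ = 0≤cube (length U)
          ∑A : S ≡ δ
          ∑A = trans (∑-+ U (λ x → d′ * N₁ x) (λ _ → - L))
            (cong₂ _+_ (∑-*ˡ U d′ N₁) (trans (∑-const U (- L)) (sym (neg-distribʳ-* u L))))
          U⊆K : ∀ {x} → x ∈ U → x ∈ K
          U⊆K {x} x∈ = ∈-filter⁺ shiftable? (els-complete x) (All.tabulate (U+V≢0 x∈))
          fourth : ∑ U (λ x → A² x * A² x) ≤ d³ * (L * L * (L * L) * (d′ * E + L) + + 3 * d′ * Q * (L * L))
          fourth = begin
            ∑ U (λ x → A² x * A² x) ≤⟨ ∑-⊆-mono uU U⊆K (λ x → 0≤i*i (A² x)) ⟩
            ∑ K (λ x → A² x * A² x) ≤⟨ ∑-mono fourth-power ⟩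
            ∑ K (λ x → d³ * (d′ * N₄ x - L * L * (L * L))) ≡⟨ ∑-*ˡ K d³ (λ x → d′ * N₄ x - L * L * (L * L)) ⟩
            d³ * ∑ K (λ x → d′ * N₄ x - L * L * (L * L)) ≤⟨ *-monoˡ-≤-nonNeg d³ {{nonNegative (0≤cube d)}} moment ⟩
            d³ * (L * L * (L * L) * (d′ * E + L) + + 3 * d′ * Q * (L * L)) ∎

-- From the fourth moment to equidistribution on the sumset

module Discrepancy where

  open import Data.Integer using (ℤ; +_; ∣_∣)
  import Data.Integer as ℤ
  import Data.Integer.Properties as ℤ
  open import Data.Nat hiding (_≟_; _^_)
  open import Data.Nat.Properties hiding (_≟_)
  open import Data.Nat.Tactic.RingSolver using (solve-∀)
  open import Relation.Binary.PropositionalEquality hiding ([_])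

  open IntSum
  open Field using (FinField; module FieldTheory)
  open Moments using (module FourthMoment)

  private
    _⊛_ : ∀ {x y a b} → x ≡ + a → y ≡ + b → x ℤ.* y ≡ + (a * b)
    _⊛_ {a = a} {b} p q = trans (cong₂ ℤ._*_ p q) (sym (ℤ.pos-* a b))

    _⊞_ : ∀ {x y a b} → x ≡ + a → y ≡ + b → x ℤ.+ y ≡ + (a + b)
    _⊞_ {a = a} {b} p q = trans (cong₂ ℤ._+_ p q) (sym (ℤ.pos-+ a b))

    i*i≡+∣i∣*∣i∣ : ∀ i → i ℤ.* i ≡ + (∣ i ∣ * ∣ i ∣)
    i*i≡+∣i∣*∣i∣ i = trans (sym (ℤ.0≤i⇒+∣i∣≡i (0≤i*i i))) (cong +_ (ℤ.abs-* i i))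

    bound-cast : ∀ u d l E Q →
      + u ℤ.* + u ℤ.* + u ℤ.* (+ d ℤ.* + d ℤ.* + d ℤ.* (+ l ℤ.* + l ℤ.* (+ l ℤ.* + l) ℤ.* (+ d ℤ.* + E ℤ.+ + l) ℤ.+ + 3 ℤ.* + d ℤ.* + Q ℤ.* (+ l ℤ.* + l)))
      ≡ + (u * u * u * (d * d * d * (l * l * (l * l) * (d * E + l) + 3 * d * Q * (l * l))))
    bound-cast u d l E Q =
      ((u′ ⊛ u′) ⊛ u′) ⊛ (((d′ ⊛ d′) ⊛ d′) ⊛
        ((((l′ ⊛ l′) ⊛ (l′ ⊛ l′)) ⊛ ((d′ ⊛ refl {x = + E}) ⊞ l′)) ⊞ (((refl {x = + 3} ⊛ d′) ⊛ refl {x = + Q}) ⊛ (l′ ⊛ l′))))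
      where
      u′ = refl {x = + u}
      d′ = refl {x = + d}
      l′ = refl {x = + l}

  fourth-power-cancel-≤ : ∀ {a b} → a * a * (a * a) ≤ b * b * (b * b) → a ≤ b
  fourth-power-cancel-≤ {a} {b} le = ≮⇒≥ λ b<a → <⇒≱ (*-mono-< (*-mono-< b<a b<a) (*-mono-< b<a b<a)) le

  -- After dE + l ≤ 10 d M′ the bound on δ⁴ contains exactly d⁴, which cancels against (d u l)⁴. The
  -- remaining condition on Λ is therefore the same for every divisor d.
  scale-fourth-power : ∀ {Λ δ u d l E M′ Q} → δ * δ * (δ * δ) ≤ u * u * u * (d * d * d * (l * l * (l * l) * (d * E + l) + 3 * d * Q * (l * l))) →
    d * E + l ≤ d * (10 * M′) → Λ * Λ * (Λ * Λ) * (10 * M′ * (l * l) + 3 * Q) ≤ u * (l * l) →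
    Λ * δ ≤ d * (u * l)
  scale-fourth-power {Λ} {δ} {u} {d} {l} {E} {M′} {Q} le₁ le₂ le₃ = fourth-power-cancel-≤ (begin
    Λ * δ * (Λ * δ) * (Λ * δ * (Λ * δ)) ≡⟨ lem₁ Λ δ ⟩
    Λ⁴ * (δ * δ * (δ * δ)) ≤⟨ *-monoʳ-≤ Λ⁴ le₁ ⟩
    Λ⁴ * (u * u * u * (d * d * d * (l * l * (l * l) * (d * E + l) + 3 * d * Q * (l * l))))
      ≤⟨ *-monoʳ-≤ Λ⁴ (*-monoʳ-≤ (u * u * u) (*-monoʳ-≤ (d * d * d) (+-monoˡ-≤ (3 * d * Q * (l * l)) (*-monoʳ-≤ (l * l * (l * l)) le₂)))) ⟩
    Λ⁴ * (u * u * u * (d * d * d * (l * l * (l * l) * (d * (10 * M′)) + 3 * d * Q * (l * l))))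
      ≡⟨ lem₂ Λ⁴ u d l M′ Q ⟩
    u * u * u * (d * d * (d * d)) * (l * l) * (Λ⁴ * (10 * M′ * (l * l) + 3 * Q))
      ≤⟨ *-monoʳ-≤ (u * u * u * (d * d * (d * d)) * (l * l)) le₃ ⟩
    u * u * u * (d * d * (d * d)) * (l * l) * (u * (l * l)) ≡⟨ lem₃ u d l ⟩
    d * (u * l) * (d * (u * l)) * (d * (u * l) * (d * (u * l))) ∎)
    where
    open ≤-Reasoning
    Λ⁴ : ℕ
    Λ⁴ = Λ * Λ * (Λ * Λ)
    lem₁ : ∀ a b → a * b * (a * b) * (a * b * (a * b)) ≡ a * a * (a * a) * (b * b * (b * b))
    lem₁ = solve-∀
    lem₂ : ∀ Λ u d l M′ Q → Λ * (u * u * u * (d * d * d * (l * l * (l * l) * (d * (10 * M′)) + 3 * d * Q * (l * l)))) ≡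
           u * u * u * (d * d * (d * d)) * (l * l) * (Λ * (10 * M′ * (l * l) + 3 * Q))
    lem₂ = solve-∀
    lem₃ : ∀ u d l → u * u * u * (d * d * (d * d)) * (l * l) * (u * (l * l)) ≡
           d * (u * l) * (d * (u * l)) * (d * (u * l) * (d * (u * l)))
    lem₃ = solve-∀

  module _ (𝔽 : FinField) where
    open FieldTheory 𝔽
      using (F; 0#; 1#; _≟_; els; units; Additive; _^_)
      renaming (_+_ to _⊕_)

    discrepancy : ∀ {U V : List F} → Unique U → Unique V → (∀ {u v} → u ∈ U → v ∈ V → u ⊕ v ≢ 0#) →
      ∀ {M M′} .{{_ : NonZero M}} → M * M′ ≡ length els → Additive M → length V ≤ M → M ≤ M′ →
      ∀ {Λ} → Λ * Λ * (Λ * Λ) * (10 * M′ * (length V * length V) + 3 * length els) ≤ length U * (length V * length V) →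
      ∀ D d .{{_ : NonZero d}} → D * d ≡ length units →
      Λ * ∣ + d ℤ.* ∑ U (λ u → ∑ V (λ v → 𝟙 (((u ⊕ v) ^ D) ≟ 1#))) ℤ.- + length U ℤ.* + length V ∣ ≤ d * (length U * length V)
    discrepancy {U} {V} uU uV nz {M} {M′} MM′≡Q add V≤M M≤M′ {Λ} le D d@(suc _) Dd≡n =
      scale-fourth-power {Λ} {∣ δ ∣} {u} {d} {l} {E} {M′} {length els} fourth dE+l≤ le
      where
      u l E : ℕ
      u = length U
      l = length V
      E = 6 * M + 3 * M′
      δ : ℤ
      δ = + d ℤ.* ∑ U (λ u → ∑ V (λ v → 𝟙 (((u ⊕ v) ^ D) ≟ 1#))) ℤ.- + u ℤ.* + l
      fourth : ∣ δ ∣ * ∣ δ ∣ * (∣ δ ∣ * ∣ δ ∣) ≤ u * u * u * (d * d * d * (l * l * (l * l) * (d * E + l) + 3 * d * length els * (l * l)))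
      fourth = ℤ.drop‿+≤+ (subst₂ ℤ._≤_ (i*i≡+∣i∣*∣i∣ δ ⊛ i*i≡+∣i∣*∣i∣ δ)
        (bound-cast u d l E (length els))
        (FourthMoment.discrepancy⁴ 𝔽 uV {D} {d} Dd≡n MM′≡Q add uU nz))
      -- 10 = 6 + 3 + 1: since |V| ≤ M, the lone l counts as one more M, and M ≤ M′ merges the two
      -- error terms.
      dE+l≤ : d * E + l ≤ d * (10 * M′)
      dE+l≤ = begin
        d * E + l ≤⟨ +-monoʳ-≤ (d * E) (≤-trans V≤M (m≤n*m M d)) ⟩
        d * E + d * M ≡⟨ lem d M M′ ⟩
        d * (7 * M + 3 * M′) ≤⟨ *-monoʳ-≤ d (+-monoˡ-≤ (3 * M′) (*-monoʳ-≤ 7 M≤M′)) ⟩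
        d * (7 * M′ + 3 * M′) ≡⟨ cong (d *_) (*-distribʳ-+ M′ 7 3) ⟨
        d * (10 * M′) ∎
        where
        open ≤-Reasoning
        lem : ∀ d M M′ → d * (6 * M + 3 * M′) + d * M ≡ d * (7 * M + 3 * M′)
        lem = solve-∀

-- Prime divisors and their number

module Primes where

  open import Data.Nat
  open import Data.Nat.Coprimality using (Coprime; prime⇒coprime)
  open import Data.Nat.Divisibility
  open import Data.Nat.DivMod using (_/_; m*n/n≡m)
  open import Data.Nat.ListAction using (product)
  open import Data.Nat.Primality using (Prime; prime?; euclidsLemma; prime⇒nonZero)
  open import Data.Nat.Primality.Factorisation using (factorisationHasAllPrimeFactors; factorise)
  open import Data.Nat.Properties
  open import Relation.Binary.PropositionalEquality hiding ([_])

  open Lists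

  module _ (n : ℕ) where

    private
      primeDivisor? : ∀ p → Dec (Prime p × p ∣ n)
      primeDivisor? p = prime? p ×-dec (p ∣? n)

    primeDivisors : List ℕ
    primeDivisors = filter primeDivisor? (upTo (suc n))

    primeDivisors-unique : Unique primeDivisors
    primeDivisors-unique = Unique.filter⁺ primeDivisor? (Unique.upTo⁺ (suc n))

    ∈primeDivisors⁻ : ∀ {p} → p ∈ primeDivisors → Prime p × p ∣ n
    ∈primeDivisors⁻ p∈ = proj₂ (∈-filter⁻ primeDivisor? {xs = upTo (suc n)} p∈)

    ∈primeDivisors⁺ : .{{_ : NonZero n}} → ∀ {p} → Prime p → p ∣ n → p ∈ primeDivisors
    ∈primeDivisors⁺ pr p∣n = ∈-filter⁺ primeDivisor? (∈-upTo⁺ (s≤s (∣⇒≤ p∣n))) (pr , p∣n)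

  -- By induction n = c · `product ps`. The new prime cannot divide `product ps`, since it would
  -- then occur in `ps`, so it divides c.
  product∣ : ∀ {ps n} → Unique ps → All Prime ps → All (_∣ n) ps → product ps ∣ n
  product∣ {[]}     {n} _ _ _ = 1∣ n
  product∣ {p ∷ ps} {n} (p∉ ∷ u) (pr ∷ prs) (p∣n ∷ ps∣n) with product∣ u prs ps∣n
  ... | divides q refl with euclidsLemma q (product ps) pr p∣n
  ...   | inj₁ p∣q = *-monoˡ-∣ (product ps) p∣q
  ...   | inj₂ p∣Π = ⊥-elim (All.lookup p∉ (factorisationHasAllPrimeFactors pr p∣Π prs) refl)

  distinct-primes-coprime : ∀ {p q} → Prime p → Prime q → p ≢ q → Coprime p q
  distinct-primes-coprime {p} {q} pr qr p≢q with <-cmp p q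
  ... | tri< p<q _ _ = Coprime.sym (prime⇒coprime qr {{prime⇒nonZero pr}} p<q)
  ... | tri≈ _ p≡q _ = ⊥-elim (p≢q p≡q)
  ... | tri> _ _ q<p = prime⇒coprime pr {{prime⇒nonZero qr}} q<p

  prime-divisor : ∀ {n} → 2 ≤ n → ∃ λ p → Prime p × p ∣ n
  prime-divisor {n} 2≤n with factorise n {{>-nonZero (≤-trans (s≤s z≤n) 2≤n)}}
  ... | record { factors = [] ; isFactorisation = eq } = ⊥-elim (<⇒≢ 2≤n (sym eq))
  ... | record { factors = p ∷ ps ; isFactorisation = eq ; factorsPrime = pr ∷ _ } =
    p , pr , subst (p ∣_) (sym eq) (m∣m*n (product ps))

  length≤B+large : ∀ B {ps} → Unique ps → length ps ≤ B + length (filter (B ≤?_) ps)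
  length≤B+large B {ps} u = ≤-trans (unique-⊆⇒≤ u cover)
    (≤-reflexive (trans (length-++ (upTo B)) (cong (_+ length (filter (B ≤?_) ps)) (length-upTo B))))
    where
    cover : ∀ {p} → p ∈ ps → p ∈ upTo B ++ filter (B ≤?_) ps
    cover {p} p∈ with B ≤? p
    ... | yes B≤p = ∈-++⁺ʳ (upTo B) (∈-filter⁺ (B ≤?_) p∈ B≤p)
    ... | no  B≰p = ∈-++⁺ˡ (∈-upTo⁺ (≰⇒> B≰p))

  ^-length-filter≤product : ∀ {B} {P : ℕ → Set} (P? : ∀ p → Dec (P p)) → (∀ {p} → P p → B ≤ p) →
                             ∀ {ps} → All NonZero ps → B ^ length (filter P? ps) ≤ product ps
  ^-length-filter≤product P? le [] = s≤s z≤n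
  ^-length-filter≤product P? le {p ∷ ps} (p≢0 ∷ ps≢0) with P? p
  ... | yes Pp = *-mono-≤ (le Pp) (^-length-filter≤product P? le ps≢0)
  ... | no  _  = ≤-trans (^-length-filter≤product P? le ps≢0) (m≤n*m (product ps) p {{p≢0}})

  B^large≤product : ∀ B {ps} → All NonZero ps → B ^ length (filter (B ≤?_) ps) ≤ product ps
  B^large≤product B = ^-length-filter≤product (B ≤?_) (λ le → le)

  -- Division made total in the divisor, with junk value 0 for the divisor 0.
  _÷_ : ℕ → ℕ → ℕ
  m ÷ zero  = 0
  m ÷ suc n = m / suc n

  n*m÷n≡m : ∀ m n .{{_ : NonZero n}} → (n * m) ÷ n ≡ m
  n*m÷n≡m m n@(suc _) = trans (cong (_/ n) (*-comm n m)) (m*n/n≡m m n)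

  m÷n*n≡m : ∀ {m n} .{{_ : NonZero n}} → n ∣ m → (m ÷ n) * n ≡ m
  m÷n*n≡m {n = n} (divides e refl) = cong (_* n) (trans (cong (_÷ n) (*-comm e n)) (n*m÷n≡m e n))

-- Multiplicative sieve for primitive elements

module Sieve where

  open import Data.Integer using (ℤ; +_; 0ℤ; ∣_∣)
  import Data.Integer as ℤ
  import Data.Integer.Properties as ℤ
  import Data.Integer.Tactic.RingSolver as ℤ-Solver
  open import Data.Nat hiding (_≟_; _^_)
  import Data.Nat as ℕ
  open import Data.Nat.Coprimality using (coprime-Bézout)
  open import Data.Nat.Divisibility
  open import Data.Nat.GCD using (module Bézout; gcd; gcd-GCD; gcd[m,n]∣m; gcd[m,n]∣n)
  open import Data.Nat.ListAction using (product)
  open import Data.Nat.ListAction.Properties using (∈⇒∣product)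
  open import Data.Nat.Primality using (Prime; prime⇒nonZero; prime⇒nonTrivial)
  open import Data.Nat.Properties hiding (_≟_)
  open import Data.Nat.Tactic.RingSolver using (solve-∀)
  open import Relation.Binary.PropositionalEquality hiding ([_])

  open Lists
  open IntSum
  open Field using (FinField; module FieldTheory)
  open Primes

  module MultiplicativeSieve (𝔽 : FinField) where
    open FieldTheory 𝔽
      using (F; 0#; 1#; _≟_; els; units; units-unique; ∈units; ∈units⇒≢0; length-units; lagrange
            ; _^_; ^-homo-*; ^-assocʳ; 1^; ^-≢0; *-cancelˡ)
      renaming (_*_ to _⊗_; *-identityʳ to ⊗-identityʳ)

    ^-multiple≡1 : ∀ {x a} b → x ^ a ≡ 1# → x ^ (b * a) ≡ 1#
    ^-multiple≡1 {x} {a} b eq = begin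
      x ^ (b * a) ≡⟨ cong (x ^_) (*-comm b a) ⟩
      x ^ (a * b) ≡⟨ ^-assocʳ x a b ⟨
      (x ^ a) ^ b ≡⟨ cong (_^ b) eq ⟩
      1# ^ b ≡⟨ 1^ b ⟩
      1# ∎
      where open ≡-Reasoning

    ^-bézout≡1 : ∀ {x a b g} → Bézout.Identity g a b → x ^ a ≡ 1# → x ^ b ≡ 1# → x ^ g ≡ 1#
    ^-bézout≡1 {x} {a} {b} {g} (Bézout.+- s t eq) xa xb = begin
      x ^ g ≡⟨ ⊗-identityʳ _ ⟨
      x ^ g ⊗ 1# ≡⟨ cong (x ^ g ⊗_) (^-multiple≡1 t xb) ⟨
      x ^ g ⊗ x ^ (t * b) ≡⟨ ^-homo-* x g (t * b) ⟨
      x ^ (g + t * b) ≡⟨ cong (x ^_) eq ⟩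
      x ^ (s * a) ≡⟨ ^-multiple≡1 s xa ⟩
      1# ∎
      where open ≡-Reasoning
    ^-bézout≡1 {x} {a} {b} {g} (Bézout.-+ s t eq) xa xb =
      ^-bézout≡1 {x} {b} {a} (Bézout.+- t s eq) xb xa

    -- With D the number of units and `ps` all its prime divisors this singles out the generators;
    -- smaller D and shorter lists arise in the recursion.
    Free : ℕ → List ℕ → F → Set
    Free D ps x = x ^ D ≡ 1# × All (λ p → x ^ (D ÷ p) ≢ 1#) ps

    free? : ∀ D ps x → Dec (Free D ps x)
    free? D ps x = (x ^ D) ≟ 1# ×-dec all? (λ p → ¬? ((x ^ (D ÷ p)) ≟ 1#)) ps

    ÷-chain : ∀ {D q} p .{{_ : NonZero q}} → q ∣ D → (p * D) ÷ q ≡ p * (D ÷ q)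
    ÷-chain {D} {q} p (divides e refl) = begin
      (p * (e * q)) ÷ q ≡⟨ cong (_÷ q) (lem p e q) ⟩
      (q * (p * e)) ÷ q ≡⟨ n*m÷n≡m (p * e) q ⟩
      p * e ≡⟨ cong (p *_) (n*m÷n≡m e q) ⟨
      p * ((q * e) ÷ q) ≡⟨ cong (λ m → p * (m ÷ q)) (*-comm q e) ⟩
      p * ((e * q) ÷ q) ∎
      where
      open ≡-Reasoning
      lem : ∀ p e q → p * (e * q) ≡ q * (p * e)
      lem = solve-∀

    -- One step of inclusion and exclusion: the condition at p, relative to p D, says x^D ≠ 1. When
    -- x^D = 1, freeness at the other primes is the same relative to p D and to D.
    free-split : ∀ {D p ps} → Prime p → All Prime ps → All (p ≢_) ps → All (_∣ D) ps → ∀ x →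
                 𝟙 (free? (p * D) (p ∷ ps) x) ≡ 𝟙 (free? (p * D) ps x) ℤ.- 𝟙 (free? D ps x)
    free-split {D} {p} {ps} pr prs p∉ ps∣D x = split ((x ^ D) ≟ 1#)
      where
      instance
        p≢0 : NonZero p
        p≢0 = prime⇒nonZero pr
      head≡D : (p * D) ÷ p ≡ D
      head≡D = n*m÷n≡m D p
      down : x ^ D ≡ 1# → Free (p * D) ps x → Free D ps x
      down xD (_ , h) = xD , All.tabulate λ {q} q∈ eq →
        All.lookup h q∈ (subst (λ m → x ^ m ≡ 1#)
          (sym (÷-chain p {{prime⇒nonZero (All.lookup prs q∈)}} (All.lookup ps∣D q∈))) (^-multiple≡1 p eq))
      up : Free D ps x → Free (p * D) ps x
      up (xD , h) = ^-multiple≡1 p xD , All.tabulate λ {q} q∈ eq → All.lookup h q∈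
        (no-new {q} (All.lookup prs q∈) (All.lookup p∉ q∈) (All.lookup ps∣D q∈) eq)
        where
        -- The element x^(D/q) is killed by both p and q, which are coprime, so it is 1.
        no-new : ∀ {q} → Prime q → p ≢ q → q ∣ D → x ^ ((p * D) ÷ q) ≡ 1# → x ^ (D ÷ q) ≡ 1#
        no-new {q} qr p≢q q∣D eq = trans (sym (⊗-identityʳ (x ^ (D ÷ q))))
          (^-bézout≡1 {x ^ (D ÷ q)} {p} {q} (coprime-Bézout (distinct-primes-coprime pr qr p≢q))
          (trans (^-assocʳ x (D ÷ q) p) (trans (cong (x ^_) (trans (*-comm (D ÷ q) p) (sym (÷-chain p {{prime⇒nonZero qr}} q∣D)))) eq))
          (trans (^-assocʳ x (D ÷ q) q) (trans (cong (x ^_) (m÷n*n≡m {{prime⇒nonZero qr}} q∣D)) xD)))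
      split : Dec (x ^ D ≡ 1#) →
              𝟙 (free? (p * D) (p ∷ ps) x) ≡ 𝟙 (free? (p * D) ps x) ℤ.- 𝟙 (free? D ps x)
      split (yes xD) = begin
        𝟙 (free? (p * D) (p ∷ ps) x)
          ≡⟨ 𝟙-no (free? (p * D) (p ∷ ps) x) (λ { (_ , h ∷ _) → h (trans (cong (x ^_) head≡D) xD) }) ⟩
        0ℤ ≡⟨ ℤ.i≡j⇒i-j≡0 (𝟙-cong (free? (p * D) ps x) (free? D ps x) (down xD) up) ⟨
        𝟙 (free? (p * D) ps x) ℤ.- 𝟙 (free? D ps x) ∎
        where open ≡-Reasoning
      split (no ¬xD) = begin
        𝟙 (free? (p * D) (p ∷ ps) x)
          ≡⟨ 𝟙-cong (free? (p * D) (p ∷ ps) x) (free? (p * D) ps x)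
               (λ { (e , _ ∷ h) → e , h }) (λ { (e , h) → e , (λ eq → ¬xD (trans (cong (x ^_) (sym head≡D)) eq)) ∷ h }) ⟩
        𝟙 (free? (p * D) ps x) ≡⟨ ℤ.+-identityʳ _ ⟨
        𝟙 (free? (p * D) ps x) ℤ.- 0ℤ ≡⟨ cong (λ z → 𝟙 (free? (p * D) ps x) ℤ.- z) (𝟙-no (free? D ps x) (λ { (e , _) → ¬xD e })) ⟨
        𝟙 (free? (p * D) ps x) ℤ.- 𝟙 (free? D ps x) ∎
        where open ≡-Reasoning

    -- For distinct primes this is Euler's totient of `product ps`.
    φ : List ℕ → ℕ
    φ []       = 1
    φ (p ∷ ps) = pred p * φ ps

    product≤2^φ : ∀ {ps} → All Prime ps → product ps ≤ 2 ℕ.^ length ps * φ ps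
    product≤2^φ [] = s≤s z≤n
    product≤2^φ {p ∷ ps} (pr ∷ prs) = begin
      p * product ps ≤⟨ *-mono-≤ (p≤2pred {{prime⇒nonTrivial pr}}) (product≤2^φ prs) ⟩
      2 * pred p * (2 ℕ.^ length ps * φ ps) ≡⟨ lem (pred p) (2 ℕ.^ length ps) (φ ps) ⟩
      2 * 2 ℕ.^ length ps * (pred p * φ ps) ∎
      where
      open ≤-Reasoning
      lem : ∀ a b c → 2 * a * (b * c) ≡ 2 * b * (a * c)
      lem = solve-∀
      p≤2pred : ∀ {p} .{{_ : NonTrivial p}} → p ≤ 2 * pred p
      p≤2pred {suc (suc m)} = s≤s (≤-trans (m≤n+m (suc m) m) (≤-reflexive (cong (_+_ m) (sym (+-identityʳ (suc m))))))

    module _ (X : List F) (Λ : ℕ)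
             (equidistributed : ∀ D d .{{_ : NonZero d}} → D * d ≡ length units →
               Λ * ∣ + d ℤ.* ∑ X (λ x → 𝟙 ((x ^ D) ≟ 1#)) ℤ.- + length X ∣ ≤ d * length X) where

      private
        n s : ℕ
        n = length units
        s = length X

        count : ℕ → List ℕ → ℤ
        count D ps = ∑ X (λ x → 𝟙 (free? D ps x))

        -- The full group contains E φ(ps) elements that are free relative to E · `product ps`, so E
        -- φ(ps) s is n times the expected count in X. Multiplying by n avoids fractions.
        error : ℕ → List ℕ → ℤ
        error E ps = + n ℤ.* count (E * product ps) ps ℤ.- + (E * φ ps) ℤ.* + s

      private
        count-split : ∀ E {p ps} → All (p ≢_) ps → Prime p → All Prime ps →
          count (E * (p * product ps)) (p ∷ ps) ≡ count (E * p * product ps) ps ℤ.- count (E * product ps) ps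
        count-split E {p} {ps} p∉ pr prs = begin
          count (E * (p * product ps)) (p ∷ ps) ≡⟨ cong (λ m → count m (p ∷ ps)) (reorder E p (product ps)) ⟩
          count (p * D) (p ∷ ps) ≡⟨ ∑-cong X (free-split pr prs p∉ ps∣D) ⟩
          ∑ X (λ x → 𝟙 (free? (p * D) ps x) ℤ.- 𝟙 (free? D ps x))
            ≡⟨ ∑-+ X (λ x → 𝟙 (free? (p * D) ps x)) (λ x → ℤ.- 𝟙 (free? D ps x)) ⟩
          count (p * D) ps ℤ.+ ∑ X (λ x → ℤ.- 𝟙 (free? D ps x))
            ≡⟨ cong₂ ℤ._+_ (cong (λ m → count m ps) (sym (reorder₁ E p (product ps)))) ∑-neg ⟩
          count (E * p * product ps) ps ℤ.- count D ps ∎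
          where
          open ≡-Reasoning
          D : ℕ
          D = E * product ps
          ps∣D : All (_∣ D) ps
          ps∣D = All.tabulate λ q∈ → ∣-trans (∈⇒∣product q∈) (n∣m*n E)
          reorder : ∀ E p P → E * (p * P) ≡ p * (E * P)
          reorder = solve-∀
          reorder₁ : ∀ E p P → E * p * P ≡ p * (E * P)
          reorder₁ = solve-∀
          ∑-neg : ∑ X (λ x → ℤ.- 𝟙 (free? D ps x)) ≡ ℤ.- count D ps
          ∑-neg = trans (∑-cong X (λ x → sym (ℤ.-1*i≡-i (𝟙 (free? D ps x)))))
            (trans (∑-*ˡ X ℤ.-1ℤ (λ x → 𝟙 (free? D ps x))) (ℤ.-1*i≡-i (count D ps)))

        weight-split : ∀ E f {p} .{{_ : NonZero p}} → + (E * (pred p * f)) ≡ + (E * p * f) ℤ.- + (E * f)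
        weight-split E f {p} = begin
          + (E * (pred p * f)) ≡⟨ cancel (+ (E * (pred p * f))) (+ (E * f)) ⟩
          + (E * (pred p * f) + E * f) ℤ.- + (E * f)
            ≡⟨ cong (λ m → + m ℤ.- + (E * f)) (trans (lem E (pred p) f) (cong (λ m → E * m * f) (suc-pred p))) ⟩
          + (E * p * f) ℤ.- + (E * f) ∎
          where
          open ≡-Reasoning
          cancel : ∀ a b → a ≡ a ℤ.+ b ℤ.- b
          cancel = ℤ-Solver.solve-∀
          lem : ∀ E m f → E * (m * f) + E * f ≡ E * suc m * f
          lem = solve-∀

      -- Removing one prime writes the error as a difference of two errors for the shorter list, so
      -- 2^|ps| leaves arise. The prime moves either into E or into d, which preserves E ·
      -- `product ps` · d = n, and each leaf costs D d s = n s by equidistribution.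
      sieve : ∀ {ps} E d .{{_ : NonZero d}} → Unique ps → All Prime ps → E * product ps * d ≡ n →
              Λ * ∣ error E ps ∣ ≤ 2 ℕ.^ length ps * (n * s)
      sieve {[]} E d _ _ eq = begin
        Λ * ∣ error E [] ∣ ≡⟨ cong (λ z → Λ * ∣ z ∣) factor ⟩
        Λ * ∣ + D ℤ.* (+ d ℤ.* Z ℤ.- + s) ∣ ≡⟨ cong (Λ *_) (ℤ.abs-* (+ D) (+ d ℤ.* Z ℤ.- + s)) ⟩
        Λ * (D * ∣ + d ℤ.* Z ℤ.- + s ∣) ≡⟨ lem₁ Λ D ∣ + d ℤ.* Z ℤ.- + s ∣ ⟩
        D * (Λ * ∣ + d ℤ.* Z ℤ.- + s ∣) ≤⟨ *-monoʳ-≤ D (equidistributed D d eq) ⟩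
        D * (d * s) ≡⟨ *-assoc D d s ⟨
        D * d * s ≡⟨ cong (_* s) eq ⟩
        n * s ≡⟨ *-identityˡ (n * s) ⟨
        1 * (n * s) ∎
        where
        open ≤-Reasoning
        D : ℕ
        D = E * 1
        Z : ℤ
        Z = ∑ X (λ x → 𝟙 ((x ^ D) ≟ 1#))
        lem₁ : ∀ a b c → a * (b * c) ≡ b * (a * c)
        lem₁ = solve-∀
        lem₂ : ∀ D d Z s → D ℤ.* d ℤ.* Z ℤ.- D ℤ.* s ≡ D ℤ.* (d ℤ.* Z ℤ.- s)
        lem₂ = ℤ-Solver.solve-∀
        count≡Z : count D [] ≡ Z
        count≡Z = ∑-cong X λ x → 𝟙-cong (free? D [] x) ((x ^ D) ≟ 1#) proj₁ (_, [])
        factor : error E [] ≡ + D ℤ.* (+ d ℤ.* Z ℤ.- + s)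
        factor = trans (cong₂ (λ m z → m ℤ.* z ℤ.- + D ℤ.* + s) (trans (cong +_ (sym eq)) (ℤ.pos-* D d)) count≡Z)
          (lem₂ (+ D) (+ d) Z (+ s))
      sieve {p ∷ ps} E d (p∉ ∷ u) (pr ∷ prs) eq = begin
        Λ * ∣ error E (p ∷ ps) ∣ ≡⟨ cong (λ z → Λ * ∣ z ∣) decompose ⟩
        Λ * ∣ error (E * p) ps ℤ.- error E ps ∣ ≤⟨ *-monoʳ-≤ Λ (ℤ.∣i-j∣≤∣i∣+∣j∣ (error (E * p) ps) (error E ps)) ⟩
        Λ * (∣ error (E * p) ps ∣ + ∣ error E ps ∣) ≡⟨ *-distribˡ-+ Λ ∣ error (E * p) ps ∣ ∣ error E ps ∣ ⟩
        Λ * ∣ error (E * p) ps ∣ + Λ * ∣ error E ps ∣ ≤⟨ +-mono-≤ (sieve (E * p) d u prs eq₁) (sieve E (p * d) {{m*n≢0 p d}} u prs eq₂) ⟩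
        2 ℕ.^ length ps * (n * s) + 2 ℕ.^ length ps * (n * s) ≡⟨ lem (2 ℕ.^ length ps) (n * s) ⟩
        2 * 2 ℕ.^ length ps * (n * s) ∎
        where
        open ≤-Reasoning
        instance
          p≢0 : NonZero p
          p≢0 = prime⇒nonZero pr
        D : ℕ
        D = E * product ps
        lem : ∀ a b → a * b + a * b ≡ 2 * a * b
        lem = solve-∀
        reorder₂ : ∀ E P p d → E * P * (p * d) ≡ E * (p * P) * d
        reorder₂ = solve-∀
        eq₁ : E * p * product ps * d ≡ n
        eq₁ = trans (cong (_* d) (*-assoc E p (product ps))) eq
        eq₂ : E * product ps * (p * d) ≡ n
        eq₂ = trans (reorder₂ E (product ps) p d) eq
        decompose : error E (p ∷ ps) ≡ error (E * p) ps ℤ.- error E ps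
        decompose = trans (cong₂ (λ c w → + n ℤ.* c ℤ.- w ℤ.* + s) (count-split E p∉ pr prs) (weight-split E (φ ps)))
          (lem₁ (+ n) (count (E * p * product ps) ps) (count D ps) (+ (E * p * φ ps)) (+ (E * φ ps)) (+ s))
          where
          lem₁ : ∀ n c c′ w w′ s → n ℤ.* (c ℤ.- c′) ℤ.- (w ℤ.- w′) ℤ.* s ≡ n ℤ.* c ℤ.- w ℤ.* s ℤ.- (n ℤ.* c′ ℤ.- w′ ℤ.* s)
          lem₁ = ℤ-Solver.solve-∀

      -- If no free element existed, the error would be the whole expected term E φ(ps) s. One
      -- factor 2^ω counts the leaves of the sieve, the other bounds n against E φ(ps); together
      -- they contradict 4^ω < Λ.
      sieve-exists : ∀ {ps} E → Unique ps → All Prime ps → E * product ps ≡ n → NonZero n → NonZero s →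
                     2 ℕ.^ length ps * 2 ℕ.^ length ps < Λ → ∃ λ x → x ∈ X × Free n ps x
      sieve-exists {ps} E u prs eq n≢0 s≢0 lt with any? (free? n ps) X
      ... | yes a = find a
      ... | no ¬a = ⊥-elim (<⇒≱ lt (*-cancelʳ-≤ Λ (2ω * 2ω) W {{W≢0}} (begin
        Λ * W ≡⟨ cong (Λ *_) ∣error∣ ⟨
        Λ * ∣ error E ps ∣ ≤⟨ sieve E 1 u prs (trans (*-identityʳ _) eq) ⟩
        2ω * (n * s) ≡⟨ cong (λ m → 2ω * (m * s)) eq ⟨
        2ω * (E * product ps * s) ≤⟨ *-monoʳ-≤ 2ω (*-monoˡ-≤ s (*-monoʳ-≤ E (product≤2^φ prs))) ⟩
        2ω * (E * (2ω * φ ps) * s) ≡⟨ lem 2ω E (φ ps) s ⟩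
        2ω * 2ω * W ∎)))
        where
        open ≤-Reasoning
        2ω W : ℕ
        2ω = 2 ℕ.^ length ps
        W = E * φ ps * s
        lem : ∀ a E f s → a * (E * (a * f) * s) ≡ a * a * (E * f * s)
        lem = solve-∀
        count≡0 : count (E * product ps) ps ≡ 0ℤ
        count≡0 = trans (∑-cong-∈ (λ {x} x∈ → 𝟙-no (free? (E * product ps) ps x)
          (λ f → ¬a (lose x∈ (subst (λ m → Free m ps x) eq f))))) (∑-0 X)
        ∣error∣ : ∣ error E ps ∣ ≡ W
        ∣error∣ = trans (cong ∣_∣ (trans (cong (λ c → + n ℤ.* c ℤ.- + (E * φ ps) ℤ.* + s) count≡0)
            (trans (cong (λ z → z ℤ.- + (E * φ ps) ℤ.* + s) (ℤ.*-zeroʳ (+ n))) (ℤ.+-identityˡ (ℤ.- (+ (E * φ ps) ℤ.* + s))))))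
          (trans (ℤ.∣-i∣≡∣i∣ (+ (E * φ ps) ℤ.* + s)) (ℤ.abs-* (+ (E * φ ps)) (+ s)))
        W≢0 : NonZero W
        W≢0 = m*n≢0 (E * φ ps) s {{m*n≢0 E (φ ps) {{m*n≢0⇒m≢0 E {{subst NonZero (sym eq) n≢0}}}} {{φ≢0 prs}}}} {{s≢0}}
          where
          φ≢0 : ∀ {ps} → All Prime ps → NonZero (φ ps)
          φ≢0 [] = _
          φ≢0 {p ∷ ps} (pr ∷ prs) = m*n≢0 (pred p) (φ ps) {{>-nonZero (≤-pred (≤-trans (nonTrivial⇒n>1 p {{prime⇒nonTrivial pr}}) (≤-reflexive (sym (suc-pred p {{prime⇒nonZero pr}})))))}} {{φ≢0 prs}}

    -- If x^k = 1 with 0 < k < n, Bézout gives x^g = 1 for g = gcd(k, n). A prime p dividing n/g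
    -- then gives x^(n/p) = 1, which freeness forbids. Hence the powers below n are distinct and
    -- exhaust the units.
    free⇒generator : ∀ {x} → Free (length units) (primeDivisors (length units)) x → x ≢ 0# →
                     ∀ y → y ≢ 0# → ∃ λ k → x ^ k ≡ y
    free⇒generator {x} (_ , h) x≢0 y y≢0 with ∈-map⁻ (x ^_) (∈-resp-↭ powers (∈units y≢0))
      where
      n : ℕ
      n = length units
      instance
        n≢0 : NonZero n
        n≢0 = >-nonZero (nonempty (∈units x≢0))
          where
          nonempty : ∀ {xs : List F} → x ∈ xs → 0 < length xs
          nonempty (here _)  = s≤s z≤n
          nonempty (there _) = s≤s z≤n
      no-small-order : ∀ {k} .{{_ : NonZero k}} → k < n → x ^ k ≢ 1#
      no-small-order {k} k<n eq with gcd[m,n]∣n k n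
      ... | divides e n≡e*g with e ≤? 1
      ...   | yes e≤1 = <⇒≱ k<n (begin
        n ≡⟨ n≡e*g ⟩
        e * gcd k n ≤⟨ *-monoˡ-≤ (gcd k n) e≤1 ⟩
        1 * gcd k n ≡⟨ *-identityˡ _ ⟩
        gcd k n ≤⟨ ∣⇒≤ (gcd[m,n]∣m k n) ⟩
        k ∎)
        where open ≤-Reasoning
      ...   | no e≰1 with prime-divisor (≰⇒> e≰1)
      ...     | p , pr , divides f e≡f*p = All.lookup h (∈primeDivisors⁺ n pr (divides (f * gcd k n) n≡′))
          (trans (cong (λ m → x ^ (m ÷ p)) (trans n≡′ (*-comm (f * gcd k n) p)))
            (trans (cong (x ^_) (n*m÷n≡m (f * gcd k n) p {{prime⇒nonZero pr}}))
              (^-multiple≡1 f (^-bézout≡1 {x} {k} {n} (Bézout.identity (gcd-GCD k n)) eq (lagrange x≢0)))))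
        where
        lem : ∀ f p g → f * p * g ≡ f * g * p
        lem = solve-∀
        n≡′ : n ≡ f * gcd k n * p
        n≡′ = trans n≡e*g (trans (cong (_* gcd k n) e≡f*p) (lem f p (gcd k n)))
      distinct : ∀ {i j} → i < j → j < n → x ^ i ≢ x ^ j
      distinct {i} {j} i<j j<n eq = no-small-order {j ∸ i} {{>-nonZero (m<n⇒0<n∸m i<j)}}
        (≤-<-trans (m∸n≤m j i) j<n)
        (*-cancelˡ (^-≢0 i x≢0) (trans (sym (^-homo-* x i (j ∸ i)))
          (trans (cong (x ^_) (m+[n∸m]≡n (<⇒≤ i<j))) (trans (sym eq) (sym (⊗-identityʳ _))))))
      powers-unique : Unique (map (x ^_) (upTo n))
      powers-unique = unique-map-∈ inj (Unique.upTo⁺ n)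
        where
        inj : ∀ {i j} → i ∈ upTo n → j ∈ upTo n → x ^ i ≡ x ^ j → i ≡ j
        inj {i} {j} i∈ j∈ eq with <-cmp i j
        ... | tri< i<j _ _ = ⊥-elim (distinct i<j (∈-upTo⁻ j∈) eq)
        ... | tri≈ _ i≡j _ = i≡j
        ... | tri> _ _ j<i = ⊥-elim (distinct j<i (∈-upTo⁻ i∈) (sym eq))
      powers = unique-⊆-length⇒↭ powers-unique (λ z∈ → power∈units z∈)
        (trans (length-map (x ^_) (upTo n)) (length-upTo n))
        where
        power∈units : ∀ {z} → z ∈ map (x ^_) (upTo n) → z ∈ units
        power∈units z∈ with ∈-map⁻ (x ^_) z∈
        ... | k , _ , refl = ∈units (^-≢0 k x≢0)
    ... | k , _ , y≡x^k = k , sym y≡x^k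

-- A generator in a sumset

module Core where

  open import Data.Integer using (+_; ∣_∣)
  import Data.Integer as ℤ
  import Data.Integer.Properties as ℤ
  open import Data.Nat hiding (_≟_; _^_)
  import Data.Nat as ℕ
  open import Data.Nat.Divisibility using (divides)
  open import Data.Nat.ListAction using (product)
  open import Data.Nat.Primality using (Prime)
  open import Data.Nat.Properties hiding (_≟_)
  open import Relation.Binary.PropositionalEquality hiding ([_])

  open IntSum
  open Field using (FinField; module FieldTheory)
  open LinDep using (1<|F|)
  open Primes
  open Discrepancy
  open Sieve using (module MultiplicativeSieve)

  module _ (𝔽 : FinField) where
    open FieldTheory 𝔽
      using (F; 0#; 1#; _≟_; els; units; length-units; Additive; _^_)
      renaming (_+_ to _⊕_)
    open MultiplicativeSieve 𝔽

    private
      n ω : ℕ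
      n = length units
      ω = length (primeDivisors n)

    generator-in-sumset : ∀ {U V : List F} → Unique U → Unique V → (∀ {u v} → u ∈ U → v ∈ V → u ⊕ v ≢ 0#) →
      .{{_ : NonZero (length U)}} .{{_ : NonZero (length V)}} →
      ∀ {M M′} .{{_ : NonZero M}} → M * M′ ≡ length els → Additive M → length V ≤ M → M ≤ M′ →
      ∀ {Λ} → 2 ℕ.^ ω * 2 ℕ.^ ω < Λ →
      Λ * Λ * (Λ * Λ) * (10 * M′ * (length V * length V) + 3 * length els) ≤ length U * (length V * length V) →
      ∃₂ λ u v → u ∈ U × v ∈ V × (∀ y → y ≢ 0# → ∃ λ k → (u ⊕ v) ^ k ≡ y)
    generator-in-sumset {U} {V} uU uV nz {M} {M′} MM′≡Q add V≤M M≤M′ {Λ} 4^ω<Λ large = conclude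
      (product∣ (primeDivisors-unique n) primes (All.tabulate (λ p∈ → proj₂ (∈primeDivisors⁻ n p∈))))
      where
      primes : All Prime (primeDivisors n)
      primes = All.tabulate (λ p∈ → proj₁ (∈primeDivisors⁻ n p∈))
      sum : F × F → F
      sum (u , v) = u ⊕ v
      -- As a list X carries each pair (u, v) once, so |X| = |U||V| and sums over X are double sums.
      X : List F
      X = map sum (cartesianProduct U V)
      ∑X : ∀ f → ∑ X f ≡ ∑ U (λ u → ∑ V (λ v → f (u ⊕ v)))
      ∑X f = trans (∑-map sum (cartesianProduct U V) f) (∑-× U V (λ p → f (sum p)))
      |X| : length X ≡ length U * length V
      |X| = ℤ.+-injective (begin
        + length X ≡⟨ trans (∑-const X (+ 1)) (ℤ.*-identityʳ (+ length X)) ⟨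
        ∑ X (λ _ → + 1) ≡⟨ ∑X (λ _ → + 1) ⟩
        ∑ U (λ _ → ∑ V (λ _ → + 1)) ≡⟨ ∑-const U _ ⟩
        + length U ℤ.* ∑ V (λ _ → + 1) ≡⟨ cong (+ length U ℤ.*_) (trans (∑-const V (+ 1)) (ℤ.*-identityʳ (+ length V))) ⟩
        + length U ℤ.* + length V ≡⟨ ℤ.pos-* (length U) (length V) ⟨
        + (length U * length V) ∎)
        where open ≡-Reasoning
      equidistributed : ∀ D d .{{_ : NonZero d}} → D * d ≡ n →
        Λ * ∣ + d ℤ.* ∑ X (λ x → 𝟙 ((x ^ D) ≟ 1#)) ℤ.- + length X ∣ ≤ d * length X
      equidistributed D d eq = subst₂ _≤_
        (cong₂ (λ s m → Λ * ∣ + d ℤ.* s ℤ.- m ∣) (sym (∑X (λ x → 𝟙 ((x ^ D) ≟ 1#)))) (sym (trans (cong +_ |X|) (ℤ.pos-* (length U) (length V)))))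
        (cong (d *_) (sym |X|))
        (discrepancy 𝔽 uU uV nz MM′≡Q add V≤M M≤M′ {Λ} large D d eq)
      n≢0 : NonZero n
      n≢0 = >-nonZero (≤-pred (≤-trans (1<|F| 𝔽) (≤-reflexive (sym length-units))))
      X≢0 : NonZero (length X)
      X≢0 = subst NonZero (sym |X|) (m*n≢0 (length U) (length V))
      conclude : product (primeDivisors n) Data.Nat.Divisibility.∣ n →
                 ∃₂ λ u v → u ∈ U × v ∈ V × (∀ y → y ≢ 0# → ∃ λ k → (u ⊕ v) ^ k ≡ y)
      conclude (divides E n≡) with sieve-exists X Λ equidistributed E (primeDivisors-unique n) primes (sym n≡) n≢0 X≢0 4^ω<Λ
      ... | x , x∈ , free with ∈-map⁻ sum x∈
      ...   | (u , v) , uv∈ , refl with ∈-cartesianProduct⁻ U V uv∈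
      ...     | u∈ , v∈ = u , v , u∈ , v∈ , free⇒generator free (nz u∈ v∈)

-- Numerical estimates

module Numeric where

  open import Data.Nat
  open import Data.Nat.ListAction using (product)
  open import Data.Nat.Properties
  open import Data.Nat.Tactic.RingSolver using (solve-∀)
  open import Relation.Binary.PropositionalEquality hiding ([_])

  open Primes

  ^-cancel-≤ : ∀ b .{{_ : NonTrivial b}} {m n} → b ^ m ≤ b ^ n → m ≤ n
  ^-cancel-≤ b le = ≮⇒≥ (λ n<m → <⇒≱ (^-monoʳ-< b (nonTrivial⇒n>1 b) n<m) le)

  ^-distribʳ-* : ∀ m n o → (n * o) ^ m ≡ n ^ m * o ^ m
  ^-distribʳ-* zero    n o = refl
  ^-distribʳ-* (suc m) n o = trans (cong (n * o *_) (^-distribʳ-* m n o)) (lem n o (n ^ m) (o ^ m))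
    where
    lem : ∀ a b c d → a * b * (c * d) ≡ a * c * (b * d)
    lem = solve-∀

  module _ (B s : ℕ) (B≡ : B ≡ 2 ^ 864) (s-large : 96 * B + 156 + 1 ≤ s) where

    -- At most B primes are below B, and k primes above B have product at least B^k = 2^(864k); the exponent 864
    -- makes 96k ≤ s + 1.
    few-primes : ∀ {ps} → Unique ps → All NonZero ps → product ps ≤ 2 ^ (9 * s + 6) → 6 * (8 * length ps + 13) ≤ s
    few-primes {ps} u ps≢0 le = *-cancelˡ-≤ 2 (+-cancelʳ-≤ s _ _ (begin
      2 * (6 * (8 * length ps + 13)) + s ≡⟨ lem₁ (length ps) s ⟩
      96 * length ps + 156 + s ≤⟨ +-monoˡ-≤ s (+-monoˡ-≤ 156 (*-monoʳ-≤ 96 (length≤B+large B u))) ⟩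
      96 * (B + k) + 156 + s ≡⟨ lem₂ B k s ⟩
      96 * k + (96 * B + 156 + s) ≤⟨ +-monoˡ-≤ (96 * B + 156 + s) 96k≤ ⟩
      s + 1 + (96 * B + 156 + s) ≡⟨ lem₃ B s ⟩
      96 * B + 156 + 1 + (s + s) ≤⟨ +-monoˡ-≤ (s + s) s-large ⟩
      s + (s + s) ≡⟨ lem₄ s ⟩
      2 * s + s ∎))
      where
      open ≤-Reasoning
      k : ℕ
      k = length (filter (B ≤?_) ps)
      lem₁ : ∀ l s → 2 * (6 * (8 * l + 13)) + s ≡ 96 * l + 156 + s
      lem₁ = solve-∀
      lem₂ : ∀ B k s → 96 * (B + k) + 156 + s ≡ 96 * k + (96 * B + 156 + s)
      lem₂ = solve-∀
      lem₃ : ∀ B s → s + 1 + (96 * B + 156 + s) ≡ 96 * B + 156 + 1 + (s + s)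
      lem₃ = solve-∀
      lem₄ : ∀ s → s + (s + s) ≡ 2 * s + s
      lem₄ = solve-∀
      864k≤ : 864 * k ≤ 9 * s + 6
      864k≤ = ^-cancel-≤ 2 (begin
        2 ^ (864 * k) ≡⟨ ^-*-assoc 2 864 k ⟨
        (2 ^ 864) ^ k ≡⟨ cong (_^ k) B≡ ⟨
        B ^ k ≤⟨ B^large≤product B ps≢0 ⟩
        product ps ≤⟨ le ⟩
        2 ^ (9 * s + 6) ∎)
      96k≤ : 96 * k ≤ s + 1
      96k≤ = *-cancelˡ-≤ 9 (begin
        9 * (96 * k) ≡⟨ *-assoc 9 96 k ⟨
        864 * k ≤⟨ 864k≤ ⟩
        9 * s + 6 ≤⟨ +-monoʳ-≤ (9 * s) (m≤m+n 6 3) ⟩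
        9 * s + 9 ≡⟨ *-distribˡ-+ 9 s 1 ⟨
        9 * (s + 1) ∎)

  -- 2·8⁶ ≤ 9⁶.
  2^t*8^s≤9^s : ∀ t {s} → 6 * t ≤ s → 2 ^ t * 8 ^ s ≤ 9 ^ s
  2^t*8^s≤9^s t {s} 6t≤s = begin
    2 ^ t * 8 ^ s ≡⟨ cong (λ m → 2 ^ t * 8 ^ m) (m+[n∸m]≡n 6t≤s) ⟨
    2 ^ t * 8 ^ (6 * t + (s ∸ 6 * t)) ≡⟨ cong (2 ^ t *_) (^-distribˡ-+-* 8 (6 * t) (s ∸ 6 * t)) ⟩
    2 ^ t * (8 ^ (6 * t) * 8 ^ (s ∸ 6 * t)) ≡⟨ *-assoc (2 ^ t) (8 ^ (6 * t)) (8 ^ (s ∸ 6 * t)) ⟨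
    2 ^ t * 8 ^ (6 * t) * 8 ^ (s ∸ 6 * t)
      ≤⟨ *-mono-≤ six (^-monoˡ-≤ (s ∸ 6 * t) (m≤m+n 8 1)) ⟩
    9 ^ (6 * t) * 9 ^ (s ∸ 6 * t) ≡⟨ ^-distribˡ-+-* 9 (6 * t) (s ∸ 6 * t) ⟨
    9 ^ (6 * t + (s ∸ 6 * t)) ≡⟨ cong (9 ^_) (m+[n∸m]≡n 6t≤s) ⟩
    9 ^ s ∎
    where
    open ≤-Reasoning
    six : 2 ^ t * 8 ^ (6 * t) ≤ 9 ^ (6 * t)
    six = begin
      2 ^ t * 8 ^ (6 * t) ≡⟨ cong (2 ^ t *_) (^-*-assoc 8 6 t) ⟨
      2 ^ t * (8 ^ 6) ^ t ≡⟨ ^-distribʳ-* t 2 (8 ^ 6) ⟨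
      (2 * 8 ^ 6) ^ t ≤⟨ ^-monoˡ-≤ t (≤ᵇ⇒≤ (2 * 8 ^ 6) (9 ^ 6) _) ⟩
      (9 ^ 6) ^ t ≡⟨ ^-*-assoc 9 6 t ⟩
      9 ^ (6 * t) ∎

  -- Transfers one estimate for (9/8)^s to every ratio b/a ≥ 9/8. The pairs that occur are 8 and 9,
  -- 64 and 81, 12 and 16, 125 and 256.
  rescale : ∀ {c s a b} → c * 8 ^ s ≤ 9 ^ s → 9 * a ≤ 8 * b → c * a ^ s ≤ b ^ s
  rescale {c} {s} {a} {b} le ab = *-cancelˡ-≤ (8 ^ s) {{m^n≢0 8 s}} (begin
    8 ^ s * (c * a ^ s) ≡⟨ lem (8 ^ s) c (a ^ s) ⟩
    c * 8 ^ s * a ^ s ≤⟨ *-monoˡ-≤ (a ^ s) le ⟩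
    9 ^ s * a ^ s ≡⟨ ^-distribʳ-* s 9 a ⟨
    (9 * a) ^ s ≤⟨ ^-monoˡ-≤ s ab ⟩
    (8 * b) ^ s ≡⟨ ^-distribʳ-* s 8 b ⟩
    8 ^ s * b ^ s ∎)
    where
    open ≤-Reasoning
    lem : ∀ e c a → e * (c * a) ≡ c * e * a
    lem = solve-∀

  -- Half of the right-hand side is given to each term on the left. Hence 640 = 16 · 10 · 2 · 2 and
  -- 192 = 16 · 3 · 2 · 2, with one factor 2 for halving and one for g² ≤ 2u.
  combine-bounds : ∀ {X M′ Q u l g} → 640 * X * M′ ≤ g * g → 192 * X * Q ≤ g * g * (g * g) →
                   g * g ≤ 2 * u → g ≤ l → 16 * X * (10 * M′ * (l * l) + 3 * Q) ≤ u * (l * l)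
  combine-bounds {X} {M′} {Q} {u} {l} {g} h₁ h₂ h₃ h₄ = *-cancelˡ-≤ 2 (begin
    2 * (16 * X * (10 * M′ * (l * l) + 3 * Q)) ≡⟨ lem₁ X M′ Q l ⟩
    320 * X * M′ * (l * l) + 96 * X * Q ≤⟨ +-mono-≤ first second ⟩
    u * (l * l) + u * (l * l) ≡⟨ lem₂ (u * (l * l)) ⟩
    2 * (u * (l * l)) ∎)
    where
    open ≤-Reasoning
    lem₁ : ∀ X M′ Q l → 2 * (16 * X * (10 * M′ * (l * l) + 3 * Q)) ≡ 320 * X * M′ * (l * l) + 96 * X * Q
    lem₁ = solve-∀
    lem₂ : ∀ a → a + a ≡ 2 * a
    lem₂ = solve-∀
    lem₃ : ∀ X M′ → 2 * (320 * X * M′) ≡ 640 * X * M′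
    lem₃ = solve-∀
    lem₄ : ∀ X Q → 2 * (96 * X * Q) ≡ 192 * X * Q
    lem₄ = solve-∀
    first : 320 * X * M′ * (l * l) ≤ u * (l * l)
    first = *-monoˡ-≤ (l * l) (*-cancelˡ-≤ {320 * X * M′} {u} 2 (≤-trans (≤-reflexive (lem₃ X M′)) (≤-trans h₁ h₃)))
    second : 96 * X * Q ≤ u * (l * l)
    second = *-cancelˡ-≤ 2 (begin
      2 * (96 * X * Q) ≡⟨ lem₄ X Q ⟩
      192 * X * Q ≤⟨ h₂ ⟩
      g * g * (g * g) ≤⟨ *-mono-≤ h₃ (*-mono-≤ h₄ h₄) ⟩
      2 * u * (l * l) ≡⟨ *-assoc 2 u (l * l) ⟩
      2 * (u * (l * l)) ∎)

-- Dual coordinates and boxes that avoid the hyperplanes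

module Hyperplanes where

  open import Data.Nat hiding (_≟_; _^_)
  import Data.Nat as ℕ
  open import Data.Nat.Properties hiding (_≟_)
  open import Data.Vec using (Vec; []; _∷_; lookup; replicate; tabulate)
  open import Data.Vec.Properties using (lookup-replicate; lookup∘tabulate)
  open import Relation.Binary.PropositionalEquality hiding ([_])

  open Lists
  open Choices
  open Field using (FinField; module FieldTheory)

  module _ (𝔽 : FinField) where
    open FieldTheory 𝔽
      using (F; 0#; 1#; _≟_; els; els-unique; els-complete; _^_; 0^; fixed≤; +-cancelˡ)
      renaming (_+_ to _⊕_; +-identityˡ to ⊕-identityˡ; +-identityʳ to ⊕-identityʳ)

    module Coordinates (g r : ℕ) .{{_ : NonZero g}} .{{_ : NonZero r}} (|F|≡q^r : length els ≡ suc g ℕ.^ r)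
             (L : Fin r → F → F)
             (L-add : ∀ i x y → L i (x ⊕ y) ≡ L i x ⊕ L i y)
             (L-fixed : ∀ i x → L i x ^ suc g ≡ L i x)
             (L-injective : ∀ {x y} → (∀ i → L i x ≡ L i y) → x ≡ y) where

      private
        q : ℕ
        q = suc g

      fixed? : ∀ x → Dec (x ^ q ≡ x)
      fixed? x = (x ^ q) ≟ x

      fq : List F
      fq = filter fixed? els

      fq-unique : Unique fq
      fq-unique = Unique.filter⁺ fixed? els-unique

      0∈fq : 0# ∈ fq
      0∈fq = ∈-filter⁺ fixed? (els-complete 0#) (0^ q)

      |fq|≤q : length fq ≤ q
      |fq|≤q = fixed≤ g fq-unique (λ x∈ → proj₂ (∈-filter⁻ fixed? {xs = els} x∈))

      coords : F → Vec F r
      coords x = tabulate (λ i → L i x)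

      coords-injective : ∀ {x y} → coords x ≡ coords y → x ≡ y
      coords-injective {x} {y} eq = L-injective λ i → begin
        L i x ≡⟨ lookup∘tabulate (λ i → L i x) i ⟨
        lookup (coords x) i ≡⟨ cong (λ v → lookup v i) eq ⟩
        lookup (coords y) i ≡⟨ lookup∘tabulate (λ i → L i y) i ⟩
        L i y ∎
        where open ≡-Reasoning

      private
        grid : List (Vec F r)
        grid = choices (replicate r fq)

        coords∈grid : ∀ {v} → v ∈ map coords els → v ∈ grid
        coords∈grid v∈ with ∈-map⁻ coords v∈
        ... | x , _ , refl = ∈-choices⁺ (replicate r fq) λ i →
          subst₂ _∈_ (sym (lookup∘tabulate (λ i → L i x) i)) (sym (lookup-replicate i fq))
            (∈-filter⁺ fixed? (els-complete (L i x)) (L-fixed i x))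

        images-unique : Unique (map coords els)
        images-unique = Unique.map⁺ coords-injective els-unique

        q^r≤|fq|^r : q ℕ.^ r ≤ length fq ℕ.^ r
        q^r≤|fq|^r = ≤-trans (≤-reflexive (sym |F|≡q^r)) (≤-trans (≤-reflexive (sym (length-map coords els)))
          (≤-trans (unique-⊆⇒≤ images-unique coords∈grid) (≤-reflexive (length-choices-replicate r fq))))

      -- At most q elements satisfy x^q = x. Fewer than q are impossible, because the coordinates
      -- embed all q^r elements of the field into the r-fold product of this set.
      |fq|≡q : length fq ≡ q
      |fq|≡q = ≤-antisym |fq|≤q (≮⇒≥ λ lt → <⇒≱ (^-monoˡ-< r lt) q^r≤|fq|^r)

      coords-surjective : ∀ {v} → (∀ i → lookup v i ∈ fq) → ∃ λ x → v ≡ coords x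
      coords-surjective {v} v∈ with ∈-map⁻ coords (∈-resp-↭
        (unique-⊆-length⇒↭ images-unique coords∈grid (trans (length-map coords els)
          (trans |F|≡q^r (sym (trans (length-choices-replicate r fq) (cong (ℕ._^ r) |fq|≡q))))))
        (∈-choices⁺ (replicate r fq) (λ i → subst (lookup v i ∈_) (sym (lookup-replicate i fq)) (v∈ i))))
      ... | x , _ , eq = x , eq

      module Box (ls : Vec (List F) r) (ls-unique : ∀ i → Unique (lookup ls i))
                 (ls⊆fq : ∀ i {x} → x ∈ lookup ls i → x ∈ fq) where

        inBox? : ∀ x → Dec (∀ i → L i x ∈ lookup ls i)
        inBox? x = Fin.all? (λ i → any? (L i x ≟_) (lookup ls i))

        box : List F
        box = filter inBox? els

        box-unique : Unique box
        box-unique = Unique.filter⁺ inBox? els-unique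

        ∈box⁻ : ∀ {x} → x ∈ box → ∀ i → L i x ∈ lookup ls i
        ∈box⁻ x∈ = proj₂ (∈-filter⁻ inBox? {xs = els} x∈)

        |choices|≤|box| : length (choices ls) ≤ length box
        |choices|≤|box| = ≤-trans (unique-⊆⇒≤ (choices-unique ls ls-unique) covered) (≤-reflexive (length-map coords box))
          where
          covered : ∀ {v} → v ∈ choices ls → v ∈ map coords box
          covered {v} v∈ with coords-surjective {v} (λ i → ls⊆fq i (∈-choices⁻ ls v∈ i))
          ... | x , refl = ∈-map⁺ coords (∈-filter⁺ inBox? (els-complete x) (λ i →
            subst (_∈ lookup ls i) (lookup∘tabulate (λ i → L i x) i) (∈-choices⁻ ls v∈ i)))

        |box|≤|choices| : length box ≤ length (choices ls)
        |box|≤|choices| = ≤-trans (≤-reflexive (sym (length-map coords box)))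
          (unique-⊆⇒≤ (Unique.map⁺ coords-injective box-unique) into)
          where
          into : ∀ {v} → v ∈ map coords box → v ∈ choices ls
          into v∈ with ∈-map⁻ coords v∈
          ... | x , x∈ , refl = ∈-choices⁺ ls (λ i →
            subst (_∈ lookup ls i) (sym (lookup∘tabulate (λ i → L i x) i)) (∈box⁻ x∈ i))

      L-0 : ∀ i → L i 0# ≡ 0#
      L-0 i = +-cancelˡ (L i 0#) (L i 0#) 0# (trans (sym (L-add i 0# 0#))
        (trans (cong (L i) (⊕-identityˡ 0#)) (sym (⊕-identityʳ (L i 0#)))))

    -- The lists of first are {0} on the last b coordinates and those of last on the first a, so that every
    -- coordinate of a sum comes from a single summand.
    module Blocks (g : ℕ) (fq : List F) (fq-unique : Unique fq) (0∈fq : 0# ∈ fq) (|fq|≡q : length fq ≡ suc g) where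

      ≢? : ∀ c (x : F) → Dec (x ≢ c)
      ≢? c x = ¬? (x ≟ c)

      allowed : F → List F
      allowed c = filter (≢? c) fq

      first : ∀ a {b} → (Fin (a + b) → F) → Vec (List F) (a + b)
      first zero    {b} c = replicate b (0# ∷ [])
      first (suc a) c     = allowed (c zero) ∷ first a (c ∘ suc)

      -- Excluding 0 from the first coordinate, where V has only 0, keeps every sum u + v nonzero.
      -- The price is a factor g - 1 in place of g in the lower bound for |U|.
      first-nonzero : ∀ a {b} → (Fin (suc a + b) → F) → Vec (List F) (suc a + b)
      first-nonzero a c = filter (≢? 0#) (allowed (c zero)) ∷ first a (c ∘ suc)

      last : ∀ a {b} → (Fin (a + b) → F) → Vec (List F) (a + b)
      last zero    c = tabulate (allowed ∘ c)
      last (suc a) c = (0# ∷ []) ∷ last a (c ∘ suc)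

      ∈allowed⁻ : ∀ {c x} → x ∈ allowed c → x ∈ fq × x ≢ c
      ∈allowed⁻ {c} = ∈-filter⁻ (≢? c) {xs = fq}

      allowed-unique : ∀ c → Unique (allowed c)
      allowed-unique c = Unique.filter⁺ (≢? c) fq-unique

      g≤|allowed| : ∀ c → g ≤ length (allowed c)
      g≤|allowed| c = ≤-pred (≤-trans (≤-reflexive (sym |fq|≡q)) (length≤1+filter-≢ _≟_ c fq-unique))

      first-⊆ : ∀ a {b} (c : Fin (a + b) → F) i {x} → x ∈ lookup (first a c) i → x ∈ fq
      first-⊆ zero    {b} c i x∈ with subst (_ ∈_) (lookup-replicate i (0# ∷ [])) x∈
      ... | here refl = 0∈fq
      first-⊆ (suc a) c zero    x∈ = proj₁ (∈allowed⁻ x∈)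
      first-⊆ (suc a) c (suc i) x∈ = first-⊆ a (c ∘ suc) i x∈

      last-⊆ : ∀ a {b} (c : Fin (a + b) → F) i {x} → x ∈ lookup (last a c) i → x ∈ fq
      last-⊆ zero    c i x∈ = proj₁ (∈allowed⁻ {c i} (subst (_ ∈_) (lookup∘tabulate (allowed ∘ c) i) x∈))
      last-⊆ (suc a) c zero    (here refl) = 0∈fq
      last-⊆ (suc a) c (suc i) x∈ = last-⊆ a (c ∘ suc) i x∈

      first-unique : ∀ a {b} (c : Fin (a + b) → F) i → Unique (lookup (first a c) i)
      first-unique zero    c i = subst Unique (sym (lookup-replicate i (0# ∷ []))) ([] ∷ [])
      first-unique (suc a) c zero    = allowed-unique (c zero)
      first-unique (suc a) c (suc i) = first-unique a (c ∘ suc) i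

      last-unique : ∀ a {b} (c : Fin (a + b) → F) i → Unique (lookup (last a c) i)
      last-unique zero    c i = subst Unique (sym (lookup∘tabulate (allowed ∘ c) i)) (allowed-unique (c i))
      last-unique (suc a) c zero    = [] ∷ []
      last-unique (suc a) c (suc i) = last-unique a (c ∘ suc) i

      first+last≢ : ∀ a {b} (c : Fin (a + b) → F) i {x y} →
                    x ∈ lookup (first a c) i → y ∈ lookup (last a c) i → x ⊕ y ≢ c i
      first+last≢ zero    c i {y = y} x∈ y∈ eq with subst (_ ∈_) (lookup-replicate i (0# ∷ [])) x∈
      ... | here refl = proj₂ (∈allowed⁻ {c i} (subst (_ ∈_) (lookup∘tabulate (allowed ∘ c) i) y∈))
                          (trans (sym (⊕-identityˡ y)) eq)
      first+last≢ (suc a) c zero {x} x∈ (here refl) eq = proj₂ (∈allowed⁻ x∈) (trans (sym (⊕-identityʳ x)) eq)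
      first+last≢ (suc a) c (suc i) x∈ y∈ = first+last≢ a (c ∘ suc) i x∈ y∈

      first-nonzero⊆first : ∀ a {b} (c : Fin (suc a + b) → F) i {x} →
                            x ∈ lookup (first-nonzero a c) i → x ∈ lookup (first (suc a) c) i
      first-nonzero⊆first a c zero    x∈ = proj₁ (∈-filter⁻ (≢? 0#) {xs = allowed (c zero)} x∈)
      first-nonzero⊆first a c (suc i) x∈ = x∈

      first-nonzero-unique : ∀ a {b} (c : Fin (suc a + b) → F) i → Unique (lookup (first-nonzero a c) i)
      first-nonzero-unique a c zero    = Unique.filter⁺ (≢? 0#) (allowed-unique (c zero))
      first-nonzero-unique a c (suc i) = first-unique a (c ∘ suc) i

      g^a≤|first| : ∀ a {b} (c : Fin (a + b) → F) → g ℕ.^ a ≤ length (choices (first a c))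
      g^a≤|first| zero    {b} c = ≤-reflexive (sym (trans (length-choices-replicate b (0# ∷ [])) (^-zeroˡ b)))
      g^a≤|first| (suc a) c = ≤-trans (*-mono-≤ (g≤|allowed| (c zero)) (g^a≤|first| a (c ∘ suc)))
        (≤-reflexive (sym (length-choices-∷ (allowed (c zero)) (first a (c ∘ suc)))))

      |first-nonzero|≥ : ∀ a {b} (c : Fin (suc a + b) → F) → pred g * g ℕ.^ a ≤ length (choices (first-nonzero a c))
      |first-nonzero|≥ a c = ≤-trans (*-mono-≤ (pred-mono-≤ (≤-trans (g≤|allowed| (c zero)) (length≤1+filter-≢ _≟_ 0# (allowed-unique (c zero)))))
          (g^a≤|first| a (c ∘ suc)))
        (≤-reflexive (sym (length-choices-∷ (filter (≢? 0#) (allowed (c zero))) (first a (c ∘ suc)))))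

      private
        tabulate-≥ : ∀ {b} (c : Fin b → F) → g ℕ.^ b ≤ length (choices (tabulate (allowed ∘ c)))
        tabulate-≥ {zero}  c = ≤-refl
        tabulate-≥ {suc b} c = ≤-trans (*-mono-≤ (g≤|allowed| (c zero)) (tabulate-≥ (c ∘ suc)))
          (≤-reflexive (sym (length-choices-∷ (allowed (c zero)) (tabulate (allowed ∘ c ∘ suc)))))

        tabulate-≤ : ∀ {b} (c : Fin b → F) → length (choices (tabulate (allowed ∘ c))) ≤ suc g ℕ.^ b
        tabulate-≤ {zero}  c = ≤-refl
        tabulate-≤ {suc b} c = ≤-trans (≤-reflexive (length-choices-∷ (allowed (c zero)) (tabulate (allowed ∘ c ∘ suc))))
          (*-mono-≤ (≤-trans (length-filter (≢? (c zero)) fq) (≤-reflexive |fq|≡q)) (tabulate-≤ (c ∘ suc)))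

        |last|-suc : ∀ a {b} (c : Fin (suc a + b) → F) → length (choices (last (suc a) c)) ≡ length (choices (last a (c ∘ suc)))
        |last|-suc a c = trans (length-choices-∷ (0# ∷ []) (last a (c ∘ suc))) (*-identityˡ _)

      g^b≤|last| : ∀ a {b} (c : Fin (a + b) → F) → g ℕ.^ b ≤ length (choices (last a c))
      g^b≤|last| zero    c = tabulate-≥ c
      g^b≤|last| (suc a) c = ≤-trans (g^b≤|last| a (c ∘ suc)) (≤-reflexive (sym (|last|-suc a c)))

      -- An upper bound on |V| is needed to place it below M, of size about √Q; allowing all q
      -- values in each coordinate is precise enough.
      |last|≤q^b : ∀ a {b} (c : Fin (a + b) → F) → length (choices (last a c)) ≤ suc g ℕ.^ b
      |last|≤q^b zero    c = tabulate-≤ c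
      |last|≤q^b (suc a) c = ≤-trans (≤-reflexive (|last|-suc a c)) (|last|≤q^b a (c ∘ suc))

    module Boxes (g a b : ℕ) .{{_ : NonZero g}} (|F|≡q^r : length els ≡ suc g ℕ.^ (suc a + b))
             (L : Fin (suc a + b) → F → F)
             (L-add : ∀ i x y → L i (x ⊕ y) ≡ L i x ⊕ L i y)
             (L-fixed : ∀ i x → L i x ^ suc g ≡ L i x)
             (L-injective : ∀ {x y} → (∀ i → L i x ≡ L i y) → x ≡ y)
             (c : Fin (suc a + b) → F) where

      open Coordinates g (suc a + b) |F|≡q^r L L-add L-fixed L-injective
      open Blocks g fq fq-unique 0∈fq |fq|≡q

      private
        us vs : Vec (List F) (suc a + b)
        us = first-nonzero a c
        vs = last (suc a) c

        us⊆fq : ∀ i {x} → x ∈ lookup us i → x ∈ fq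
        us⊆fq i x∈ = first-⊆ (suc a) c i (first-nonzero⊆first a c i x∈)

        module BU = Box us (first-nonzero-unique a c) us⊆fq
        module BV = Box vs (last-unique (suc a) c) (last-⊆ (suc a) c)

      U V : List F
      U = BU.box
      V = BV.box

      U-unique : Unique U
      U-unique = BU.box-unique

      V-unique : Unique V
      V-unique = BV.box-unique

      |U|≥ : pred g * g ℕ.^ a ≤ length U
      |U|≥ = ≤-trans (|first-nonzero|≥ a c) BU.|choices|≤|box|

      |V|≥ : g ℕ.^ b ≤ length V
      |V|≥ = ≤-trans (g^b≤|last| (suc a) c) BV.|choices|≤|box|

      |V|≤ : length V ≤ suc g ℕ.^ b
      |V|≤ = ≤-trans BV.|box|≤|choices| (|last|≤q^b (suc a) c)

      sums-avoid : ∀ {u v} → u ∈ U → v ∈ V → ∀ i → L i (u ⊕ v) ≢ c i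
      sums-avoid {u} {v} u∈ v∈ i eq = first+last≢ (suc a) c i (first-nonzero⊆first a c i (BU.∈box⁻ u∈ i)) (BV.∈box⁻ v∈ i)
        (trans (sym (L-add i u v)) eq)
      sums-nonzero : ∀ {u v} → u ∈ U → v ∈ V → u ⊕ v ≢ 0#
      sums-nonzero {u} {v} u∈ v∈ eq = proj₂ (∈-filter⁻ (≢? 0#) {xs = allowed (c zero)} (BU.∈box⁻ u∈ zero)) (begin
        L zero u ≡⟨ ⊕-identityʳ _ ⟨
        L zero u ⊕ 0# ≡⟨ cong (L zero u ⊕_) (singleton (BV.∈box⁻ v∈ zero)) ⟨
        L zero u ⊕ L zero v ≡⟨ L-add zero u v ⟨
        L zero (u ⊕ v) ≡⟨ cong (L zero) eq ⟩
        L zero 0# ≡⟨ L-0 zero ⟩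
        0# ∎)
        where
        open ≡-Reasoning
        singleton : ∀ {x} → x ∈ (0# ∷ []) → x ≡ 0#
        singleton (here eq) = eq

-- A copy of the field with propositional equality

module Transport where

  open import Algebra.Structures using (IsCommutativeRing)
  open import Data.List.Relation.Unary.Unique.Propositional.Properties using (allFin⁺)
  open import Data.Nat using (ℕ; zero; suc)
  open import Relation.Binary.PropositionalEquality using (_≡_; refl; sym; trans; cong; isEquivalence; cong₂; _≢_)

  open import Defs using (FiniteField; pow)
  open Field using (FinField; module FieldTheory)

  -- The enumeration carries the field structure to Fin n, whose equality is propositional.
  module Enumerated {n : ℕ} (K : FiniteField n) where
    private module K = FiniteField K
    open K using (_≈_; Carrier) renaming (_+_ to _+ᴷ_; _*_ to _*ᴷ_; -_ to -ᴷ_; 0# to 0ᴷ; 1# to 1ᴷ)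

    E : Fin n → Carrier
    E = K.enum

    I : Carrier → Fin n
    I x = proj₁ (K.enum-sur x)

    E-I : ∀ x → E (I x) ≈ x
    E-I x = proj₂ (K.enum-sur x)

    E-injective : ∀ {i j} → E i ≈ E j → i ≡ j
    E-injective = K.enum-inj _ _

    I-cong : ∀ {x y} → x ≈ y → I x ≡ I y
    I-cong {x} {y} eq = E-injective (K.trans (E-I x) (K.trans eq (K.sym (E-I y))))

    I-injective : ∀ {x y} → I x ≡ I y → x ≈ y
    I-injective {x} {y} eq = K.trans (K.sym (E-I x)) (K.trans (K.reflexive (cong E eq)) (E-I y))

    I-E : ∀ i → I (E i) ≡ i
    I-E i = E-injective (E-I (E i))

    _⊕_ _⊗_ : Fin n → Fin n → Fin n
    i ⊕ j = I (E i +ᴷ E j)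
    i ⊗ j = I (E i *ᴷ E j)

    ⊖_ : Fin n → Fin n
    ⊖ i = I (-ᴷ E i)

    E-⊕ : ∀ i j → E (i ⊕ j) ≈ E i +ᴷ E j
    E-⊕ i j = E-I _

    E-⊗ : ∀ i j → E (i ⊗ j) ≈ E i *ᴷ E j
    E-⊗ i j = E-I _

    private
      isCommutativeRing : IsCommutativeRing _≡_ _⊕_ _⊗_ ⊖_ (I 0ᴷ) (I 1ᴷ)
      isCommutativeRing = record
        { isRing = record
          { +-isAbelianGroup = record
            { isGroup = record
              { isMonoid = record
                { isSemigroup = record
                  { isMagma = record { isEquivalence = isEquivalence ; ∙-cong = cong₂ _⊕_ }
                  ; assoc = λ i j k → I-cong (K.trans (K.+-cong (E-⊕ i j) K.refl)
                      (K.trans (K.+-assoc (E i) (E j) (E k)) (K.+-cong K.refl (K.sym (E-⊕ j k))))) }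
                ; identity = (λ i → trans (I-cong (K.trans (K.+-cong (E-I 0ᴷ) K.refl) (K.+-identityˡ (E i)))) (I-E i))
                           , (λ i → trans (I-cong (K.trans (K.+-cong K.refl (E-I 0ᴷ)) (K.+-identityʳ (E i)))) (I-E i)) }
              ; inverse = (λ i → I-cong (K.trans (K.+-cong (E-I _) K.refl) (K.-‿inverseˡ (E i))))
                        , (λ i → I-cong (K.trans (K.+-cong K.refl (E-I _)) (K.-‿inverseʳ (E i))))
              ; ⁻¹-cong = cong ⊖_ }
            ; comm = λ i j → I-cong (K.+-comm (E i) (E j)) }
          ; *-cong = cong₂ _⊗_
          ; *-assoc = λ i j k → I-cong (K.trans (K.*-cong (E-⊗ i j) K.refl)
              (K.trans (K.*-assoc (E i) (E j) (E k)) (K.*-cong K.refl (K.sym (E-⊗ j k)))))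
          ; *-identity = (λ i → trans (I-cong (K.trans (K.*-cong (E-I 1ᴷ) K.refl) (K.*-identityˡ (E i)))) (I-E i))
                       , (λ i → trans (I-cong (K.trans (K.*-cong K.refl (E-I 1ᴷ)) (K.*-identityʳ (E i)))) (I-E i))
          ; distrib = (λ i j k → I-cong (K.trans (K.*-cong K.refl (E-⊕ j k)) (K.trans (K.distribˡ (E i) (E j) (E k))
                        (K.sym (K.+-cong (E-⊗ i j) (E-⊗ i k))))))
                    , (λ i j k → I-cong (K.trans (K.*-cong (E-⊕ j k) K.refl) (K.trans (K.distribʳ (E i) (E j) (E k))
                        (K.sym (K.+-cong (E-⊗ j i) (E-⊗ k i))))))
          }
        ; *-comm = λ i j → I-cong (K.*-comm (E i) (E j))
        }

      inverse : Fin n → Fin n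
      inverse i with E i K.≟ 0ᴷ
      ... | yes _  = i
      ... | no nz = I (proj₁ (K.inverse (E i) nz))

      ⊗-inverse : ∀ i → i ≢ I 0ᴷ → i ⊗ inverse i ≡ I 1ᴷ
      ⊗-inverse i i≢0 with E i K.≟ 0ᴷ
      ... | yes z = contradiction (trans (sym (I-E i)) (I-cong z)) i≢0
      ... | no nz = I-cong (K.trans (K.*-cong K.refl (E-I _)) (proj₂ (K.inverse (E i) nz)))

    field′ : FinField
    field′ = record
      { F = Fin n ; _+_ = _⊕_ ; _*_ = _⊗_ ; -_ = ⊖_ ; 0# = I 0ᴷ ; 1# = I 1ᴷ
      ; isCommutativeRing = isCommutativeRing
      ; _≟_ = Fin._≟_
      ; 1≢0 = λ eq → K.1≉0 (I-injective eq)
      ; inv = inverse ; *-inv = ⊗-inverse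
      ; els = allFin n ; els-unique = allFin⁺ n ; els-complete = ∈-allFin }

  record PropositionalModel {n : ℕ} (K : FiniteField n) : Set₁ where
    private module K = FiniteField K
    field
      𝔽 : FinField
    module F = FieldTheory 𝔽
    field
      |els|≡n     : length F.els ≡ n
      E           : F.F → K.Carrier
      I           : K.Carrier → F.F
      E-I         : ∀ x → E (I x) K.≈ x
      E-injective : ∀ {i j} → E i K.≈ E j → i ≡ j
      E-+         : ∀ i j → E (i F.+ j) K.≈ E i K.+ E j
      E-*         : ∀ i j → E (i F.* j) K.≈ E i K.* E j
      E-0         : E F.0# K.≈ K.0#
      E-1         : E F.1# K.≈ K.1#

    I-cong : ∀ {x y} → x K.≈ y → I x ≡ I y
    I-cong {x} {y} eq = E-injective (K.trans (E-I x) (K.trans eq (K.sym (E-I y))))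

    I-injective : ∀ {x y} → I x ≡ I y → x K.≈ y
    I-injective {x} {y} eq = K.trans (K.sym (E-I x)) (K.trans (K.reflexive (cong E eq)) (E-I y))

    I-E : ∀ i → I (E i) ≡ i
    I-E i = E-injective (E-I (E i))

    I-+ : ∀ x y → I x F.+ I y ≡ I (x K.+ y)
    I-+ x y = E-injective (K.trans (E-+ (I x) (I y)) (K.trans (K.+-cong (E-I x) (E-I y)) (K.sym (E-I (x K.+ y)))))

    I-0 : I K.0# ≡ F.0#
    I-0 = E-injective (K.trans (E-I K.0#) (K.sym E-0))

    E-^ : ∀ i k → E (i F.^ k) K.≈ pow K (E i) k
    E-^ i zero    = E-1
    E-^ i (suc k) = K.trans (E-* i (i F.^ k)) (K.*-cong K.refl (E-^ i k))

  abstract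
    propositionalModel : ∀ {n} (K : FiniteField n) → PropositionalModel K
    propositionalModel {n} K = record
      { 𝔽 = field′ ; |els|≡n = length-tabulate {n = n} id
      ; E = E ; I = I ; E-I = E-I ; E-injective = E-injective
      ; E-+ = E-⊕ ; E-* = E-⊗ ; E-0 = E-I _ ; E-1 = E-I _ }
      where open Enumerated K

-- From general position to coordinates

module Assembly where

  open import Data.Fin.Subset using (⊤)
  open import Data.Fin.Subset.Properties using (∣⊤∣≡n; ∈⊤)
  open import Data.Nat
  open import Data.Nat.Properties
  open import Relation.Binary.PropositionalEquality hiding ([_])

  open import Defs
  open Transport using (PropositionalModel)
  open Hyperplanes using (module Boxes)
  open Primes using (primeDivisors)
  open Core using (generator-in-sumset)

  pow-cong : ∀ {n} (K : FiniteField n) {x y} → FiniteField._≈_ K x y → ∀ k → FiniteField._≈_ K (pow K x k) (pow K y k)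
  pow-cong K eq zero    = FiniteField.refl K
  pow-cong K eq (suc k) = FiniteField.*-cong K eq (pow-cong K eq k)

  module _ {g a b : ℕ} .{{_ : NonZero g}} {n : ℕ} (1<g : 1 < g) (n≡q^r : n ≡ suc g ^ (suc a + b))
           (K : FiniteField n) (model : PropositionalModel K)
           (A : Fin (suc a + b) → AffineHyperplane K (suc g)) (general : GeneralPosition K A) where

    private
      q r : ℕ
      q = suc g
      r = suc a + b

      module K = FiniteField K
      open PropositionalModel model
      open AffineHyperplane

      |els|≡q^r : length F.els ≡ q ^ r
      |els|≡q^r = trans |els|≡n n≡q^r

      Lᴷ : Fin r → K.Carrier → K.Carrier
      Lᴷ i = FqFunctional.L (functional (A i))

      L : Fin r → F.F → F.F
      L i x = I (Lᴷ i (E x))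

      c : Fin r → F.F
      c i = I (const (A i))

      L-add : ∀ i x y → L i (x F.+ y) ≡ L i x F.+ L i y
      L-add i x y = trans (I-cong (K.trans (FqFunctional.L-cong (functional (A i)) (E-+ x y))
        (FqFunctional.L-add (functional (A i)) (E x) (E y)))) (sym (I-+ (Lᴷ i (E x)) (Lᴷ i (E y))))

      L-fixed : ∀ i x → L i x F.^ q ≡ L i x
      L-fixed i x = E-injective (K.trans (E-^ (L i x) q) (K.trans (pow-cong K (E-I (Lᴷ i (E x))) q)
        (K.trans (FqFunctional.L-Fq (functional (A i)) (E x)) (K.sym (E-I (Lᴷ i (E x)))))))

      -- General position for the full set of r hyperplanes gives an intersection of q^(r - r) = 1
      -- point.
      common-point : ∃ λ x₀ → (∀ i → L i x₀ ≡ c i) × (∀ z → (∀ i → L i z ≡ c i) → z ≡ x₀)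
      common-point with general ⊤ (subst (1 ≤_) (sym (∣⊤∣≡n r)) (s≤s z≤n))
      ... | size = unpack (subst (HasSize K (InAll K A ⊤)) (trans (cong (λ m → q ^ (r ∸ m)) (∣⊤∣≡n r)) (cong (q ^_) (n∸n≡0 r))) size)
        where
        unpack : HasSize K (InAll K A ⊤) 1 → ∃ λ x₀ → (∀ i → L i x₀ ≡ c i) × (∀ z → (∀ i → L i z ≡ c i) → z ≡ x₀)
        unpack (f , inside , _ , covers) = I (f zero)
          , (λ i → I-cong (K.trans (FqFunctional.L-cong (functional (A i)) (E-I (f zero))) (inside zero i ∈⊤)))
          , λ z on → E-injective (K.trans (unique (covers (E z) (λ i _ → I-injective (on i)))) (K.sym (E-I (f zero))))
          where
          unique : ∀ {z} → (∃ λ i → f i K.≈ z) → z K.≈ f zero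
          unique (zero , eq) = K.sym eq

      -- A common zero x - y of the functionals would move the common point x₀ to another one. With
      -- t = x₀ - y, both t + y and t + x lie on all hyperplanes, so they coincide.
      L-injective : ∀ {x y} → (∀ i → L i x ≡ L i y) → x ≡ y
      L-injective {x} {y} eq with common-point
      ... | x₀ , on , only = F.+-cancelˡ t x y (trans (only (t F.+ x) λ i → begin
        L i (t F.+ x) ≡⟨ L-add i t x ⟩
        L i t F.+ L i x ≡⟨ cong (L i t F.+_) (eq i) ⟩
        L i t F.+ L i y ≡⟨ L-add i t y ⟨
        L i (t F.+ y) ≡⟨ cong (L i) t+y ⟩
        L i x₀ ≡⟨ on i ⟩
        c i ∎) (sym t+y))
        where
        open ≡-Reasoning
        t : F.F
        t = x₀ F.+ (F.- y)
        t+y : t F.+ y ≡ x₀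
        t+y = trans (F.+-assoc x₀ (F.- y) y) (trans (cong (x₀ F.+_) (F.-‿inverseˡ y)) (F.+-identityʳ x₀))

      open Boxes 𝔽 g a b |els|≡q^r L L-add L-fixed L-injective c

      units≡ : length F.units ≡ pred (q ^ r)
      units≡ = cong pred (trans F.length-units |els|≡q^r)

      conclude : (∃₂ λ u v → u ∈ U × v ∈ V × (∀ y → y ≢ F.0# → ∃ λ k → (u F.+ v) F.^ k ≡ y)) →
                 ∃ λ x → Primitive K x × Avoids K A x
      conclude (u , v , u∈ , v∈ , generates) = E (u F.+ v) , (nonzero , spans) , λ i on → sums-avoid u∈ v∈ i (I-cong on)
        where
        nonzero : ¬ (E (u F.+ v) K.≈ K.0#)
        nonzero eq = sums-nonzero u∈ v∈ (trans (sym (I-E (u F.+ v))) (trans (I-cong eq) I-0))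
        spans : ∀ y → ¬ (y K.≈ K.0#) → ∃ λ k → pow K (E (u F.+ v)) k K.≈ y
        spans y y≉0 =
          let (k , eq) = generates (I y) (λ eq → y≉0 (I-injective (trans eq (sym I-0)))) in
          k , K.trans (K.sym (E-^ (u F.+ v) k)) (K.trans (K.reflexive (cong E eq)) (E-I y))

      instance
        U≢0 : NonZero (length U)
        U≢0 = >-nonZero (≤-trans (>-nonZero⁻¹ (pred g * g ^ a) {{m*n≢0 (pred g) (g ^ a) {{>-nonZero (pred-mono-≤ 1<g)}} {{m^n≢0 g a}}}}) |U|≥)
        V≢0 : NonZero (length V)
        V≢0 = >-nonZero (≤-trans (>-nonZero⁻¹ (g ^ b) {{m^n≢0 g b}}) |V|≥)

    avoiding-primitive : ∀ {M M′} .{{_ : NonZero M}} → M * M′ ≡ q ^ r → F.Additive M → q ^ b ≤ M → M ≤ M′ →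
      ∀ {Λ} → (let ω = length (primeDivisors (pred (q ^ r))) in 2 ^ ω * 2 ^ ω < Λ) →
      (∀ {u l} → pred g * g ^ a ≤ u → g ^ b ≤ l → Λ * Λ * (Λ * Λ) * (10 * M′ * (l * l) + 3 * (q ^ r)) ≤ u * (l * l)) →
      ∃ λ x → Primitive K x × Avoids K A x
    avoiding-primitive {M} {M′} MM′≡Q additive q^b≤M M≤M′ {Λ} 4^ω<Λ large = conclude
      (generator-in-sumset 𝔽 U-unique V-unique sums-nonzero
        (trans MM′≡Q (sym |els|≡q^r)) additive (≤-trans |V|≤ q^b≤M) M≤M′ {Λ}
        (subst (λ n → 2 ^ length (primeDivisors n) * 2 ^ length (primeDivisors n) < Λ) (sym units≡) 4^ω<Λ)
        (subst (λ Q → Λ * Λ * (Λ * Λ) * (10 * M′ * (length V * length V) + 3 * Q) ≤ length U * (length V * length V))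
          (sym |els|≡q^r) (large |U|≥ |V|≥)))

-- The cases q = 4 and q = 5

open import Defs
open import Data.Nat using (ℕ; _≤_; _^_)
open import Data.Fin using (Fin)
open import Data.Product using (Σ; ∃; _×_)
open import Data.Sum using (_⊎_)
open import Relation.Binary.PropositionalEquality using (_≡_)

open import Data.Nat using (zero; suc; pred; _+_; _*_; _<_; NonZero; z≤n; s≤s; ⌊_/2⌋; ⌈_/2⌉; >-nonZero; >-nonZero⁻¹; ≤-pred)
open import Data.Nat.Divisibility using (∣⇒≤)
open import Data.Nat.DivMod using (_/_; _%_; m≡m%n+[m/n]*n; m%n<n; /-monoˡ-≤; m*n/n≡m)
open import Data.Nat.Primality using (prime⇒nonZero)
open import Data.Nat.Properties
open import Data.Nat.Tactic.RingSolver using (solve-∀)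
open import Relation.Binary.PropositionalEquality using (refl; sym; trans; cong; cong₂; subst)

open Primes
open Numeric
open Transport
open Assembly

private
  ω : ℕ → ℕ
  ω n = length (primeDivisors n)

  -- The sieve requires Λ > 4^w, and Λ = 2 · 4^w is taken. Its fourth power is the loss that the
  -- moment bound has to absorb.
  16X≡Λ⁴ : ∀ w → let Λ = 2 * (2 ^ w * 2 ^ w) in Λ * Λ * (Λ * Λ) ≡ 16 * 2 ^ (8 * w)
  16X≡Λ⁴ w = trans (lem (2 ^ w)) (cong (16 *_) (trans (^-*-assoc 2 w 8) (cong (2 ^_) (*-comm w 8))))
    where
    lem : ∀ p → 2 * (p * p) * (2 * (p * p)) * (2 * (p * p) * (2 * (p * p))) ≡
          16 * (p * (p * (p * (p * (p * (p * (p * (p * 1))))))))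
    lem = solve-∀

module _ {g a s : ℕ} .{{_ : NonZero g}} (1<g : 1 < g) (2s≤a+1 : s + s ≤ suc a)
         (K : FiniteField (suc g ^ (suc a + s))) (A : Fin (suc a + s) → AffineHyperplane K (suc g))
         (general : GeneralPosition K A) where

  private
    q Q w X : ℕ
    q = suc g
    Q = q ^ (suc a + s)
    w = ω (pred Q)
    X = 2 ^ (8 * w)
    module F = PropositionalModel.F (propositionalModel K)

  primitive-if-large : ∀ {M M′} .{{_ : NonZero M}} → M * M′ ≡ Q → F.Additive M → q ^ s ≤ M → M ≤ M′ →
    640 * X * M′ ≤ g ^ s * g ^ s → 192 * X * Q ≤ g ^ s * g ^ s * (g ^ s * g ^ s) →
    ∃ λ x → Primitive K x × Avoids K A x
  primitive-if-large {M} {M′} MM′≡Q additive q^s≤M M≤M′ h₁ h₂ =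
    avoiding-primitive {g} {a} {s} 1<g refl K (propositionalModel K) A general MM′≡Q additive q^s≤M M≤M′
      {2 * (2 ^ w * 2 ^ w)}
      (m<m+n (2 ^ w * 2 ^ w) (≤-trans (>-nonZero⁻¹ (2 ^ w * 2 ^ w) {{m*n≢0 (2 ^ w) (2 ^ w) {{m^n≢0 2 w}} {{m^n≢0 2 w}}}}) (m≤m+n _ 0)))
      (λ {u} {l} u≥ l≥ → subst (λ m → m * (10 * M′ * (l * l) + 3 * Q) ≤ u * (l * l)) (sym (16X≡Λ⁴ w))
        (combine-bounds {X} {M′} {Q} {u} {l} {g ^ s} h₁ h₂ (g^2s≤2u u≥) l≥))
    where
    open ≤-Reasoning
    lem : ∀ m x → 2 * m * x ≡ 2 * (m * x)
    lem = solve-∀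
    g≤2pred : g ≤ 2 * pred g
    g≤2pred = ≤-trans (≤-reflexive (sym (suc-pred g))) (+-mono-≤ {1} {pred g} {pred g} (pred-mono-≤ 1<g) (≤-reflexive (sym (+-identityʳ _))))
    -- Since g ≥ 2, excluding 0 from the first coordinate at most halves the count: (g - 1) g^a ≥
    -- g^(a + 1)/2.
    g^2s≤2u : ∀ {u} → pred g * g ^ a ≤ u → g ^ s * g ^ s ≤ 2 * u
    g^2s≤2u {u} u≥ = begin
      g ^ s * g ^ s ≡⟨ ^-distribˡ-+-* g s s ⟨
      g ^ (s + s) ≤⟨ ^-monoʳ-≤ g 2s≤a+1 ⟩
      g * g ^ a ≤⟨ *-monoˡ-≤ (g ^ a) g≤2pred ⟩
      2 * pred g * g ^ a ≡⟨ lem (pred g) (g ^ a) ⟩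
      2 * (pred g * g ^ a) ≤⟨ *-monoʳ-≤ 2 u≥ ⟩
      2 * u ∎

private
  abstract
    B : ℕ
    B = 2 ^ 864

    B≡ : B ≡ 2 ^ 864
    B≡ = refl

    s₀ : ℕ
    s₀ = 96 * B + 156 + 1

    s₀-large : 96 * B + 156 + 1 ≤ s₀
    s₀-large = ≤-refl

    1≤s₀ : 1 ≤ s₀
    1≤s₀ = m≤n+m 1 (96 * B + 156)

  -- The primes dividing q^r - 1 have product at most 8^r ≤ 2^(9s + 6), to which `few-primes`
  -- applies. The factor 8192 = 2^13, the source of the 13 there, exceeds the constants 2560, 3072,
  -- 7680 and 4800 of the two cases.
  prime-factor-bound : ∀ {q r s} → 2 ≤ q → q ≤ 8 → 1 ≤ r → r ≤ 2 + 3 * s → s₀ ≤ s →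
                       2 ^ (8 * ω (pred (q ^ r))) * 8192 * 8 ^ s ≤ 9 ^ s
  prime-factor-bound {q} {r} {s} 2≤q q≤8 1≤r r≤ s₀≤s = ≤-trans
    (≤-reflexive (cong (_* 8 ^ s) (sym (^-distribˡ-+-* 2 (8 * ω n) 13))))
    (2^t*8^s≤9^s (8 * ω n + 13) (few-primes B s B≡ (≤-trans s₀-large s₀≤s) (primeDivisors-unique n)
      (All.tabulate (λ p∈ → prime⇒nonZero (proj₁ (∈primeDivisors⁻ n p∈))))
      (≤-trans (∣⇒≤ {{n≢0}} (product∣ (primeDivisors-unique n)
          (All.tabulate (λ p∈ → proj₁ (∈primeDivisors⁻ n p∈))) (All.tabulate (λ p∈ → proj₂ (∈primeDivisors⁻ n p∈)))))
        n≤)))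
    where
    open ≤-Reasoning
    n : ℕ
    n = pred (q ^ r)
    n≢0 : NonZero n
    n≢0 = >-nonZero (pred-mono-≤ (≤-trans (≤-trans 2≤q (≤-reflexive (sym (*-identityʳ q)))) (^-monoʳ-≤ q {{>-nonZero (≤-trans (s≤s z≤n) 2≤q)}} 1≤r)))
    lem : ∀ s → 3 * (2 + 3 * s) ≡ 9 * s + 6
    lem = solve-∀
    n≤ : n ≤ 2 ^ (9 * s + 6)
    n≤ = begin
      pred (q ^ r) ≤⟨ pred[n]≤n ⟩
      q ^ r ≤⟨ ^-monoˡ-≤ r q≤8 ⟩
      8 ^ r ≤⟨ ^-monoʳ-≤ 8 r≤ ⟩
      8 ^ (2 + 3 * s) ≡⟨ ^-*-assoc 2 3 (2 + 3 * s) ⟩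
      2 ^ (3 * (2 + 3 * s)) ≡⟨ cong (2 ^_) (lem s) ⟩
      2 ^ (9 * s + 6) ∎

  scaled : ∀ {X c s a b y} → X * 8192 * 8 ^ s ≤ 9 ^ s → 9 * a ≤ 8 * b → c ≤ 8192 → y ≤ c * a ^ s → X * y ≤ b ^ s
  scaled {X} {c} {s} {a} {b} {y} H ab c≤ y≤ = begin
    X * y ≤⟨ *-monoʳ-≤ X (≤-trans y≤ (*-monoˡ-≤ (a ^ s) c≤)) ⟩
    X * (8192 * a ^ s) ≡⟨ *-assoc X 8192 (a ^ s) ⟨
    X * 8192 * a ^ s ≤⟨ rescale {X * 8192} {s} {a} {b} H ab ⟩
    b ^ s ∎
    where open ≤-Reasoning

  move-constant : ∀ {k X y z} → X * (k * y) ≤ z → k * X * y ≤ z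
  move-constant {k} {X} {y} = ≤-trans (≤-reflexive (lem k X y))
    where
    lem : ∀ k X y → k * X * y ≡ X * (k * y)
    lem = solve-∀

  q^r≤ : ∀ q .{{_ : NonZero q}} {r s} → r ≤ 2 + 3 * s → q ^ r ≤ q ^ 2 * (q ^ 3) ^ s
  q^r≤ q {r} {s} r≤ = ≤-trans (^-monoʳ-≤ q r≤)
    (≤-reflexive (trans (^-distribˡ-+-* q 2 (3 * s)) (cong (q ^ 2 *_) (sym (^-*-assoc q 3 s)))))

  square^ : ∀ g s → (g * g) ^ s ≡ g ^ s * g ^ s
  square^ g s = ^-distribʳ-* s g g

  fourth^ : ∀ g s → (g * g * (g * g)) ^ s ≡ g ^ s * g ^ s * (g ^ s * g ^ s)
  fourth^ g s = trans (square^ (g * g) s) (cong₂ _*_ (square^ g s) (square^ g s))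

  ⌈n/2⌉≤1+⌊n/2⌋ : ∀ n → ⌈ n /2⌉ ≤ suc ⌊ n /2⌋
  ⌈n/2⌉≤1+⌊n/2⌋ zero          = z≤n
  ⌈n/2⌉≤1+⌊n/2⌋ (suc zero)    = s≤s z≤n
  ⌈n/2⌉≤1+⌊n/2⌋ (suc (suc n)) = s≤s (⌈n/2⌉≤1+⌊n/2⌋ n)

  square-cancel-≤ : ∀ {m n} → m * m ≤ n * n → m ≤ n
  square-cancel-≤ le = ≮⇒≥ λ n<m → <⇒≱ (*-mono-< n<m n<m) le

-- As 4 = 2², the power M = M′ = 2^r of the characteristic is exactly √Q for every r. The tight
-- comparison is 9^s from U against √Q ≤ 4 · 8^s.
case₄ : ∀ {a s} → s + s ≤ suc a → suc a + s ≤ 2 + 3 * s → s₀ ≤ s →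
        (K : FiniteField (4 ^ (suc a + s))) (A : Fin (suc a + s) → AffineHyperplane K 4) → GeneralPosition K A →
        ∃ λ x → Primitive K x × Avoids K A x
case₄ {a} {s} 2s≤ r≤ s₀≤s K A general = primitive-if-large (s≤s (s≤s z≤n)) 2s≤ K A general
  {2 ^ r} {2 ^ r} {{m^n≢0 2 r}} (sym (^-distribʳ-* r 2 2)) additive
  (≤-trans (≤-reflexive (^-*-assoc 2 2 s)) (^-monoʳ-≤ 2 2s≤r)) ≤-refl
  (move-constant {640} {X} {2 ^ r} (subst (X * (640 * 2 ^ r) ≤_) (square^ 3 s) (scaled {X} {2560} {s} {8} {9} H ≤-refl (≤ᵇ⇒≤ 2560 8192 _) (begin
    640 * 2 ^ r ≤⟨ *-monoʳ-≤ 640 (q^r≤ 2 {r} {s} r≤) ⟩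
    640 * (4 * 8 ^ s) ≡⟨ *-assoc 640 4 (8 ^ s) ⟨
    2560 * 8 ^ s ∎))))
  (move-constant {192} {X} {4 ^ r} (subst (X * (192 * 4 ^ r) ≤_) (fourth^ 3 s) (scaled {X} {3072} {s} {64} {81} H (≤ᵇ⇒≤ 576 648 _) (≤ᵇ⇒≤ 3072 8192 _) (begin
    192 * 4 ^ r ≤⟨ *-monoʳ-≤ 192 (q^r≤ 4 {r} {s} r≤) ⟩
    192 * (16 * 64 ^ s) ≡⟨ *-assoc 192 16 (64 ^ s) ⟨
    3072 * 64 ^ s ∎))))
  where
  open ≤-Reasoning
  r X : ℕ
  r = suc a + s
  X = 2 ^ (8 * ω (pred (4 ^ r)))
  H : X * 8192 * 8 ^ s ≤ 9 ^ s
  H = prime-factor-bound {4} {r} (s≤s (s≤s z≤n)) (≤ᵇ⇒≤ 4 8 _) (s≤s z≤n) r≤ s₀≤s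
  2s≤r : 2 * s ≤ r
  2s≤r = ≤-trans (≤-reflexive (cong (s +_) (+-identityʳ s))) (≤-trans 2s≤ (m≤m+n (suc a) s))
  open PropositionalModel (propositionalModel K)
  -- 4 · 1 is the square of 2 · 1, so its vanishing forces characteristic 2.
  2×1≡0 : 2 F.×′ F.1# ≡ F.0#
  2×1≡0 = F.^≡0⇒≡0 2 (trans (cong (2 F.×′ F.1# F.*_) (F.*-identityʳ _))
    (trans (sym (F.×1-homo-* 2 2)) (F.q×1≡0 4 r |els|≡n)))
  additive : F.Additive (2 ^ r)
  additive = F.Additive-^ {2} (F.frobenius₂ 2×1≡0) r

-- The characteristic is 5 itself, so for odd r no power of it equals √Q; M and M′ are the powers
-- with exponents ⌊r/2⌋ and ⌈r/2⌉.
case₅ : ∀ {a s} → s + s ≤ suc a → suc a + s ≤ 2 + 3 * s → s₀ ≤ s →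
        (K : FiniteField (5 ^ (suc a + s))) (A : Fin (suc a + s) → AffineHyperplane K 5) → GeneralPosition K A →
        ∃ λ x → Primitive K x × Avoids K A x
case₅ {a} {s} 2s≤ r≤ s₀≤s K A general = primitive-if-large (s≤s (s≤s z≤n)) 2s≤ K A general
  {5 ^ h} {5 ^ h′} {{m^n≢0 5 h}} (trans (sym (^-distribˡ-+-* 5 h h′)) (cong (5 ^_) (⌊n/2⌋+⌈n/2⌉≡n r))) additive
  (^-monoʳ-≤ 5 s≤h) (^-monoʳ-≤ 5 (⌊n/2⌋≤⌈n/2⌉ r))
  (move-constant {640} {X} {5 ^ h′} (subst (X * (640 * 5 ^ h′) ≤_) (square^ 4 s) (scaled {X} {7680} {s} {12} {16} H (≤ᵇ⇒≤ 108 128 _) (≤ᵇ⇒≤ 7680 8192 _) (begin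
    640 * 5 ^ h′ ≤⟨ *-monoʳ-≤ 640 5^h′≤ ⟩
    640 * (12 * 12 ^ s) ≡⟨ *-assoc 640 12 (12 ^ s) ⟨
    7680 * 12 ^ s ∎))))
  (move-constant {192} {X} {5 ^ r} (subst (X * (192 * 5 ^ r) ≤_) (fourth^ 4 s) (scaled {X} {4800} {s} {125} {256} H (≤ᵇ⇒≤ 1125 2048 _) (≤ᵇ⇒≤ 4800 8192 _) (begin
    192 * 5 ^ r ≤⟨ *-monoʳ-≤ 192 (q^r≤ 5 {r} {s} r≤) ⟩
    192 * (25 * 125 ^ s) ≡⟨ *-assoc 192 25 (125 ^ s) ⟨
    4800 * 125 ^ s ∎))))
  where
  open ≤-Reasoning
  r h h′ X : ℕ
  r  = suc a + s
  h  = ⌊ r /2⌋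
  h′ = ⌈ r /2⌉
  X  = 2 ^ (8 * ω (pred (5 ^ r)))
  H : X * 8192 * 8 ^ s ≤ 9 ^ s
  H = prime-factor-bound {5} {r} (s≤s (s≤s z≤n)) (≤ᵇ⇒≤ 5 8 _) (s≤s z≤n) r≤ s₀≤s
  s≤h : s ≤ h
  s≤h = ≤-trans (≤-reflexive (n≡⌊n+n/2⌋ s)) (⌊n/2⌋-mono (≤-trans 2s≤ (m≤m+n (suc a) s)))
  h′+h′≤ : h′ + h′ ≤ 3 * suc s
  h′+h′≤ = begin
    h′ + h′ ≤⟨ +-monoˡ-≤ h′ (⌈n/2⌉≤1+⌊n/2⌋ r) ⟩
    suc (h + h′) ≡⟨ cong suc (⌊n/2⌋+⌈n/2⌉≡n r) ⟩
    suc r ≤⟨ s≤s r≤ ⟩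
    3 + 3 * s ≡⟨ *-suc 3 s ⟨
    3 * suc s ∎
  -- √125 is replaced by the integer 12, which still leaves the ratio 16/12 above 9/8. Comparing
  -- squares avoids half-integral exponents.
  5^h′≤ : 5 ^ h′ ≤ 12 * 12 ^ s
  5^h′≤ = square-cancel-≤ (begin
    5 ^ h′ * 5 ^ h′ ≡⟨ ^-distribˡ-+-* 5 h′ h′ ⟨
    5 ^ (h′ + h′) ≤⟨ ^-monoʳ-≤ 5 h′+h′≤ ⟩
    5 ^ (3 * suc s) ≡⟨ ^-*-assoc 5 3 (suc s) ⟨
    125 ^ suc s ≤⟨ ^-monoˡ-≤ (suc s) (≤ᵇ⇒≤ 125 144 _) ⟩
    144 ^ suc s ≡⟨ square^ 12 (suc s) ⟩
    12 ^ suc s * 12 ^ suc s ∎)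
  open PropositionalModel (propositionalModel K)
  additive : F.Additive (5 ^ h)
  additive = F.Additive-^ {5} (F.frobenius₅ (F.q×1≡0 5 r |els|≡n)) h

-- The remainder t of r modulo 3 goes to the block of U: its length is a + 1 = 2s + t, and that of V
-- is s.
split-dimension : ∀ {r} s t → r ≡ t + s * 3 → t < 3 → 1 ≤ s →
                  ∃ λ a → suc a + s ≡ r × s + s ≤ suc a × suc a + s ≤ 2 + 3 * s
split-dimension s@(suc s′) t refl t<3 _ = s′ + s + t , lem s′ t , m≤m+n (s + s) t , (begin
  suc (s′ + s + t) + s ≡⟨ lem s′ t ⟩
  t + s * 3 ≤⟨ +-mono-≤ (≤-pred t<3) (≤-reflexive (*-comm s 3)) ⟩
  2 + 3 * s ∎)
  where
  open ≤-Reasoning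
  lem : ∀ s t → suc (s + suc s + t) + suc s ≡ t + suc s * 3
  lem = solve-∀

s₀≤r/3 : ∀ {r} → s₀ * 3 ≤ r → s₀ ≤ r / 3
s₀≤r/3 le = ≤-trans (≤-reflexive (sym (m*n/n≡m s₀ 3))) (/-monoˡ-≤ 3 le)

theorem3p3 : (q : ℕ) → (q ≡ 4 ⊎ q ≡ 5) →
    ∃ λ (R : ℕ) → ∀ (r : ℕ) → R ≤ r →
    (K : FiniteField (q ^ r)) →
    (A : Fin r → AffineHyperplane K q) →
    GeneralPosition K A →
    ∃ λ (g : FiniteField.Carrier K) → Primitive K g × Avoids K A g
-- R = 3 s₀ ensures that s = ⌊r/3⌋ reaches the threshold s₀.
theorem3p3 q q≡ = s₀ * 3 , λ r R≤r →
  let s₀≤s = s₀≤r/3 R≤r in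
  by-splitting q≡ (r / 3) s₀≤s (split-dimension (r / 3) (r % 3) (m≡m%n+[m/n]*n r 3) (m%n<n r 3) (≤-trans 1≤s₀ s₀≤s))
  where
  by-splitting : ∀ {q r} → (q ≡ 4 ⊎ q ≡ 5) → ∀ s → s₀ ≤ s →
    (∃ λ a → suc a + s ≡ r × s + s ≤ suc a × suc a + s ≤ 2 + 3 * s) →
    (K : FiniteField (q ^ r)) (A : Fin r → AffineHyperplane K q) → GeneralPosition K A →
    ∃ λ (g : FiniteField.Carrier K) → Primitive K g × Avoids K A g
  by-splitting (inj₁ refl) s s₀≤s (a , refl , 2s≤ , r≤) = case₄ 2s≤ r≤ s₀≤s
  by-splitting (inj₂ refl) s s₀≤s (a , refl , 2s≤ , r≤) = case₅ 2s≤ r≤ s₀≤s
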